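{- There exists a (randomized) streaming algorithm that, given $n$ elements arriving one by one in a stream in arbitrary order, an integer parameter $k\ge 1$, a noise parameter $\gamma\in(0,1/2]$, and a confidence parameter $\delta\in(0,1)$, with probability at least $1-\delta$ finds the $k$ largest elements of the underlying total order in the noisy comparison model, using a memory of $O(k)$ elements and $O\!\left(\frac{n}{\gamma^2}\cdot\log(k/\delta)\right)$ noisy comparisons.
   Context: Noisy comparison model. There are $n$ elements with an unknown total order. The algorithm may query any pair of elements available to it; for each query, independently of the other queries, the answer agrees with the underlying total order with probability $1/2+\gamma$, and with the remaining probability the answer is arbitrary. The parameters $n,k,\gamma,\delta$ are known to the algorithm. Streaming model. The elements arrive one by one in a stream. To query a pair of elements, both elements must be available at that time, i.e., each is stored in the memory or is the currently arriving element; an element that is not stored, or that is removed from memory, is no longer accessible. The memory is the maximum number of elements stored at any point (auxiliary information such as counters is not counted). The output is the set of the $k$ largest elements, $k\le n$. $O(\cdot)$ hides absolute constants. -}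

module Defs where

open import Data.Bool using (Bool; true; false; if_then_else_)
open import Data.Fin using (Fin; toℕ)
open import Data.Fin.Properties using (all?)
open import Data.Fin.Subset using (Subset; _∈_; _∉_; _⊆_; _∪_; ⁅_⁆; _-_; ∣_∣; ⊥)
open import Data.Fin.Subset.Properties using (_∈?_)
open import Data.Integer using (+_)
open import Data.List using (List; []; _∷_)
open import Data.Nat as ℕ using (ℕ; zero; suc; _≤_; _<_; _⊔_)
open import Data.Nat.Properties as ℕₚ using ()
open import Data.Product using (∃; _×_; _,_)
open import Data.Rational as ℚ using (ℚ; 0ℚ; 1ℚ; ½)
open import Data.Rational.Properties as ℚₚ using ()
open import Data.Rational.Solver using (module +-*-Solver)
open import Data.Sum using (_⊎_)
open import Data.Vec.Functional using (foldr)
open import Function using (const)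
open import Level using (0ℓ)
open import Relation.Binary using (Rel; IsStrictTotalOrder)
open import Relation.Binary.PropositionalEquality
  using (_≡_; _≢_; refl; sym; trans; cong; cong₂; subst; subst₂)
open import Relation.Nullary using (Dec; does; ¬?)
open import Relation.Nullary.Decidable using (_×-dec_; _→-dec_)

IsCauchy : (ℕ → ℚ) → Set
IsCauchy x = ∀ ε → 0ℚ ℚ.< ε →
  ∃ λ N → ∀ m n → N ≤ m → N ≤ n → ℚ.∣ x m ℚ.- x n ∣ ℚ.< ε

record ℝ : Set where
  constructor real
  field
    seq    : ℕ → ℚ
    cauchy : IsCauchy seq

open ℝ public

infix 4 _≤ᵣ_ _<ᵣ_

_≤ᵣ_ : ℝ → ℝ → Set
x ≤ᵣ y = ∀ ε → 0ℚ ℚ.< ε →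
  ∃ λ N → ∀ m → N ≤ m → seq x m ℚ.≤ seq y m ℚ.+ ε

_<ᵣ_ : ℝ → ℝ → Set
x <ᵣ y = ∃ λ ε → 0ℚ ℚ.< ε ×
  ∃ λ N → ∀ m → N ≤ m → seq x m ℚ.+ ε ℚ.≤ seq y m

private
  ½-pos : ∀ ε → 0ℚ ℚ.< ε → 0ℚ ℚ.< ½ ℚ.* ε
  ½-pos ε ε>0 = subst (ℚ._< ½ ℚ.* ε) (ℚₚ.*-zeroʳ ½) (ℚₚ.*-monoʳ-<-pos ½ ε>0)

  halves : ∀ ε → ½ ℚ.* ε ℚ.+ ½ ℚ.* ε ≡ ε
  halves ε = trans (sym (ℚₚ.*-distribʳ-+ ε ½ ½)) (ℚₚ.*-identityˡ ε)

  const-cauchy : ∀ q → IsCauchy (const q)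
  const-cauchy q ε ε>0 = 0 , λ _ _ _ _ →
    subst (ℚ._< ε) (sym (cong ℚ.∣_∣ (ℚₚ.+-inverseʳ q))) ε>0

  +-cauchy : ∀ x y → IsCauchy x → IsCauchy y → IsCauchy (λ n → x n ℚ.+ y n)
  +-cauchy x y cx cy ε ε>0
    with cx (½ ℚ.* ε) (½-pos ε ε>0) | cy (½ ℚ.* ε) (½-pos ε ε>0)
  ... | N , hx | M , hy = N ⊔ M , λ m n p q →
    subst₂ ℚ._<_ refl (halves ε)
      (ℚₚ.≤-<-trans
        (subst (ℚ._≤ (ℚ.∣ x m ℚ.- x n ∣ ℚ.+ ℚ.∣ y m ℚ.- y n ∣))
          (cong ℚ.∣_∣ (rearrange (x m) (x n) (y m) (y n)))
          (ℚₚ.∣p+q∣≤∣p∣+∣q∣ (x m ℚ.- x n) (y m ℚ.- y n)))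
        (ℚₚ.+-mono-<
          (hx m n (ℕₚ.≤-trans (ℕₚ.m≤m⊔n N M) p) (ℕₚ.≤-trans (ℕₚ.m≤m⊔n N M) q))
          (hy m n (ℕₚ.≤-trans (ℕₚ.m≤n⊔m N M) p) (ℕₚ.≤-trans (ℕₚ.m≤n⊔m N M) q))))
    where
    open +-*-Solver
    rearrange : ∀ a b c d → (a ℚ.- b) ℚ.+ (c ℚ.- d) ≡ (a ℚ.+ c) ℚ.- (b ℚ.+ d)
    rearrange = solve 4 (λ a b c d → (a :- b) :+ (c :- d) := (a :+ c) :- (b :+ d)) refl

  neg-cauchy : ∀ x → IsCauchy x → IsCauchy (λ n → ℚ.- x n)
  neg-cauchy x cx ε ε>0 with cx ε ε>0
  ... | N , h = N , λ m n p q →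
    subst (ℚ._< ε)
      (trans (sym (ℚₚ.∣-p∣≡∣p∣ (x m ℚ.- x n))) (cong ℚ.∣_∣ (rearrange (x m) (x n))))
      (h m n p q)
    where
    open +-*-Solver
    rearrange : ∀ a b → ℚ.- (a ℚ.- b) ≡ (ℚ.- a) ℚ.- (ℚ.- b)
    rearrange = solve 2 (λ a b → :- (a :- b) := (:- a) :- (:- b)) refl

  EventuallyBelow : (ℕ → ℚ) → ℚ → Set
  EventuallyBelow x B = ∃ λ N → ∀ n → N ≤ n → ℚ.∣ x n ∣ ℚ.≤ B

  bounded : ∀ x → IsCauchy x → ∃ λ B → 0ℚ ℚ.< B × EventuallyBelow x B
  bounded x cx with cx 1ℚ (ℚₚ.positive⁻¹ 1ℚ)
  ... | N , h = 1ℚ ℚ.+ ℚ.∣ x N ∣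
    , ℚₚ.<-≤-trans (ℚₚ.positive⁻¹ 1ℚ)
        (subst (ℚ._≤ 1ℚ ℚ.+ ℚ.∣ x N ∣) (ℚₚ.+-identityʳ 1ℚ)
          (ℚₚ.+-monoʳ-≤ 1ℚ (ℚₚ.0≤∣p∣ (x N))))
    , N , λ n p → ℚₚ.≤-trans
        (subst (ℚ._≤ ℚ.∣ x n ℚ.- x N ∣ ℚ.+ ℚ.∣ x N ∣)
          (cong ℚ.∣_∣ (rearrange (x n) (x N)))
          (ℚₚ.∣p+q∣≤∣p∣+∣q∣ (x n ℚ.- x N) (x N)))
        (ℚₚ.+-monoˡ-≤ ℚ.∣ x N ∣ (ℚₚ.<⇒≤ (h n N p ℕₚ.≤-refl)))
    where
    open +-*-Solver
    rearrange : ∀ a b → (a ℚ.- b) ℚ.+ b ≡ a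
    rearrange = solve 2 (λ a b → (a :- b) :+ b := a) refl

  share : ∀ B → 0ℚ ℚ.< B → ∀ ε → 0ℚ ℚ.< ε →
          ∃ λ η → 0ℚ ℚ.< η × B ℚ.* η ≡ ε
  share B B>0 ε ε>0 =
    η , ℚₚ.positive⁻¹ η {{ℚₚ.pos*pos⇒pos (ℚ.1/ B) {{ℚₚ.1/pos⇒pos B}} ε}} ,
    trans (sym (ℚₚ.*-assoc B (ℚ.1/ B) ε))
      (trans (cong (ℚ._* ε) (ℚₚ.*-inverseʳ B)) (ℚₚ.*-identityˡ ε))
    where
    instance
      B-pos : ℚ.Positive B
      B-pos = ℚ.positive B>0
      B-nonZero : ℚ.NonZero B
      B-nonZero = ℚₚ.pos⇒nonZero B
      ε-pos : ℚ.Positive ε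
      ε-pos = ℚ.positive ε>0
    η : ℚ
    η = ℚ.1/ B ℚ.* ε

  ∣*∣-bound : ∀ {B η} a b → 0ℚ ℚ.< B → ℚ.∣ a ∣ ℚ.≤ B → ℚ.∣ b ∣ ℚ.< η →
              ℚ.∣ a ℚ.* b ∣ ℚ.< B ℚ.* η
  ∣*∣-bound {B} {η} a b B>0 a≤B b<η =
    subst (ℚ._< B ℚ.* η) (sym (ℚₚ.∣p*q∣≡∣p∣*∣q∣ a b))
      (ℚₚ.≤-<-trans
        (ℚₚ.*-monoʳ-≤-nonNeg ℚ.∣ b ∣ {{ℚₚ.∣-∣-nonNeg b}} a≤B)
        (ℚₚ.*-monoʳ-<-pos B {{ℚ.positive B>0}} b<η))

  *-close : ∀ a b c d {B D η θ ε} → 0ℚ ℚ.< B → 0ℚ ℚ.< D →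
            B ℚ.* η ≡ ½ ℚ.* ε → D ℚ.* θ ≡ ½ ℚ.* ε →
            ℚ.∣ a ∣ ℚ.≤ B → ℚ.∣ d ∣ ℚ.≤ D →
            ℚ.∣ c ℚ.- d ∣ ℚ.< η → ℚ.∣ a ℚ.- b ∣ ℚ.< θ →
            ℚ.∣ a ℚ.* c ℚ.- b ℚ.* d ∣ ℚ.< ε
  *-close a b c d {B} {D} {η} {θ} {ε} B>0 D>0 Bη Dθ a≤B d≤D c-d a-b = begin-strict
    ℚ.∣ a ℚ.* c ℚ.- b ℚ.* d ∣                              ≡⟨ cong ℚ.∣_∣ (rearrange a b c d) ⟨
    ℚ.∣ a ℚ.* (c ℚ.- d) ℚ.+ d ℚ.* (a ℚ.- b) ∣              ≤⟨ ℚₚ.∣p+q∣≤∣p∣+∣q∣ (a ℚ.* (c ℚ.- d)) (d ℚ.* (a ℚ.- b)) ⟩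
    ℚ.∣ a ℚ.* (c ℚ.- d) ∣ ℚ.+ ℚ.∣ d ℚ.* (a ℚ.- b) ∣        <⟨ ℚₚ.+-mono-< (∣*∣-bound a (c ℚ.- d) B>0 a≤B c-d) (∣*∣-bound d (a ℚ.- b) D>0 d≤D a-b) ⟩
    B ℚ.* η ℚ.+ D ℚ.* θ                                    ≡⟨ cong₂ ℚ._+_ Bη Dθ ⟩
    ½ ℚ.* ε ℚ.+ ½ ℚ.* ε                                    ≡⟨ halves ε ⟩
    ε                                                      ∎
    where
    open ℚₚ.≤-Reasoning
    open +-*-Solver
      using (solve; _:+_; _:-_; _:*_; _:=_)
    rearrange : ∀ a b c d →
      a ℚ.* (c ℚ.- d) ℚ.+ d ℚ.* (a ℚ.- b) ≡ a ℚ.* c ℚ.- b ℚ.* d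
    rearrange = solve 4 (λ a b c d →
      a :* (c :- d) :+ d :* (a :- b) := a :* c :- b :* d) refl

  *-cauchy : ∀ x y → IsCauchy x → IsCauchy y → IsCauchy (λ n → x n ℚ.* y n)
  *-cauchy x y cx cy ε ε>0 =
    let B , B>0 , N₁ , hB = bounded x cx
        D , D>0 , N₂ , hD = bounded y cy
        η , η>0 , Bη      = share B B>0 (½ ℚ.* ε) (½-pos ε ε>0)
        θ , θ>0 , Dθ      = share D D>0 (½ ℚ.* ε) (½-pos ε ε>0)
        N₃ , hy           = cy η η>0
        N₄ , hx           = cx θ θ>0
        N₁₂ = N₁ ⊔ N₂
        N₃₄ = N₃ ⊔ N₄
    in N₁₂ ⊔ N₃₄ , λ m n p q →
      let p₁₂ = ℕₚ.m⊔n≤o⇒m≤o N₁₂ N₃₄ p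
          p₃₄ = ℕₚ.m⊔n≤o⇒n≤o N₁₂ N₃₄ p
          q₁₂ = ℕₚ.m⊔n≤o⇒m≤o N₁₂ N₃₄ q
          q₃₄ = ℕₚ.m⊔n≤o⇒n≤o N₁₂ N₃₄ q
      in *-close (x m) (x n) (y m) (y n) B>0 D>0 Bη Dθ
           (hB m (ℕₚ.m⊔n≤o⇒m≤o N₁ N₂ p₁₂))
           (hD n (ℕₚ.m⊔n≤o⇒n≤o N₁ N₂ q₁₂))
           (hy m n (ℕₚ.m⊔n≤o⇒m≤o N₃ N₄ p₃₄) (ℕₚ.m⊔n≤o⇒m≤o N₃ N₄ q₃₄))
           (hx m n (ℕₚ.m⊔n≤o⇒n≤o N₃ N₄ p₃₄) (ℕₚ.m⊔n≤o⇒n≤o N₃ N₄ q₃₄))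

infixl 6 _+ᵣ_ _-ᵣ_
infixl 7 _*ᵣ_
infixr 8 _^ᵣ_

fromℚ : ℚ → ℝ
fromℚ q = real (const q) (const-cauchy q)

fromℕ : ℕ → ℝ
fromℕ n = fromℚ (+ n ℚ./ 1)

0ᵣ 1ᵣ ½ᵣ : ℝ
0ᵣ = fromℚ 0ℚ
1ᵣ = fromℚ 1ℚ
½ᵣ = fromℚ ½

_+ᵣ_ _-ᵣ_ _*ᵣ_ : ℝ → ℝ → ℝ
x +ᵣ y = real (λ n → seq x n ℚ.+ seq y n)
  (+-cauchy (seq x) (seq y) (cauchy x) (cauchy y))
x -ᵣ y = real (λ n → seq x n ℚ.- seq y n)
  (+-cauchy (seq x) (λ n → ℚ.- seq y n) (cauchy x) (neg-cauchy (seq y) (cauchy y)))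
x *ᵣ y = real (λ n → seq x n ℚ.* seq y n)
  (*-cauchy (seq x) (seq y) (cauchy x) (cauchy y))

_^ᵣ_ : ℝ → ℕ → ℝ
x ^ᵣ zero  = 1ᵣ
x ^ᵣ suc n = x *ᵣ x ^ᵣ n

-- log₂ (x / y) ≤ a / b, for x , y > 0 and b > 0, i.e. (x / y) ^ b ≤ 2 ^ a.
Log₂[_/_]≤_/_ : ℝ → ℝ → ℕ → ℕ → Set
Log₂[ x / y ]≤ a / b = x ^ᵣ b ≤ᵣ fromℕ 2 ^ᵣ a *ᵣ y ^ᵣ b

-- Elements are named by their arrival position: Fin n lists the stream in
-- order of arrival.  `Program n t M` is (the rest of) an algorithm after t
-- arrivals, when M is the set of elements in memory; the t-th arrival is the
-- current element.

IsCurrent : ∀ {n} → ℕ → Fin n → Set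
IsCurrent t i = suc (toℕ i) ≡ t

Available : ∀ {n} → ℕ → Subset n → Fin n → Set
Available t M i = i ∈ M ⊎ IsCurrent t i

data Program (n : ℕ) : ℕ → Subset n → Set where
  -- Move on to the next arrival; an element that was not stored is lost.
  next    : ∀ {t M} → t < n → Program n (suc t) M → Program n t M
  store   : ∀ {t M} (i : Fin n) → IsCurrent t i →
            Program n t (M ∪ ⁅ i ⁆) → Program n t M
  discard : ∀ {t M} (i : Fin n) → Program n t (M - i) → Program n t M
  -- Ask whether i is smaller than j, and continue according to the answer.
  query   : ∀ {t M} (i j : Fin n) → i ≢ j →
            Available t M i → Available t M j →
            (Bool → Program n t M) → Program n t M
  -- Draw uniformly from Fin (suc m).
  random  : ∀ {t M} (m : ℕ) → (Fin (suc m) → Program n t M) → Program n t M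
  -- After the whole stream, output a set of elements held in memory.
  output  : ∀ {M} (S : Subset n) → S ⊆ M → Program n n M

StreamingAlgorithm : ℕ → Set
StreamingAlgorithm n = Program n 0 ⊥

-- Both resources are worst-case: maxima over all draws and all answers.

peakMemory : ∀ {n t M} → Program n t M → ℕ
peakMemory {M = M} (next _ P)          = ∣ M ∣ ⊔ peakMemory P
peakMemory {M = M} (store _ _ P)       = ∣ M ∣ ⊔ peakMemory P
peakMemory {M = M} (discard _ P)       = ∣ M ∣ ⊔ peakMemory P
peakMemory {M = M} (query _ _ _ _ _ P) = ∣ M ∣ ⊔ (peakMemory (P true) ⊔ peakMemory (P false))
peakMemory {M = M} (random _ P)        = ∣ M ∣ ⊔ foldr _⊔_ 0 (λ x → peakMemory (P x))
peakMemory {M = M} (output _ _)        = ∣ M ∣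

comparisons : ∀ {n t M} → Program n t M → ℕ
comparisons (next _ P)          = comparisons P
comparisons (store _ _ P)       = comparisons P
comparisons (discard _ P)       = comparisons P
comparisons (query _ _ _ _ _ P) = suc (comparisons (P true) ⊔ comparisons (P false))
comparisons (random _ P)        = foldr _⊔_ 0 (λ x → comparisons (P x))
comparisons (output _ _)        = 0

data Outcome : Set where
  truthful  : Outcome
  corrupted : Outcome
  drawn     : ℕ → Outcome

-- The answer to each corrupted query may depend on everything that happened
-- before it: for a fixed program and order, the past draws and the past
-- corruptions (most recent first) determine the whole past of the execution.
Adversary : Set
Adversary = List Outcome → Bool

module _ {n : ℕ} {_≺_ : Rel (Fin n) 0ℓ} (order : IsStrictTotalOrder _≡_ _≺_) where

  open IsStrictTotalOrder order using (_<?_)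

  IsLargest : ℕ → Subset n → Set
  IsLargest k S = ∣ S ∣ ≡ k × (∀ i → i ∈ S → ∀ j → j ∉ S → j ≺ i)

  isLargest? : ∀ k S → Dec (IsLargest k S)
  isLargest? k S = (∣ S ∣ ℕ.≟ k) ×-dec
    all? (λ i → (i ∈? S) →-dec all? (λ j → ¬? (j ∈? S) →-dec (j <? i)))

  -- Each query is truthful with probability ½ + γ, independently of the history.
  successProbabilityFrom : ∀ {t M} → List Outcome → (γ : ℝ) (k : ℕ) → Adversary →
                           Program n t M → ℝ
  successProbabilityFrom h γ k adv (next _ P)    = successProbabilityFrom h γ k adv P
  successProbabilityFrom h γ k adv (store _ _ P) = successProbabilityFrom h γ k adv P
  successProbabilityFrom h γ k adv (discard _ P) = successProbabilityFrom h γ k adv P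
  successProbabilityFrom h γ k adv (query i j _ _ _ P) =
    (½ᵣ +ᵣ γ) *ᵣ successProbabilityFrom (truthful ∷ h) γ k adv (P (does (i <? j))) +ᵣ
    (½ᵣ -ᵣ γ) *ᵣ successProbabilityFrom (corrupted ∷ h) γ k adv (P (adv h))
  successProbabilityFrom h γ k adv (random m P) =
    fromℚ (+ 1 ℚ./ suc m) *ᵣ
    foldr _+ᵣ_ 0ᵣ (λ x → successProbabilityFrom (drawn (toℕ x) ∷ h) γ k adv (P x))
  successProbabilityFrom h γ k adv (output S _) =
    if does (isLargest? k S) then 1ᵣ else 0ᵣ

  successProbability : (γ : ℝ) (k : ℕ) → Adversary → StreamingAlgorithm n → ℝ
  successProbability = successProbabilityFrom []

record Parameters : Set where
  field
    n k : ℕ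
    γ δ : ℝ
    1≤k : 1 ≤ k
    k≤n : k ≤ n
    0<γ : 0ᵣ <ᵣ γ
    γ≤½ : γ ≤ᵣ ½ᵣ
    0<δ : 0ᵣ <ᵣ δ
    δ<1 : δ <ᵣ 1ᵣ

-- q ≤ c · (n / γ²) · log₂ (k / δ).  Here log₂ (k / δ) > 0 is the infimum of the
-- rationals a / b above it, so the bound says q ≤ c · (n / γ²) · (a / b) for
-- each of these; the division by γ² > 0 is cleared.
ComparisonBound : Parameters → (c q : ℕ) → Set
ComparisonBound p c q = ∀ a b → Log₂[ fromℕ k / δ ]≤ a / suc b →
  fromℕ q *ᵣ (γ *ᵣ γ) ≤ᵣ fromℕ c *ᵣ fromℕ n *ᵣ fromℚ (+ a ℚ./ suc b)
  where open Parameters p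

{-# OPTIONS --safe #-}
-- Every element arrives with a score of h points.  Whenever the memory holds 16k elements, two
-- of them are drawn uniformly at random and compared by a majority vote over O(1/γ²) queries; the
-- winner gains one point, the loser pays two, and an element without points is discarded.  Each
-- such duel lowers the total score, so there are O(nh) of them, whatever the answers are.  An
-- element of the top k mostly meets weaker opponents, and the sum of 2^(-score) over the top k is
-- a supermartingale: they all survive, for a stream of any length, except with probability k/2^h.
-- At the end, median-of-medians selection makes O(k) comparisons, each decided by a vote over
-- O(h/γ²) queries.  With h of the order of log (k/δ) both bounds follow; only for k = 1 and δ close
-- to 1, where log (k/δ) is about 1 - δ, the algorithm restricts itself to a random block of the stream.
module Submission where

open import Defs
open import Data.Nat.Properties as ℕₚ using ()
open import Data.Nat.Solver using () renaming (module +-*-Solver to ℕ-Solver)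
open import Data.Rational.Solver using () renaming (module +-*-Solver to ℚ-Solver)
open import Level using (0ℓ)
open import Relation.Binary using (Rel; IsStrictTotalOrder)

-- A union bound over the arrivals would cost `log (n/δ)` votes per arrival. Points remove the
-- dependence on `n`: a top element may fight any number of duels, each of constant error, because
-- one point won and two points lost change `2 ^ (- score)` by the factors 1/2 and 4, whose mean
-- against a weaker opponent is below 1. Duels among top elements can push the sum up. A memory of
-- 16k makes them rare enough: for a uniformly random pair the bound on the mean change splits into
-- (sum of weights) times (sum of charges), and the second factor is at most 0 whatever the scores
-- are.
--
-- Two obstacles shape the proof. The adversary sees the history, so failure bounds are carried
-- backwards through the program and hold from every history. And `γ`, `δ` are Cauchy sequences,
-- whose order cannot be decided: the algorithm sees only powers of two within constant factors of
-- `γ`, `δ` or `1 - δ`, and the logarithm occurs only through the fractions above it.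

-- Rational arithmetic and powers of 1/2

module RationalArithmetic where

  open import Data.Integer as ℤ using (+_)
  open import Data.Integer.Properties as ℤₚ using ()
  open import Data.Nat as ℕ using (ℕ; zero; suc)
  open import Data.Rational
  open import Data.Rational.Properties
  open import Data.Rational.Unnormalised as ℚᵘ using (mkℚᵘ; *≡*; *≤*)
  open import Data.Rational.Unnormalised.Properties as ℚᵘₚ using ()
  open import Algebra.Bundles using (CommutativeRing)
  open import Relation.Binary.PropositionalEquality

  open import Algebra.Properties.CommutativeSemiring.Exp
    (CommutativeRing.commutativeSemiring +-*-commutativeRing) public
    using (_^_; ^-homo-*; ^-assocʳ; ^-distrib-*)

  ≤-by-gap : ∀ {p q} r → 0ℚ ≤ r → p + r ≡ q → p ≤ q
  ≤-by-gap {p} r 0≤r refl = subst (_≤ p + r) (+-identityʳ p) (+-monoʳ-≤ p 0≤r)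

  p≤q⇒0≤q-p : ∀ {p q} → p ≤ q → 0ℚ ≤ q - p
  p≤q⇒0≤q-p {p} {q} p≤q = subst (_≤ q - p) (+-inverseʳ p) (+-monoˡ-≤ (- p) p≤q)

  0≤+ : ∀ {p q} → 0ℚ ≤ p → 0ℚ ≤ q → 0ℚ ≤ p + q
  0≤+ = +-mono-≤

  0≤* : ∀ {p q} → 0ℚ ≤ p → 0ℚ ≤ q → 0ℚ ≤ p * q
  0≤* {p} {q} 0≤p 0≤q =
    nonNegative⁻¹ (p * q) {{nonNeg*nonNeg⇒nonNeg p {{nonNegative 0≤p}} q {{nonNegative 0≤q}}}}

  0<* : ∀ {p q} → 0ℚ < p → 0ℚ < q → 0ℚ < p * q
  0<* {p} {q} 0<p 0<q =
    positive⁻¹ (p * q) {{pos*pos⇒pos p {{positive 0<p}} q {{positive 0<q}}}}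

  *-mono-≤ : ∀ {p q r s} → 0ℚ ≤ p → 0ℚ ≤ s → p ≤ q → r ≤ s → p * r ≤ q * s
  *-mono-≤ {p} {q} {r} {s} 0≤p 0≤s p≤q r≤s = ≤-trans
    (*-monoˡ-≤-nonNeg p {{nonNegative 0≤p}} r≤s)
    (*-monoʳ-≤-nonNeg s {{nonNegative 0≤s}} p≤q)

  *-monoˡ : ∀ r {p q} → 0ℚ ≤ r → p ≤ q → r * p ≤ r * q
  *-monoˡ r 0≤r = *-monoˡ-≤-nonNeg r {{nonNegative 0≤r}}

  *-cancelˡ : ∀ r {p q} → 0ℚ < r → r * p ≤ r * q → p ≤ q
  *-cancelˡ r 0<r = *-cancelˡ-≤-pos r {{positive 0<r}}

  0≤^ : ∀ {p} n → 0ℚ ≤ p → 0ℚ ≤ p ^ n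
  0≤^ zero    _   = nonNegative⁻¹ 1ℚ
  0≤^ (suc n) 0≤p = 0≤* 0≤p (0≤^ n 0≤p)

  0<^ : ∀ {p} n → 0ℚ < p → 0ℚ < p ^ n
  0<^ zero    _   = positive⁻¹ 1ℚ
  0<^ (suc n) 0<p = 0<* 0<p (0<^ n 0<p)

  1^ : ∀ n → 1ℚ ^ n ≡ 1ℚ
  1^ zero    = refl
  1^ (suc n) = trans (*-identityˡ _) (1^ n)

  ^-monoˡ-≤ : ∀ {p q} n → 0ℚ ≤ p → p ≤ q → p ^ n ≤ q ^ n
  ^-monoˡ-≤ zero    _   _   = ≤-refl
  ^-monoˡ-≤ (suc n) 0≤p p≤q =
    *-mono-≤ 0≤p (0≤^ n (≤-trans 0≤p p≤q)) p≤q (^-monoˡ-≤ n 0≤p p≤q)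

  1≤^ : ∀ {p} n → 1ℚ ≤ p → 1ℚ ≤ p ^ n
  1≤^ n 1≤p = ≤-trans (≤-reflexive (sym (1^ n))) (^-monoˡ-≤ n (nonNegative⁻¹ 1ℚ) 1≤p)

  ^-anti : ∀ {p m n} → 0ℚ ≤ p → p ≤ 1ℚ → m ℕ.≤ n → p ^ n ≤ p ^ m
  ^-anti {p} {n = n} 0≤p p≤1 ℕ.z≤n = ≤-trans (^-monoˡ-≤ n 0≤p p≤1) (≤-reflexive (1^ n))
  ^-anti {p} 0≤p p≤1 (ℕ.s≤s m≤n) = *-monoˡ p 0≤p (^-anti 0≤p p≤1 m≤n)

  private
    toℚᵘ-ι : ∀ n → toℚᵘ (+ n / 1) ℚᵘ.≃ mkℚᵘ (+ n) 0
    toℚᵘ-ι n = toℚᵘ-fromℚᵘ (mkℚᵘ (+ n) 0)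

  opaque
    -- Opaque, so that the normalised fraction is never computed: calculations go through the
    -- homomorphism laws, and `ι-def` leads back to the fractions of the definitions.
    ι : ℕ → ℚ
    ι n = + n / 1

    ι-def : ∀ n → ι n ≡ + n / 1
    ι-def n = refl

    ι-0 : ι 0 ≡ 0ℚ
    ι-0 = refl

    ι-1 : ι 1 ≡ 1ℚ
    ι-1 = refl

    ι-+ : ∀ m n → ι (m ℕ.+ n) ≡ ι m + ι n
    ι-+ m n = toℚᵘ-injective (ℚᵘₚ.≃-trans (toℚᵘ-ι (m ℕ.+ n))
      (ℚᵘₚ.≃-sym (ℚᵘₚ.≃-trans (toℚᵘ-homo-+ (ι m) (ι n))
        (ℚᵘₚ.≃-trans (ℚᵘₚ.+-cong (toℚᵘ-ι m) (toℚᵘ-ι n))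
          (*≡* (cong (ℤ._* ℤ.1ℤ) (trans (cong₂ ℤ._+_ (ℤₚ.*-identityʳ (+ m)) (ℤₚ.*-identityʳ (+ n)))
            (sym (ℤₚ.pos-+ m n)))))))))

    ι-* : ∀ m n → ι (m ℕ.* n) ≡ ι m * ι n
    ι-* m n = toℚᵘ-injective (ℚᵘₚ.≃-trans (toℚᵘ-ι (m ℕ.* n))
      (ℚᵘₚ.≃-sym (ℚᵘₚ.≃-trans (toℚᵘ-homo-* (ι m) (ι n))
        (ℚᵘₚ.≃-trans (ℚᵘₚ.*-cong (toℚᵘ-ι m) (toℚᵘ-ι n))
          (*≡* (cong (ℤ._* ℤ.1ℤ) (sym (ℤₚ.pos-* m n))))))))

    ι-mono : ∀ {m n} → m ℕ.≤ n → ι m ≤ ι n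
    ι-mono {m} {n} m≤n = toℚᵘ-cancel-≤ (ℚᵘₚ.≤-respˡ-≃ (ℚᵘₚ.≃-sym (toℚᵘ-ι m))
      (ℚᵘₚ.≤-respʳ-≃ (ℚᵘₚ.≃-sym (toℚᵘ-ι n)) (*≤* (ℤₚ.*-monoʳ-≤-nonNeg ℤ.1ℤ (ℤ.+≤+ m≤n)))))

    ι-cancel : ∀ {m n} → ι m ≤ ι n → m ℕ.≤ n
    ι-cancel {m} {n} p with ℚᵘₚ.≤-respˡ-≃ (toℚᵘ-ι m) (ℚᵘₚ.≤-respʳ-≃ (toℚᵘ-ι n) (toℚᵘ-mono-≤ p))
    ... | *≤* q = ℤₚ.drop‿+≤+ (ℤₚ.*-cancelʳ-≤-pos (+ m) (+ n) ℤ.1ℤ q)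

  ι-^ : ∀ m n → ι (m ℕ.^ n) ≡ ι m ^ n
  ι-^ m zero    = ι-1
  ι-^ m (suc n) = trans (ι-* m (m ℕ.^ n)) (cong (ι m *_) (ι-^ m n))

  ι-suc : ∀ n → ι (suc n) ≡ 1ℚ + ι n
  ι-suc n = trans (ι-+ 1 n) (cong (_+ ι n) ι-1)

  0≤ι : ∀ n → 0ℚ ≤ ι n
  0≤ι n = subst (_≤ ι n) ι-0 (ι-mono ℕ.z≤n)

  0<ι : ∀ n → 0ℚ < ι (suc n)
  0<ι n = <-≤-trans (positive⁻¹ 1ℚ) (subst (_≤ ι (suc n)) ι-1 (ι-mono (ℕ.s≤s ℕ.z≤n)))

  opaque
    unfolding ι

    /-cancel : ∀ a b → (+ a / suc b) * ι (suc b) ≡ ι a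
    /-cancel a b = toℚᵘ-injective (ℚᵘₚ.≃-trans (toℚᵘ-homo-* (+ a / suc b) (ι (suc b)))
      (ℚᵘₚ.≃-trans (ℚᵘₚ.*-cong (toℚᵘ-fromℚᵘ (mkℚᵘ (+ a) b)) (toℚᵘ-ι (suc b)))
        (ℚᵘₚ.≃-trans (*≡* (trans (ℤₚ.*-identityʳ (+ a ℤ.* + suc b))
           (cong (λ z → + a ℤ.* + suc z) (sym (ℕₚ.*-identityʳ b)))))
          (ℚᵘₚ.≃-sym (toℚᵘ-ι a)))))

    ½*ι2 : ½ * ι 2 ≡ 1ℚ
    ½*ι2 = refl

  -- From (1 + 1/x)^(x+1) ≥ 1 + (x+1)/x, the Bernoulli inequality, with denominators cleared.
  private
    bernoulli : ∀ x j → (x ℕ.+ j) ℕ.* x ℕ.^ j ℕ.≤ x ℕ.* suc x ℕ.^ j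
    bernoulli x zero = ℕₚ.≤-reflexive (cong (ℕ._* 1) (ℕₚ.+-identityʳ x))
    bernoulli x (suc j) = begin
      (x ℕ.+ suc j) ℕ.* (x ℕ.* x ℕ.^ j)  ≤⟨ ℕₚ.m≤m+n _ (j ℕ.* x ℕ.^ j) ⟩
      (x ℕ.+ suc j) ℕ.* (x ℕ.* x ℕ.^ j) ℕ.+ j ℕ.* x ℕ.^ j ≡⟨ solve 3 (λ x j y → (x :+ (con 1 :+ j)) :* (x :* y) :+ j :* y := (con 1 :+ x) :* ((x :+ j) :* y)) refl x j (x ℕ.^ j) ⟩
      suc x ℕ.* ((x ℕ.+ j) ℕ.* x ℕ.^ j)  ≤⟨ ℕₚ.*-monoʳ-≤ (suc x) (bernoulli x j) ⟩
      suc x ℕ.* (x ℕ.* suc x ℕ.^ j)  ≡⟨ solve 2 (λ x y → (con 1 :+ x) :* (x :* y) := x :* ((con 1 :+ x) :* y)) refl x (suc x ℕ.^ j) ⟩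
      x ℕ.* (suc x ℕ.* suc x ℕ.^ j) ∎
      where
      open ℕₚ.≤-Reasoning
      open ℕ-Solver

  2x^[1+x]≤[1+x]^[1+x] : ∀ x → 2 ℕ.* x ℕ.^ suc x ℕ.≤ suc x ℕ.^ suc x
  2x^[1+x]≤[1+x]^[1+x] zero = ℕ.z≤n
  2x^[1+x]≤[1+x]^[1+x] x@(suc _) = ℕₚ.*-cancelˡ-≤ x (begin
    x ℕ.* (2 ℕ.* x ℕ.^ suc x)  ≡⟨ solve 2 (λ x y → x :* (con 2 :* y) := (x :+ x) :* y) refl x (x ℕ.^ suc x) ⟩
    (x ℕ.+ x) ℕ.* x ℕ.^ suc x  ≤⟨ ℕₚ.*-monoˡ-≤ (x ℕ.^ suc x) (ℕₚ.+-monoʳ-≤ x (ℕₚ.n≤1+n x)) ⟩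
    (x ℕ.+ suc x) ℕ.* x ℕ.^ suc x  ≤⟨ bernoulli x (suc x) ⟩
    x ℕ.* suc x ℕ.^ suc x ∎)
    where
    open ℕₚ.≤-Reasoning
    open ℕ-Solver

  ½^-* : ∀ n → ½ ^ n * ι (2 ℕ.^ n) ≡ 1ℚ
  ½^-* n = trans (cong (½ ^ n *_) (ι-^ 2 n))
    (trans (sym (^-distrib-* ½ (ι 2) n)) (trans (cong (_^ n) ½*ι2) (1^ n)))

  -- Since `r = 1/(N+1)`, multiplying by `(N+1)^(N+1)` leaves the integer inequality above. This is
  -- the exchange rate between small advantages and bits: it gives the number of votes in
  -- `drift-power` and the size of the logarithm near `δ = 1` in `log-lower`.
  [1-r]^N≤½ : ∀ r N → r * ι (suc N) ≡ 1ℚ → (1ℚ - r) ^ suc N ≤ ½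
  [1-r]^N≤½ r N eq = *-cancelˡ (ι (suc N) ^ suc N) (0<^ (suc N) (0<ι N)) (begin
    ι (suc N) ^ suc N * (1ℚ - r) ^ suc N  ≡⟨ sym (^-distrib-* (ι (suc N)) (1ℚ - r) (suc N)) ⟩
    (ι (suc N) * (1ℚ - r)) ^ suc N  ≡⟨ cong (_^ suc N) lem ⟩
    ι N ^ suc N  ≡⟨ sym (ι-^ N (suc N)) ⟩
    ι (N ℕ.^ suc N)  ≡⟨ trans (sym (*-identityˡ _)) (trans (cong (_* ι (N ℕ.^ suc N)) (sym ½*ι2)) (*-assoc ½ (ι 2) _)) ⟩
    ½ * (ι 2 * ι (N ℕ.^ suc N))  ≡⟨ cong (½ *_) (sym (ι-* 2 (N ℕ.^ suc N))) ⟩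
    ½ * ι (2 ℕ.* N ℕ.^ suc N)  ≤⟨ *-monoˡ ½ (nonNegative⁻¹ ½) (ι-mono (2x^[1+x]≤[1+x]^[1+x] N)) ⟩
    ½ * ι (suc N ℕ.^ suc N)  ≡⟨ cong (½ *_) (ι-^ (suc N) (suc N)) ⟩
    ½ * ι (suc N) ^ suc N  ≡⟨ *-comm ½ (ι (suc N) ^ suc N) ⟩
    ι (suc N) ^ suc N * ½ ∎)
    where
    open ≤-Reasoning
    open ℚ-Solver
    lem : ι (suc N) * (1ℚ - r) ≡ ι N
    lem = trans (solve 2 (λ s r → s :* (con 1ℚ :- r) := s :- r :* s) refl (ι (suc N)) r)
      (trans (cong₂ _-_ (ι-suc N) eq) (solve 1 (λ x → (con 1ℚ :+ x) :- con 1ℚ := x) refl (ι N)))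

-- Inequalities between Cauchy reals and dyadic approximation

module RealBounds where

  open import Data.Integer using (+_)
  import Data.Integer as ℤ
  open import Data.Fin using (zero; suc)
  open import Data.Nat as ℕ using (ℕ; zero; suc; _⊔_)
  open import Data.Product using (∃; _×_; _,_; proj₁; proj₂; map₂)
  open import Data.Rational hiding (_⊔_)
  open import Data.Rational.Properties
  open import Data.Sum using (inj₁; inj₂)
  open import Relation.Binary.PropositionalEquality
  open import Relation.Nullary using (yes; no; contradiction)
  open RationalArithmetic
  open ℚ-Solver

  Eventually : (ℕ → Set) → Set
  Eventually P = ∃ λ N → ∀ m → N ℕ.≤ m → P m

  eventually-map₂ : ∀ {P Q R : ℕ → Set} → (∀ {m} → P m → Q m → R m) →
                    Eventually P → Eventually Q → Eventually R
  eventually-map₂ f (M , p) (N , q) = M ⊔ N , λ m ≤m →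
    f (p m (ℕₚ.m⊔n≤o⇒m≤o M N ≤m)) (q m (ℕₚ.m⊔n≤o⇒n≤o M N ≤m))

  eventually-map : ∀ {P Q : ℕ → Set} → (∀ {m} → P m → Q m) → Eventually P → Eventually Q
  eventually-map f = map₂ (λ p m ≤m → f (p m ≤m))

  0<½* : ∀ {ε} → 0ℚ < ε → 0ℚ < ½ * ε
  0<½* = 0<* (positive⁻¹ ½)

  -- Real inequalities are proved by exhibiting the gap as a sum of products of nonnegative reals;
  -- what remains is a termwise polynomial identity.
  ≤ᵣ-by-gap : ∀ {x y} z → 0ᵣ ≤ᵣ z → (∀ m → seq x m + seq z m ≡ seq y m) → x ≤ᵣ y
  ≤ᵣ-by-gap {x} z 0≤z eq ε ε>0 = map₂ (λ h m N≤m → ≤-by-gap (seq z m + ε) (h m N≤m)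
    (trans (sym (+-assoc (seq x m) (seq z m) ε)) (cong (_+ ε) (eq m)))) (0≤z ε ε>0)

  0≤ᵣ-gap : ∀ {x y} → x ≤ᵣ y → 0ᵣ ≤ᵣ y -ᵣ x
  0≤ᵣ-gap {x} {y} x≤y ε ε>0 = map₂ (λ h m N≤m → ≤-trans (p≤q⇒0≤q-p (h m N≤m))
    (≤-reflexive (solve 3 (λ x y ε → (y :+ ε) :- x := (y :- x) :+ ε) refl (seq x m) (seq y m) ε)))
    (x≤y ε ε>0)

  0≤ᵣ-+ : ∀ {x y} → 0ᵣ ≤ᵣ x → 0ᵣ ≤ᵣ y → 0ᵣ ≤ᵣ x +ᵣ y
  0≤ᵣ-+ {x} {y} 0≤x 0≤y ε ε>0 =
    eventually-map₂ (λ {m} p q → ≤-trans (0≤+ p q) (≤-reflexive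
      (solve 3 (λ x y ε → (x :+ con ½ :* ε) :+ (y :+ con ½ :* ε) := (x :+ y) :+ ε) refl
        (seq x m) (seq y m) ε)))
      (0≤x (½ * ε) (0<½* ε>0)) (0≤y (½ * ε) (0<½* ε>0))

  p≤∣p∣ : ∀ p → p ≤ ∣ p ∣
  p≤∣p∣ p with ≤-total 0ℚ p
  ... | inj₁ 0≤p = ≤-reflexive (sym (0≤p⇒∣p∣≡p 0≤p))
  ... | inj₂ p≤0 = ≤-trans p≤0 (0≤∣p∣ p)

  ∣p-q∣<r⇒p≤q+r : ∀ p q {r} → ∣ p - q ∣ < r → p ≤ q + r
  ∣p-q∣<r⇒p≤q+r p q {r} lt = ≤-by-gap (r - (p - q))
    (p≤q⇒0≤q-p (≤-trans (p≤∣p∣ (p - q)) (<⇒≤ lt)))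
    (solve 3 (λ p q r → p :+ (r :- (p :- q)) := q :+ r) refl p q r)

  ∣p-q∣<r⇒q≤p+r : ∀ p q {r} → ∣ p - q ∣ < r → q ≤ p + r
  ∣p-q∣<r⇒q≤p+r p q {r} lt = ∣p-q∣<r⇒p≤q+r q p (subst (_< r)
    (trans (sym (∣-p∣≡∣p∣ (p - q))) (cong ∣_∣ (solve 2 (λ p q → :- (p :- q) := q :- p) refl p q))) lt)

  bounded-above : ∀ x → ∃ λ B → 0ℚ ≤ B × Eventually (λ m → seq x m ≤ B)
  bounded-above x with cauchy x 1ℚ (positive⁻¹ 1ℚ)
  ... | N , h = ∣ seq x N ∣ + 1ℚ , 0≤+ (0≤∣p∣ (seq x N)) (nonNegative⁻¹ 1ℚ) , N , λ m N≤m →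
    ≤-trans (∣p-q∣<r⇒p≤q+r (seq x m) (seq x N) (h m N N≤m ℕₚ.≤-refl))
      (+-monoˡ-≤ 1ℚ (p≤∣p∣ (seq x N)))

  divide : ∀ {T ε} → 0ℚ < T → 0ℚ < ε → ∃ λ η → 0ℚ < η × T * η ≡ ε
  divide {T} {ε} 0<T 0<ε = 1/ T * ε , 0<* (positive⁻¹ (1/ T) {{1/pos⇒pos T}}) 0<ε ,
    trans (sym (*-assoc T (1/ T) ε)) (trans (cong (_* ε) (*-inverseʳ T)) (*-identityˡ ε))
    where
    instance
      T-pos : Positive T
      T-pos = positive 0<T
      T-nonZero : NonZero T
      T-nonZero = pos⇒nonZero T

  -- The terms of the factors are only eventually at least `- η`. From
  -- `x y = (x + η) (y + η) - η (x + y) - η²` and upper bounds `X`, `Y` the loss is at most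
  -- `(1 + X + Y) η` once `η ≤ 1`. Dividing the minimum of `ε` and 1 by `1 + X + Y` yields an `η`
  -- that meets both demands.
  0≤ᵣ-* : ∀ {x y} → 0ᵣ ≤ᵣ x → 0ᵣ ≤ᵣ y → 0ᵣ ≤ᵣ x *ᵣ y
  0≤ᵣ-* {x} {y} 0≤x 0≤y ε ε>0 = eventually-map₂ (λ { {m} (x≤X , -η≤x) (y≤Y , -η≤y) →
      ≤-trans (0≤+ (0≤+ (0≤* -η≤x -η≤y)
          (0≤* 0≤η (0≤+ (p≤q⇒0≤q-p x≤X) (0≤+ (p≤q⇒0≤q-p y≤Y) (p≤q⇒0≤q-p η≤1)))))
          (p≤q⇒0≤q-p Tη≤ε))
        (≤-reflexive (solve 6 (λ x y η X Y ε →
          ((x :+ η) :* (y :+ η) :+ η :* ((X :- x) :+ ((Y :- y) :+ (con 1ℚ :- η)))) :+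
            (ε :- (con 1ℚ :+ (X :+ Y)) :* η) := x :* y :+ ε)
          refl (seq x m) (seq y m) η X Y ε)) })
    (eventually-map₂ _,_ (proj₂ (proj₂ (bounded-above x))) (0≤x η 0<η))
    (eventually-map₂ _,_ (proj₂ (proj₂ (bounded-above y))) (0≤y η 0<η))
    where
    X Y T : ℚ
    X = proj₁ (bounded-above x)
    Y = proj₁ (bounded-above y)
    T = 1ℚ + (X + Y)
    0≤X+Y : 0ℚ ≤ X + Y
    0≤X+Y = 0≤+ (proj₁ (proj₂ (bounded-above x))) (proj₁ (proj₂ (bounded-above y)))
    0<ε⊓1 : 0ℚ < ε ⊓ 1ℚ
    0<ε⊓1 with ⊓-sel ε 1ℚ
    ... | inj₁ eq = subst (0ℚ <_) (sym eq) ε>0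
    ... | inj₂ eq = subst (0ℚ <_) (sym eq) (positive⁻¹ 1ℚ)
    quotient : ∃ λ η → 0ℚ < η × T * η ≡ ε ⊓ 1ℚ
    quotient = divide (<-≤-trans (positive⁻¹ 1ℚ)
      (≤-by-gap (X + Y) 0≤X+Y refl)) 0<ε⊓1
    η : ℚ
    η = proj₁ quotient
    0<η : 0ℚ < η
    0<η = proj₁ (proj₂ quotient)
    0≤η : 0ℚ ≤ η
    0≤η = <⇒≤ 0<η
    Tη≤ε : T * η ≤ ε
    Tη≤ε = ≤-trans (≤-reflexive (proj₂ (proj₂ quotient))) (p⊓q≤p ε 1ℚ)
    η≤1 : η ≤ 1ℚ
    η≤1 = ≤-trans (≤-by-gap ((X + Y) * η) (0≤* 0≤X+Y 0≤η)
      (solve 2 (λ η s → η :+ s :* η := (con 1ℚ :+ s) :* η) refl η (X + Y)))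
      (≤-trans (≤-reflexive (proj₂ (proj₂ quotient))) (p⊓q≤q ε 1ℚ))

  fromℚ-mono : ∀ {p q} → p ≤ q → fromℚ p ≤ᵣ fromℚ q
  fromℚ-mono {p} {q} p≤q ε ε>0 = 0 , λ _ _ → ≤-trans p≤q (≤-by-gap ε (<⇒≤ ε>0) refl)

  ≤ᵣ-trans : ∀ {x y z} → x ≤ᵣ y → y ≤ᵣ z → x ≤ᵣ z
  ≤ᵣ-trans {x} {y} {z} x≤y y≤z = ≤ᵣ-by-gap {x} {z} ((y -ᵣ x) +ᵣ (z -ᵣ y))
    (0≤ᵣ-+ {y -ᵣ x} {z -ᵣ y} (0≤ᵣ-gap {x} {y} x≤y) (0≤ᵣ-gap {y} {z} y≤z))
    (λ m → solve 3 (λ x y z → x :+ ((y :- x) :+ (z :- y)) := z) refl (seq x m) (seq y m) (seq z m))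

  eventually-≤ : ∀ {x y} → Eventually (λ m → seq x m ≤ seq y m) → x ≤ᵣ y
  eventually-≤ ev ε ε>0 = eventually-map (λ p → ≤-trans p (≤-by-gap ε (<⇒≤ ε>0) refl)) ev

  fromℚ-cancel : ∀ {p q} → fromℚ p ≤ᵣ fromℚ q → p ≤ q
  fromℚ-cancel {p} {q} p≤q with p ≤? q
  ... | yes r = r
  ... | no ¬p≤q with <-dense (≰⇒> ¬p≤q)
  ...   | s , q<s , s<p with p≤q (s - q) (subst (_< s - q) (+-inverseʳ q) (+-monoˡ-< (- q) q<s))
  ...     | N , h = contradiction (<-≤-trans s<p (≤-trans (h N ℕₚ.≤-refl)
                (≤-reflexive (solve 2 (λ q s → q :+ (s :- q) := s) refl q s)))) (<-irrefl refl)

  -- The denominator serves as the exponent: it is at most its own power of two, and the numerator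
  -- is at least 1.
  ½^-archimedean : ∀ q → 0ℚ < q → ∃ λ D → ½ ^ D ≤ q
  ½^-archimedean q@(mkℚ (+ suc a) b _) _ = suc b , *-cancelˡ (ι (suc b)) (0<ι b) (begin
    ι (suc b) * ½ ^ suc b  ≤⟨ *-monoʳ-≤-nonNeg (½ ^ suc b) {{nonNegative (0≤^ (suc b) (nonNegative⁻¹ ½))}} (ι-mono (n≤2^n (suc b))) ⟩
    ι (2 ℕ.^ suc b) * ½ ^ suc b  ≡⟨ *-comm (ι (2 ℕ.^ suc b)) (½ ^ suc b) ⟩
    ½ ^ suc b * ι (2 ℕ.^ suc b)  ≡⟨ ½^-* (suc b) ⟩
    1ℚ  ≡⟨ sym ι-1 ⟩
    ι 1  ≤⟨ ι-mono {1} {suc a} (ℕ.s≤s ℕ.z≤n) ⟩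
    ι (suc a)  ≡⟨ sym (/-cancel (suc a) b) ⟩
    (+ suc a / suc b) * ι (suc b)  ≡⟨ cong (_* ι (suc b)) (↥p/↧p≡p q) ⟩
    q * ι (suc b)  ≡⟨ *-comm q (ι (suc b)) ⟩
    ι (suc b) * q ∎)
    where
    open ≤-Reasoning
    n≤2^n : ∀ n → n ℕ.≤ 2 ℕ.^ n
    n≤2^n zero    = ℕ.z≤n
    n≤2^n (suc n) = ℕₚ.≤-trans (ℕₚ.+-mono-≤ (ℕₚ.m^n>0 2 n) (n≤2^n n))
      (ℕₚ.+-monoʳ-≤ (2 ℕ.^ n) (ℕₚ.m≤m+n (2 ℕ.^ n) 0))
  ½^-archimedean (mkℚ (+ zero) b _) (*<* (ℤ.+<+ ()))
  ½^-archimedean (mkℚ (ℤ.-[1+ a ]) b _) (*<* ())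

  ½^-bracket : ∀ D {y} → ½ ^ D ≤ y → y ≤ (1ℚ + 1ℚ) → ∃ λ d → ½ ^ d ≤ y × y ≤ (1ℚ + 1ℚ) * ½ ^ d
  ½^-bracket zero    lo hi = 0 , lo , hi
  ½^-bracket (suc D) {y} lo hi with ½ ^ D ≤? y
  ... | yes lo′ = ½^-bracket D lo′ hi
  ... | no ¬lo = suc D , lo , ≤-trans (<⇒≤ (≰⇒> ¬lo))
    (≤-reflexive (solve 1 (λ x → x := (con 1ℚ :+ con 1ℚ) :* (con ½ :* x)) refl (½ ^ D)))

  8ℚ : ℚ
  8ℚ = + 8 / 1

  -- One sufficiently late term `q` decides: all later terms differ from it by less than
  -- `ε/2 ≤ q/2`, so they lie between `q/2` and `3q/2`. With `½ ^ d ≤ q/2 ≤ 2 * ½ ^ d` the upper end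
  -- is at most `6 * ½ ^ d`; the factor is rounded up to 8, whose binary logarithm is an integer.
  dyadic-bracket : ∀ x {ε} → 0ℚ < ε → Eventually (λ m → ε ≤ seq x m) → Eventually (λ m → seq x m ≤ 1ℚ) →
                   ∃ λ d → Eventually (λ m → ½ ^ d ≤ seq x m × seq x m ≤ 8ℚ * ½ ^ d)
  dyadic-bracket x {ε} 0<ε (N₁ , above) (N₂ , below)
    with cauchy x (½ * ε) (0<½* 0<ε)
  ... | N₃ , close = d , N , λ m N≤m → ≤-trans lo (lower m N≤m) , ≤-trans (upper m N≤m) hi′
    where
    N : ℕ
    N = N₁ ⊔ N₂ ⊔ N₃
    N₁₂≤N : N₁ ⊔ N₂ ℕ.≤ N
    N₁₂≤N = ℕₚ.m≤m⊔n (N₁ ⊔ N₂) N₃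
    N₃≤N : N₃ ℕ.≤ N
    N₃≤N = ℕₚ.m≤n⊔m (N₁ ⊔ N₂) N₃
    q : ℚ
    q = seq x N
    ε≤q : ε ≤ q
    ε≤q = above N (ℕₚ.≤-trans (ℕₚ.m≤m⊔n N₁ N₂) N₁₂≤N)
    q≤1 : q ≤ 1ℚ
    q≤1 = below N (ℕₚ.≤-trans (ℕₚ.m≤n⊔m N₁ N₂) N₁₂≤N)
    ½ε≤½q : ½ * ε ≤ ½ * q
    ½ε≤½q = *-monoˡ ½ (nonNegative⁻¹ ½) ε≤q
    lower : ∀ m → N ℕ.≤ m → ½ * q ≤ seq x m
    lower m N≤m = ≤-by-gap ((seq x m + ½ * ε - q) + (½ * q - ½ * ε))
      (0≤+ (p≤q⇒0≤q-p (∣p-q∣<r⇒q≤p+r (seq x m) q (close m N (ℕₚ.≤-trans N₃≤N N≤m) N₃≤N)))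
        (p≤q⇒0≤q-p ½ε≤½q))
      (solve 3 (λ x q ε → con ½ :* q :+ ((x :+ con ½ :* ε :- q) :+ (con ½ :* q :- con ½ :* ε)) := x)
        refl (seq x m) q ε)
    upper : ∀ m → N ℕ.≤ m → seq x m ≤ q + ½ * q
    upper m N≤m = ≤-trans (∣p-q∣<r⇒p≤q+r (seq x m) q (close m N (ℕₚ.≤-trans N₃≤N N≤m) N₃≤N))
      (+-monoʳ-≤ q ½ε≤½q)
    0<½q : 0ℚ < ½ * q
    0<½q = 0<½* (<-≤-trans 0<ε ε≤q)
    bracket : ∃ λ d → ½ ^ d ≤ ½ * q × ½ * q ≤ (1ℚ + 1ℚ) * ½ ^ d
    bracket = ½^-bracket (proj₁ (½^-archimedean (½ * q) 0<½q)) (proj₂ (½^-archimedean (½ * q) 0<½q))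
      (≤-trans (*-monoˡ ½ (nonNegative⁻¹ ½) q≤1) (≤ᵇ⇒≤ _))
    d : ℕ
    d = proj₁ bracket
    lo : ½ ^ d ≤ ½ * q
    lo = proj₁ (proj₂ bracket)
    hi′ : q + ½ * q ≤ 8ℚ * ½ ^ d
    hi′ = ≤-by-gap ((1ℚ + 1ℚ + 1ℚ) * ((1ℚ + 1ℚ) * ½ ^ d - ½ * q) + (1ℚ + 1ℚ) * ½ ^ d)
      (0≤+ (0≤* (nonNegative⁻¹ (1ℚ + 1ℚ + 1ℚ)) (p≤q⇒0≤q-p (proj₂ (proj₂ bracket))))
           (0≤* (nonNegative⁻¹ (1ℚ + 1ℚ)) (0≤^ d (nonNegative⁻¹ ½))))
      (solve 2 (λ q x → q :+ con ½ :* q :+ ((con 1ℚ :+ con 1ℚ :+ con 1ℚ) :* ((con 1ℚ :+ con 1ℚ) :* x :- con ½ :* q)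
         :+ (con 1ℚ :+ con 1ℚ) :* x) := con 8ℚ :* x) refl q (½ ^ d))

  seq-^ : ∀ x n m → seq (x ^ᵣ n) m ≡ seq x m ^ n
  seq-^ x zero    m = refl
  seq-^ x (suc n) m = cong (seq x m *_) (seq-^ x n m)

-- Failure probabilities and the Chernoff bound for majority votes

module NoisyComparisons where

  open import Algebra.Bundles using (CommutativeRing)
  open import Data.Bool using (Bool; true; false; not; if_then_else_; T)
  open import Data.Fin using (Fin; zero; suc; toℕ)
  open import Data.Fin.Subset using (Subset; _⊆_)
  open import Data.Integer using (+_)
  open import Data.List using (List; []; _∷_)
  open import Data.Nat as ℕ using (ℕ; zero; suc)
  open import Data.Rational hiding (_<?_)
  open import Data.Rational.Properties hiding (_<?_)
  open import Data.Vec.Functional using (foldr)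
  open import Function using (_∘_)
  open import Relation.Binary.PropositionalEquality
  open import Relation.Nullary using (does)
  open import Relation.Nullary.Decidable using (dec-true)
  open import Algebra.Properties.CommutativeMonoid.Sum +-0-commutativeMonoid
    using (sum; ∑-distrib-+)
  open RationalArithmetic
  open RealBounds
  open ℚ-Solver

  ∑-mono : ∀ {m} {f g : Fin m → ℚ} → (∀ i → f i ≤ g i) → sum f ≤ sum g
  ∑-mono {zero}  _   = ≤-refl
  ∑-mono {suc m} f≤g = +-mono-≤ (f≤g zero) (∑-mono (f≤g ∘ suc))

  ∑-const : ∀ m c → sum {m} (λ _ → c) ≡ ι m * c
  ∑-const zero    c = sym (trans (cong (_* c) ι-0) (*-zeroˡ c))
  ∑-const (suc m) c = trans (cong (_+_ c) (∑-const m c))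
    (trans (solve 2 (λ c x → c :+ x :* c := (con 1ℚ :+ x) :* c) refl c (ι m))
      (cong (_* c) (sym (ι-suc m))))

  ∑-neg : ∀ {m} (f : Fin m → ℚ) → sum (λ i → - f i) ≡ - sum f
  ∑-neg {zero}  f = refl
  ∑-neg {suc m} f = trans (cong (_+_ (- f zero)) (∑-neg (f ∘ suc))) (sym (neg-distrib-+ (f zero) (sum (f ∘ suc))))

  uniform : ℕ → ℚ
  uniform m = + 1 / suc m

  uniform-ι : ∀ m → uniform m * ι (suc m) ≡ 1ℚ
  uniform-ι m = trans (/-cancel 1 m) ι-1

  0≤uniform : ∀ m → 0ℚ ≤ uniform m
  0≤uniform m = nonNegative⁻¹ (uniform m) {{normalize-nonNeg 1 (suc m)}}

  vote : ∀ {n t M} (i j : Fin n) → i ≢ j → Available t M i → Available t M j →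
         ℕ → (yeas nays : ℕ) → (Bool → Program n t M) → Program n t M
  vote i j i≢j i∈ j∈ zero    y z P = P (z ℕ.<ᵇ y)
  vote i j i≢j i∈ j∈ (suc N) y z P = query i j i≢j i∈ j∈ λ b →
    if b then vote i j i≢j i∈ j∈ N (suc y) z P else vote i j i≢j i∈ j∈ N y (suc z) P

  module Failure {n : ℕ} {_≺_ : Rel (Fin n) 0ℓ} (order : IsStrictTotalOrder _≡_ _≺_)
           (k : ℕ) (γ : ℝ) (adversary : Adversary)
           (g : ℚ) (g≤γ : fromℚ g ≤ᵣ γ) (γ≤½ : γ ≤ᵣ ½ᵣ) where

    open IsStrictTotalOrder order using (_<?_)

    infix 4 _FailsAtMost_

    -- The bound holds from every history, since the adversary may use the history.
    record _FailsAtMost_ {t M} (P : Program n t M) (φ : ℚ) : Set where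
      constructor failsAtMost
      field
        success≥ : ∀ h → fromℚ (1ℚ - φ) ≤ᵣ successProbabilityFrom order h γ k adversary P

    open _FailsAtMost_ public

    fails⇒success : ∀ {P : StreamingAlgorithm n} {φ} → P FailsAtMost φ →
      fromℚ (1ℚ - φ) ≤ᵣ successProbability order γ k adversary P
    fails⇒success fails = success≥ fails []

    fails-mono : ∀ {t M} {P : Program n t M} {φ ψ} → φ ≤ ψ → P FailsAtMost φ → P FailsAtMost ψ
    fails-mono {P = P} {φ} {ψ} φ≤ψ fails = failsAtMost λ h →
      ≤ᵣ-trans {fromℚ (1ℚ - ψ)} {fromℚ (1ℚ - φ)} {successProbabilityFrom order h γ k adversary P}
        (fromℚ-mono (+-monoʳ-≤ 1ℚ (neg-antimono-≤ φ≤ψ))) (success≥ fails h)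

    fails-output : ∀ {M} {S : Subset n} {S⊆M : S ⊆ M} → IsLargest order k S →
                   output S S⊆M FailsAtMost 0ℚ
    fails-output {M} {S} {S⊆M} largest = failsAtMost bound
      where
      bound : ∀ h → fromℚ (1ℚ - 0ℚ) ≤ᵣ successProbabilityFrom order h γ k adversary (output S S⊆M)
      bound h rewrite dec-true (isLargest? order k S) largest = fromℚ-mono ≤-refl

    private
      0≤½-γ : 0ᵣ ≤ᵣ ½ᵣ -ᵣ γ
      0≤½-γ = 0≤ᵣ-gap {γ} {½ᵣ} γ≤½

    -- The mixture grows with `γ` because the larger value `a` carries the weight `½ + γ`: the gap
    -- consists of the gains of `A` over `a` and of `B` over `b`, and of `(γ - g) (a - b)`.
    mixture-bound : ∀ {a b} A B → 0ℚ ≤ g → b ≤ a → fromℚ a ≤ᵣ A → fromℚ b ≤ᵣ B →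
      fromℚ ((½ + g) * a + (½ - g) * b) ≤ᵣ (½ᵣ +ᵣ γ) *ᵣ A +ᵣ (½ᵣ -ᵣ γ) *ᵣ B
    mixture-bound {a} {b} A B 0≤g b≤a a≤A b≤B = ≤ᵣ-by-gap
      {fromℚ ((½ + g) * a + (½ - g) * b)} {(½ᵣ +ᵣ γ) *ᵣ A +ᵣ (½ᵣ -ᵣ γ) *ᵣ B}
      (fst +ᵣ (snd +ᵣ trd))
      (0≤ᵣ-+ {fst} {snd +ᵣ trd} 0≤fst (0≤ᵣ-+ {snd} {trd} 0≤snd 0≤trd))
      (λ m → solve 6 (λ g a b γ A B →
          (con ½ :+ g) :* a :+ (con ½ :- g) :* b :+
          ((con ½ :+ γ) :* (A :- a) :+ ((con ½ :- γ) :* (B :- b) :+ (γ :- g) :* (a :- b)))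
          := (con ½ :+ γ) :* A :+ (con ½ :- γ) :* B) refl g a b (seq γ m) (seq A m) (seq B m))
      where
      fst snd trd : ℝ
      fst = (½ᵣ +ᵣ γ) *ᵣ (A -ᵣ fromℚ a)
      snd = (½ᵣ -ᵣ γ) *ᵣ (B -ᵣ fromℚ b)
      trd = (γ -ᵣ fromℚ g) *ᵣ fromℚ (a - b)
      0≤½+γ : 0ᵣ ≤ᵣ ½ᵣ +ᵣ γ
      0≤½+γ = ≤ᵣ-by-gap {0ᵣ} {½ᵣ +ᵣ γ} (fromℚ (½ + g) +ᵣ (γ -ᵣ fromℚ g))
        (0≤ᵣ-+ {fromℚ (½ + g)} {γ -ᵣ fromℚ g} (fromℚ-mono (0≤+ (nonNegative⁻¹ ½) 0≤g))
          (0≤ᵣ-gap {fromℚ g} {γ} g≤γ))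
        (λ m → solve 2 (λ g γ → con 0ℚ :+ ((con ½ :+ g) :+ (γ :- g)) := con ½ :+ γ) refl g (seq γ m))
      0≤fst : 0ᵣ ≤ᵣ fst
      0≤fst = 0≤ᵣ-* {½ᵣ +ᵣ γ} {A -ᵣ fromℚ a} 0≤½+γ (0≤ᵣ-gap {fromℚ a} {A} a≤A)
      0≤snd : 0ᵣ ≤ᵣ snd
      0≤snd = 0≤ᵣ-* {½ᵣ -ᵣ γ} {B -ᵣ fromℚ b} 0≤½-γ (0≤ᵣ-gap {fromℚ b} {B} b≤B)
      0≤trd : 0ᵣ ≤ᵣ trd
      0≤trd = 0≤ᵣ-* {γ -ᵣ fromℚ g} {fromℚ (a - b)} (0≤ᵣ-gap {fromℚ g} {γ} g≤γ)
        (fromℚ-mono (p≤q⇒0≤q-p b≤a))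

    -- A corrupted answer may happen to be correct. As `φ ≤ ψ`, this only helps, so an adversary
    -- that always lies is the worst case.
    fails-query : ∀ {t M i j i≢j} {i∈ : Available t M i} {j∈ : Available t M j}
      {P : Bool → Program n t M} {φ ψ} → 0ℚ ≤ g → φ ≤ ψ →
      P (does (i <? j)) FailsAtMost φ → P (not (does (i <? j))) FailsAtMost ψ →
      query i j i≢j i∈ j∈ P FailsAtMost ((½ + g) * φ + (½ - g) * ψ)
    fails-query {i = i} {j} {i≢j} {i∈} {j∈} {P} {φ} {ψ} 0≤g φ≤ψ right wrong = failsAtMost λ h →
      subst (λ q → fromℚ q ≤ᵣ successProbabilityFrom order h γ k adversary (query i j i≢j i∈ j∈ P))
        (solve 3 (λ g φ ψ → (con ½ :+ g) :* (con 1ℚ :- φ) :+ (con ½ :- g) :* (con 1ℚ :- ψ)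
          := con 1ℚ :- ((con ½ :+ g) :* φ :+ (con ½ :- g) :* ψ)) refl g φ ψ)
        (mixture-bound (successProbabilityFrom order (truthful ∷ h) γ k adversary (P (does (i <? j))))
          (successProbabilityFrom order (corrupted ∷ h) γ k adversary (P (adversary h)))
          0≤g (+-monoʳ-≤ 1ℚ (neg-antimono-≤ φ≤ψ)) (success≥ right (truthful ∷ h))
          (success≥ (either (does (i <? j)) (adversary h) right wrong) (corrupted ∷ h)))
      where
      either : ∀ b c → P b FailsAtMost φ → P (not b) FailsAtMost ψ → P c FailsAtMost ψ
      either true  true  r w = fails-mono φ≤ψ r
      either true  false r w = w
      either false true  r w = w
      either false false r w = fails-mono φ≤ψ r

    ∑ᵣ-mono : ∀ {m} {f : Fin m → ℚ} {F : Fin m → ℝ} → (∀ x → fromℚ (f x) ≤ᵣ F x) →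
              fromℚ (sum f) ≤ᵣ foldr _+ᵣ_ 0ᵣ F
    ∑ᵣ-mono {zero}  f≤F = fromℚ-mono ≤-refl
    ∑ᵣ-mono {suc m} {f} {F} f≤F = ≤ᵣ-by-gap
      {fromℚ (sum f)} {F zero +ᵣ foldr _+ᵣ_ 0ᵣ (F ∘ suc)}
      ((F zero -ᵣ fromℚ (f zero)) +ᵣ (foldr _+ᵣ_ 0ᵣ (F ∘ suc) -ᵣ fromℚ (sum (f ∘ suc))))
      (0≤ᵣ-+ {F zero -ᵣ fromℚ (f zero)} {foldr _+ᵣ_ 0ᵣ (F ∘ suc) -ᵣ fromℚ (sum (f ∘ suc))}
        (0≤ᵣ-gap {fromℚ (f zero)} {F zero} (f≤F zero))
        (0≤ᵣ-gap {fromℚ (sum (f ∘ suc))} {foldr _+ᵣ_ 0ᵣ (F ∘ suc)} (∑ᵣ-mono (f≤F ∘ suc))))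
      (λ j → solve 4 (λ a b A B → a :+ b :+ ((A :- a) :+ (B :- b)) := A :+ B) refl
        (f zero) (sum (f ∘ suc)) (seq (F zero) j) (seq (foldr _+ᵣ_ 0ᵣ (F ∘ suc)) j))

    fails-random : ∀ {t M m} {P : Fin (suc m) → Program n t M} {φ : Fin (suc m) → ℚ} →
      (∀ x → P x FailsAtMost φ x) → random m P FailsAtMost uniform m * sum φ
    fails-random {t} {M} {m} {P} {φ} fails = failsAtMost λ h →
      ≤ᵣ-by-gap {fromℚ (1ℚ - uniform m * sum φ)} {fromℚ (uniform m) *ᵣ total h}
        (fromℚ (uniform m) *ᵣ (total h -ᵣ fromℚ (sum (λ x → 1ℚ - φ x))))
        (0≤ᵣ-* {fromℚ (uniform m)} {total h -ᵣ fromℚ (sum (λ x → 1ℚ - φ x))} (fromℚ-mono (0≤uniform m))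
          (0≤ᵣ-gap {fromℚ (sum (λ x → 1ℚ - φ x))} {total h} (∑ᵣ-mono {F = branch h} (λ x → success≥ (fails x) (drawn (toℕ x) ∷ h)))))
        (λ j → trans (cong (λ z → 1ℚ - uniform m * sum φ + uniform m * (seq (total h) j - z)) complement)
          (trans (solve 4 (λ u s i t → con 1ℚ :- u :* s :+ u :* (t :- (i :- s)) := u :* t :+ (con 1ℚ :- u :* i))
            refl (uniform m) (sum φ) (ι (suc m)) (seq (total h) j))
            (trans (cong (λ z → uniform m * seq (total h) j + (1ℚ - z)) (uniform-ι m))
              (+-identityʳ (uniform m * seq (total h) j)))))
      where
      branch : List Outcome → Fin (suc m) → ℝ
      branch h x = successProbabilityFrom order (drawn (toℕ x) ∷ h) γ k adversary (P x)
      total : List Outcome → ℝ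
      total h = foldr _+ᵣ_ 0ᵣ (branch h)
      complement : sum (λ x → 1ℚ - φ x) ≡ ι (suc m) - sum φ
      complement = trans (∑-distrib-+ (λ _ → 1ℚ) (λ x → - φ x))
        (cong₂ _+_ (trans (∑-const (suc m) 1ℚ) (*-identityʳ (ι (suc m)))) (∑-neg φ))

    -- The trivial bound, for branches that are written off: a wrong vote in the final selection, a
    -- wrong block, a top element already lost.
    fails-always : ∀ {t M} → 0ℚ ≤ g → (P : Program n t M) → P FailsAtMost 1ℚ
    -- These three instructions leave the success probability definitionally unchanged; only the
    -- program that indexes the record differs. The same repackaging recurs in the analysis of the
    -- stream.
    fails-always 0≤g (next _ P)    = failsAtMost (success≥ (fails-always 0≤g P))
    fails-always 0≤g (store _ _ P) = failsAtMost (success≥ (fails-always 0≤g P))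
    fails-always 0≤g (discard _ P) = failsAtMost (success≥ (fails-always 0≤g P))
    fails-always 0≤g (query i j i≢j i∈ j∈ P) = fails-mono {P = query i j i≢j i∈ j∈ P} (≤-reflexive
        (solve 1 (λ g → (con ½ :+ g) :* con 1ℚ :+ (con ½ :- g) :* con 1ℚ := con 1ℚ) refl g))
      (fails-query {P = P} 0≤g ≤-refl (fails-always 0≤g (P _)) (fails-always 0≤g (P _)))
    fails-always 0≤g (random m P) = fails-mono {P = random m P}
      (≤-reflexive (trans (cong (uniform m *_) (trans (∑-const (suc m) 1ℚ) (*-identityʳ (ι (suc m)))))
        (uniform-ι m)))
      (fails-random {P = P} (λ x → fails-always 0≤g (P x)))
    fails-always 0≤g (output S S⊆M) = failsAtMost bound
      where
      bound : ∀ h → fromℚ (1ℚ - 1ℚ) ≤ᵣ successProbabilityFrom order h γ k adversary (output S S⊆M)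
      bound h with does (isLargest? order k S)
      ... | true  = fromℚ-mono {1ℚ - 1ℚ} {1ℚ} (≤ᵇ⇒≤ _)
      ... | false = fromℚ-mono {0ℚ} ≤-refl

    module Voting (0≤g : 0ℚ ≤ g) (g≤½ : g ≤ ½) where

      -- A correct answer multiplies the Chernoff potential by 1 - g and a wrong one by
      -- 1 + g + 2g², an upper bound of 1/(1 - g); on average the factor is at most 1 - g².
      down up drift : ℚ
      down  = 1ℚ - g
      up    = 1ℚ + g + (1ℚ + 1ℚ) * (g * g)
      drift = (½ + g) * down + (½ - g) * up

      private
        0≤g² : 0ℚ ≤ g * g
        0≤g² = 0≤* 0≤g 0≤g
        0≤½-g : 0ℚ ≤ ½ - g
        0≤½-g = p≤q⇒0≤q-p g≤½
        0≤down : 0ℚ ≤ down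
        0≤down = subst (0ℚ ≤_) (solve 1 (λ g → con ½ :+ (con ½ :- g) := con 1ℚ :- g) refl g)
          (0≤+ (nonNegative⁻¹ ½) 0≤½-g)
        1≤up : 1ℚ ≤ up
        1≤up = ≤-by-gap (g + (1ℚ + 1ℚ) * (g * g)) (0≤+ 0≤g (0≤* (nonNegative⁻¹ (1ℚ + 1ℚ)) 0≤g²))
          (sym (+-assoc 1ℚ g ((1ℚ + 1ℚ) * (g * g))))
        down≤up : down ≤ up
        down≤up = ≤-trans (≤-by-gap g 0≤g (solve 1 (λ g → con 1ℚ :- g :+ g := con 1ℚ) refl g)) 1≤up
        1≤down*up : 1ℚ ≤ down * up
        1≤down*up = ≤-by-gap ((1ℚ + 1ℚ) * (g * g * (½ - g)))
          (0≤* (nonNegative⁻¹ (1ℚ + 1ℚ)) (0≤* 0≤g² 0≤½-g))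
          (solve 1 (λ g → con 1ℚ :+ (con 1ℚ :+ con 1ℚ) :* (g :* g :* (con ½ :- g)) :=
             (con 1ℚ :- g) :* (con 1ℚ :+ g :+ (con 1ℚ :+ con 1ℚ) :* (g :* g))) refl g)
        0≤drift : 0ℚ ≤ drift
        0≤drift = 0≤+ (0≤* (0≤+ (nonNegative⁻¹ ½) 0≤g) 0≤down)
          (0≤* 0≤½-g (≤-trans (nonNegative⁻¹ 1ℚ) 1≤up))

      drift≤1-g² : drift ≤ 1ℚ - g * g
      drift≤1-g² = ≤-by-gap ((1ℚ + 1ℚ) * (g * g * g))
        (0≤* (nonNegative⁻¹ (1ℚ + 1ℚ)) (0≤* 0≤g² 0≤g))
        (solve 1 (λ g → (con ½ :+ g) :* (con 1ℚ :- g) :+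
            (con ½ :- g) :* (con 1ℚ :+ g :+ (con 1ℚ :+ con 1ℚ) :* (g :* g)) :+
            (con 1ℚ :+ con 1ℚ) :* (g :* g :* g) := con 1ℚ :- g :* g) refl g)

      private
        potential : (correct wrong : ℕ) → ℚ
        potential c w = down ^ c * up ^ w

        -- Pairing each correct answer with a wrong one gives factors `down * up ≥ 1`, and the
        -- surplus wrong answers give factors `up ≥ 1`.
        1≤potential : ∀ {c w} → c ℕ.≤ w → 1ℚ ≤ potential c w
        1≤potential {c} {w} c≤w = ≤-trans (1≤^ c 1≤down*up) (≤-trans
          (≤-reflexive (^-distrib-* down up c))
          (*-monoˡ (down ^ c) (0≤^ c 0≤down) (≤-trans
            (≤-trans (≤-reflexive (sym (*-identityʳ (up ^ c))))
              (*-monoˡ (up ^ c) (0≤^ c (≤-trans (nonNegative⁻¹ 1ℚ) 1≤up)) (1≤^ (w ℕ.∸ c) 1≤up)))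
            (≤-reflexive (trans (sym (^-homo-* up c (w ℕ.∸ c))) (cong (up ^_) (ℕₚ.m+[n∸m]≡n c≤w)))))))

        0≤potential : ∀ c w → 0ℚ ≤ potential c w
        0≤potential c w = 0≤* (0≤^ c 0≤down) (0≤^ w (≤-trans (nonNegative⁻¹ 1ℚ) 1≤up))

      module _ {t : ℕ} {M : Subset n} {i j : Fin n} {i≢j : i ≢ j} {i∈ : Available t M i} {j∈ : Available t M j}
               {P : Bool → Program n t M} {φ Δ : ℚ} (0≤Δ : 0ℚ ≤ Δ) where

        private
          -- The exponential-moment argument as a backward induction: with `N` queries to come, the
          -- excess `Δ` is charged with the expected final potential. One query turns the bound for
          -- `N` into that for `suc N` by the very definition of `drift`, and at the end a wrong
          -- majority has potential at least 1.
          bound : (N c w : ℕ) → ℚ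
          bound N c w = φ + drift ^ N * potential c w * Δ

          step-mono : ∀ N c w → bound N (suc c) w ≤ bound N c (suc w)
          step-mono N c w = +-monoʳ-≤ φ (*-monoʳ-≤-nonNeg Δ {{nonNegative 0≤Δ}}
            (*-monoˡ (drift ^ N) (0≤^ N 0≤drift)
              (≤-trans (≤-reflexive (*-assoc down (down ^ c) (up ^ w)))
                (≤-trans (*-monoʳ-≤-nonNeg (potential c w) {{nonNegative (0≤potential c w)}} down≤up)
                  (≤-reflexive (solve 3 (λ a b d → b :* (a :* d) := a :* (b :* d)) refl
                    (down ^ c) up (up ^ w)))))))

          step-drift : ∀ N c w → (½ + g) * bound N (suc c) w + (½ - g) * bound N c (suc w) ≡ bound (suc N) c w
          step-drift N c w = solve 8 (λ g φ ρ a b x y Δ →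
              (con ½ :+ g) :* (φ :+ ρ :* ((a :* x) :* y) :* Δ) :+ (con ½ :- g) :* (φ :+ ρ :* (x :* (b :* y)) :* Δ)
              := φ :+ (((con ½ :+ g) :* a :+ (con ½ :- g) :* b) :* ρ) :* (x :* y) :* Δ) refl
            g φ (drift ^ N) down up (down ^ c) (up ^ w) Δ

          decided-right : ∀ {Q : Program n t M} → ∀ c w → Q FailsAtMost φ → Q FailsAtMost bound zero c w
          decided-right {Q} c w = fails-mono {P = Q} (≤-by-gap _
            (0≤* (0≤* (nonNegative⁻¹ 1ℚ) (0≤potential c w)) 0≤Δ) refl)

          decided-wrong : ∀ {Q : Program n t M} c w → c ℕ.≤ w → Q FailsAtMost φ + Δ → Q FailsAtMost bound zero c w
          decided-wrong {Q} c w c≤w = fails-mono {P = Q} (+-monoʳ-≤ φ (≤-trans (≤-reflexive (sym (*-identityˡ Δ)))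
            (*-monoʳ-≤-nonNeg Δ {{nonNegative 0≤Δ}} (≤-trans (1≤potential c≤w)
              (≤-reflexive (sym (*-identityˡ (potential c w))))))))

          fails-vote-true : does (i <? j) ≡ true → P true FailsAtMost φ → P false FailsAtMost φ + Δ →
            ∀ N y z → vote i j i≢j i∈ j∈ N y z P FailsAtMost bound N y z
          fails-vote-true i<j right wrong zero y z with z ℕ.<ᵇ y in eq
          ... | true  = decided-right {P true} y z right
          -- A tie counts as `false`, so the wrong answers may merely equal the correct ones in
          -- number; `1≤potential` allows for that.
          ... | false = decided-wrong {P false} y z (ℕₚ.≮⇒≥ λ lt → subst T (eq) (ℕₚ.<⇒<ᵇ lt)) wrong
          fails-vote-true i<j right wrong (suc N) y z = fails-mono {P = vote i j i≢j i∈ j∈ (suc N) y z P}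
            (≤-reflexive (step-drift N y z))
            (fails-query 0≤g (step-mono N y z) (lemma (sym i<j)) (lemma′ (sym i<j)))
            where
            Q : Bool → Program n t M
            Q b = if b then vote i j i≢j i∈ j∈ N (suc y) z P else vote i j i≢j i∈ j∈ N y (suc z) P
            lemma : ∀ {b} → true ≡ b → Q b FailsAtMost bound N (suc y) z
            lemma refl = fails-vote-true i<j right wrong N (suc y) z
            lemma′ : ∀ {b} → true ≡ b → Q (not b) FailsAtMost bound N y (suc z)
            lemma′ refl = fails-vote-true i<j right wrong N y (suc z)

          fails-vote-false : does (i <? j) ≡ false → P false FailsAtMost φ → P true FailsAtMost φ + Δ →
            ∀ N y z → vote i j i≢j i∈ j∈ N y z P FailsAtMost bound N z y
          fails-vote-false i≮j right wrong zero y z with z ℕ.<ᵇ y in eq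
          ... | true  = decided-wrong {P true} z y (ℕₚ.<⇒≤ (ℕₚ.<ᵇ⇒< z y (subst T (sym eq) _))) wrong
          ... | false = decided-right {P false} z y right
          fails-vote-false i≮j right wrong (suc N) y z = fails-mono {P = vote i j i≢j i∈ j∈ (suc N) y z P}
            (≤-reflexive (step-drift N z y))
            (fails-query 0≤g (step-mono N z y) (lemma (sym i≮j)) (lemma′ (sym i≮j)))
            where
            Q : Bool → Program n t M
            Q b = if b then vote i j i≢j i∈ j∈ N (suc y) z P else vote i j i≢j i∈ j∈ N y (suc z) P
            lemma : ∀ {b} → false ≡ b → Q b FailsAtMost bound N (suc z) y
            lemma refl = fails-vote-false i≮j right wrong N y (suc z)
            lemma′ : ∀ {b} → false ≡ b → Q (not b) FailsAtMost bound N z (suc y)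
            lemma′ refl = fails-vote-false i≮j right wrong N (suc y) z

        fails-vote : ∀ N {ε} → drift ^ N ≤ ε →
          P (does (i <? j)) FailsAtMost φ → P (not (does (i <? j))) FailsAtMost φ + Δ →
          vote i j i≢j i∈ j∈ N 0 0 P FailsAtMost φ + ε * Δ
        fails-vote N {ε} error right wrong = fails-mono {P = vote i j i≢j i∈ j∈ N 0 0 P}
          (+-monoʳ-≤ φ (*-monoʳ-≤-nonNeg Δ {{nonNegative 0≤Δ}}
            (≤-trans (≤-reflexive (*-identityʳ (drift ^ N))) error)))
          (go (does (i <? j)) refl right wrong)
          where
          go : ∀ b → does (i <? j) ≡ b → P b FailsAtMost φ → P (not b) FailsAtMost φ + Δ →
               vote i j i≢j i∈ j∈ N 0 0 P FailsAtMost bound N 0 0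
          go true  i<j r w = fails-vote-true i<j r w N 0 0
          go false i≮j r w = fails-vote-false i≮j r w N 0 0

      -- Every `G * G` votes contribute a factor of at most `(1 - 1/G²)^(G²) ≤ 1/2`, so the
      -- confidence of a vote can be counted in bits.
      drift-power : ∀ {G} → 1 ℕ.≤ G → g * ι G ≡ 1ℚ → ∀ h → drift ^ (G ℕ.* G ℕ.* h) ≤ ½ ^ h
      drift-power {suc G-1} _ gG h = begin
        drift ^ (N ℕ.* h)  ≤⟨ ^-monoˡ-≤ (N ℕ.* h) 0≤drift drift≤1-g² ⟩
        (1ℚ - g * g) ^ (N ℕ.* h)  ≡⟨ sym (^-assocʳ (1ℚ - g * g) N h) ⟩
        ((1ℚ - g * g) ^ N) ^ h  ≤⟨ ^-monoˡ-≤ h (0≤^ N 0≤1-g²) ([1-r]^N≤½ (g * g) _ g²N) ⟩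
        ½ ^ h ∎
        where
        open ≤-Reasoning
        N : ℕ
        N = suc G-1 ℕ.* suc G-1
        0≤1-g² : 0ℚ ≤ 1ℚ - g * g
        0≤1-g² = ≤-trans 0≤drift drift≤1-g²
        g²N : g * g * ι N ≡ 1ℚ
        g²N = trans (cong (g * g *_) (ι-* (suc G-1) (suc G-1)))
          (trans (solve 2 (λ g G → g :* g :* (G :* G) := (g :* G) :* (g :* G)) refl g (ι (suc G-1)))
            (cong₂ _*_ gG gG))

-- Median-of-medians selection as a decision tree

module Selection where

  open import Data.Bool using (Bool; true; false; if_then_else_; T)
  open import Data.Empty using (⊥)
  open import Data.List using (List; []; _∷_; _++_; length; concatMap; [_])
  open import Data.List.Properties using (length-++; concatMap-++)
  open import Data.List.Relation.Unary.All as All using (All; []; _∷_)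
  open import Data.List.Relation.Unary.All.Properties using (++⁺; ++⁻)
  open import Data.List.Relation.Binary.Permutation.Propositional hiding (refl; trans)
  open import Data.List.Relation.Binary.Permutation.Propositional.Properties as Perm
    using (↭-length; shift; All-resp-↭; ++-commutativeMonoid)
  open import Data.Nat hiding (compare)
  open import Data.Nat.Properties
  open import Data.Product using (_×_; _,_; proj₁; proj₂; ∃)
  open import Data.Unit using (tt)
  open import Function using (_∘_; id)
  open import Relation.Binary using (Tri; tri<; tri≈; tri>)
  open import Relation.Binary.PropositionalEquality using (_≡_; refl; sym; trans; cong; cong₂; subst)
  open import Relation.Nullary using (contradiction)
  import Algebra.Solver.CommutativeMonoid as CommutativeMonoidSolver

  -- The procedure is kept apart from the source of its answers: `Computes` follows it on the true
  -- order, `simulate` on majority votes. Only the truthful path has to be analysed.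
  data Comparing (X A : Set) : Set where
    done    : A → Comparing X A
    compare : X → X → (Bool → Comparing X A) → Comparing X A

  infixl 1 _>>=_

  _>>=_ : ∀ {X A B} → Comparing X A → (A → Comparing X B) → Comparing X B
  done a        >>= f = f a
  compare x y c >>= f = compare x y (λ b → c b >>= f)

  record Split (A : Set) : Set where
    constructor split
    field
      hi  : List A
      mid : A
      lo  : List A

    elements : List A
    elements = mid ∷ hi ++ lo

  open Split public

  module _ {X A : Set} (key : A → X) where

    partition : X → List A → Comparing X (List A × List A)
    partition p []       = done ([] , [])
    partition p (x ∷ xs) = compare p (key x) λ b → partition p xs >>= λ (above , below) →
      done (if b then (x ∷ above , below) else (above , x ∷ below))

  -- The first argument of a selection procedure is only returned for a rank that is out of range.
  Selector : Set → Set → Set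
  Selector X A = Split A → ℕ → List A → Comparing X (Split A)

  module _ {X A : Set} (rec : Selector X A) where

    adjust : ℕ → Split A → Comparing X (Split A)
    adjust j s = go (<-cmp j (length (hi s)))
      where
      go : Tri (j < length (hi s)) (j ≡ length (hi s)) (j > length (hi s)) → Comparing X (Split A)
      go (tri< _ _ _) = rec s j (hi s) >>= λ s′ →
        done (split (hi s′) (mid s′) (lo s′ ++ mid s ∷ lo s))
      go (tri≈ _ _ _) = done s
      go (tri> _ _ _) = rec s (j ∸ suc (length (hi s))) (lo s) >>= λ s′ →
        done (split (hi s ++ mid s ∷ hi s′) (mid s′) (lo s′))

  quickselect : ∀ {X A} → (A → X) → ℕ → Selector X A
  quickselect key zero    d j xs       = done d
  quickselect key (suc f) d j []       = done d
  quickselect key (suc f) d j (x ∷ xs) = partition key (key x) xs >>= λ (above , below) →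
    adjust (quickselect key f) j (split above x below)

  add-group : ∀ {X A} → (A → X) → A → List A → Comparing X (List (Split A) × List A) →
              Comparing X (List (Split A) × List A)
  add-group key a five more = quickselect key 5 (split [] a []) 2 five >>= λ s →
    more >>= λ (gs , rest) → done (s ∷ gs , rest)

  medians : ∀ {X A} → (A → X) → List A → Comparing X (List (Split A) × List A)
  medians key (a ∷ b ∷ c ∷ d ∷ e ∷ xs) = add-group key a (a ∷ b ∷ c ∷ d ∷ e ∷ []) (medians key xs)
  medians key xs = done ([] , xs)

  -- If the median of a group is above the pivot, so is its upper half, by transitivity;
  -- symmetrically below. Only the other halves need comparisons with the pivot.
  known-above known-below unknown : ∀ {A} → Split (Split A) → List A
  known-above G = hi (mid G) ++ concatMap (λ s → mid s ∷ hi s) (hi G)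
  known-below G = lo (mid G) ++ concatMap (λ s → mid s ∷ lo s) (lo G)
  unknown     G = concatMap lo (hi G) ++ concatMap hi (lo G)

  -- Median of medians of five.
  select : ∀ {X A} → (A → X) → ℕ → Selector X A
  select key zero    d j xs = done d
  select key (suc f) d j xs = if length xs ≤ᵇ 4 then quickselect key 4 d j xs else
    (medians key xs >>= λ (gs , rest) →
     -- Whole groups are selected, ranked by their medians, so that the result delivers the halves
     -- of every group together with its side of the pivot.
     select (key ∘ mid) f (split [] d []) ⌊ length gs /2⌋ gs >>= λ G →
     partition key (key (mid (mid G))) (unknown G ++ rest) >>= λ (above , below) →
     adjust (select key f) j (split (above ++ known-above G) (mid (mid G)) (below ++ known-below G)))

  module _ {X : Set} (_≼_ : X → X → Set) (less : X → X → Bool) where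

    -- With truthful answers, the procedure makes at most c comparisons and its result satisfies Q.
    Computes : ∀ {A} → Comparing X A → (A → Set) → ℕ → Set
    Computes (done a)        Q c       = Q a
    Computes (compare x y m) Q zero    = ⊥
    Computes (compare x y m) Q (suc c) = Computes (m (less x y)) Q c

    computes-bind : ∀ {A B} (m : Comparing X A) {f : A → Comparing X B} {P Q c d} →
                    Computes m P c → (∀ a → P a → Computes (f a) Q d) → Computes (m >>= f) Q (c + d)
    computes-bind (done a) {f} {Q = Q} {c} {d} p cont = raise (f a) (m≤n+m d c) (cont a p)
      where
      raise : ∀ {B} (m : Comparing X B) {Q c d} → c ≤ d → Computes m Q c → Computes m Q d
      raise (done _)        _         q = q
      raise (compare x y m) (s≤s c≤d) q = raise (m (less x y)) c≤d q
    computes-bind (compare x y m) {c = suc c} p cont = computes-bind (m (less x y)) p cont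

    computes-weaken : ∀ {A} (m : Comparing X A) {P Q c d} → c ≤ d → (∀ {a} → P a → Q a) →
                      Computes m P c → Computes m Q d
    computes-weaken (done _)        _         f p = f p
    computes-weaken (compare x y m) (s≤s c≤d) f p = computes-weaken (m (less x y)) c≤d f p

    -- Truthful answers turn a procedure into an existence proof; the set of the `k` largest
    -- elements is obtained in this way.
    computes-result : ∀ {A} (m : Comparing X A) {Q c} → Computes m Q c → ∃ Q
    computes-result (done a)                    q = a , q
    computes-result (compare x y m) {c = suc c} q = computes-result (m (less x y)) q

    record IsSplit {A} (key : A → X) (xs : List A) (s : Split A) : Set where
      field
        permutes : xs ↭ elements s
        above    : All (λ x → key (mid s) ≼ key x) (hi s)
        below    : All (λ x → key x ≼ key (mid s)) (lo s)

    open IsSplit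

    record IsSelection {A} (key : A → X) (xs : List A) (j : ℕ) (s : Split A) : Set where
      field
        isSplit : IsSplit key xs s
        rank    : length (hi s) ≡ j

    open IsSelection

    Selects : ∀ {A} → (A → X) → Selector X A → ℕ → (ℕ → ℕ) → Set
    Selects key sel bound cost = ∀ d j xs → length xs ≤ bound → j < length xs →
      Computes (sel d j xs) (IsSelection key xs j) (cost (length xs))

    module Correctness
      (≼-trans : ∀ {x y z} → x ≼ y → y ≼ z → x ≼ z)
      (less⇒≼  : ∀ {x y} → less x y ≡ true → x ≼ y)
      (¬less⇒≽ : ∀ {x y} → less x y ≡ false → y ≼ x) where

      IsPartition : ∀ {A} → (A → X) → X → List A → List A × List A → Set
      IsPartition key p xs (above , below) = xs ↭ above ++ below ×
        All (λ x → p ≼ key x) above × All (λ x → key x ≼ p) below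

      partition-correct : ∀ {A} (key : A → X) p xs →
        Computes (partition key p xs) (IsPartition key p xs) (length xs)
      partition-correct key p []       = ↭-refl , [] , []
      partition-correct key p (x ∷ xs) with less p (key x) in eq
      ... | true  = subst (Computes (partition key p xs >>= _) _) (+-identityʳ _)
        (computes-bind (partition key p xs) (partition-correct key p xs)
          λ (a , b) (perm , p≼a , b≼p) → prep x perm , less⇒≼ eq ∷ p≼a , b≼p)
      ... | false = subst (Computes (partition key p xs >>= _) _) (+-identityʳ _)
        (computes-bind (partition key p xs) (partition-correct key p xs)
          λ (a , b) (perm , p≼a , b≼p) →
            ↭-trans (prep x perm) (↭-sym (shift x a b)) , p≼a , ¬less⇒≽ eq ∷ b≼p)

      module _ {A : Set} where
        open CommutativeMonoidSolver (++-commutativeMonoid {A = A}) public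
          using (_⊕_; _⊜_) renaming (solve to solve-↭)

      adjust-correct : ∀ {A} (key : A → X) {rec : Selector X A} {j xs s c} b →
        IsSplit key xs s → j < length xs → length (hi s) ≤ b → length (lo s) ≤ b →
        (∀ d j ys → length ys ≤ b → j < length ys → Computes (rec d j ys) (IsSelection key ys j) c) →
        Computes (adjust rec j s) (IsSelection key xs j) c
      adjust-correct {A} key {rec} {j} {xs} {s} {c} b isS j< hi≤ lo≤ rec-correct
        with <-cmp j (length (hi s))
      ... | tri< j<hi _ _ = subst (Computes (rec s j (hi s) >>= _) _) (+-identityʳ c)
        (computes-bind (rec s j (hi s)) (rec-correct s j (hi s) hi≤ j<hi) upper)
        where
        upper : ∀ s′ → IsSelection key (hi s) j s′ →
          IsSelection key xs j (split (hi s′) (mid s′) (lo s′ ++ mid s ∷ lo s))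
        upper s′ sel with All-resp-↭ (permutes (isSplit sel)) (above isS)
        ... | m≼m′ ∷ _ = record
          { rank    = rank sel
          ; isSplit = record
            { permutes = begin
                xs  ↭⟨ permutes isS ⟩
                [ mid s ] ++ hi s ++ lo s  ↭⟨ prep (mid s) (Perm.++⁺ʳ (lo s) (permutes (isSplit sel))) ⟩
                [ mid s ] ++ ([ mid s′ ] ++ hi s′ ++ lo s′) ++ lo s ↭⟨ solve-↭ 5 (λ m m′ h′ l′ l → m ⊕ ((m′ ⊕ (h′ ⊕ l′)) ⊕ l) ⊜ m′ ⊕ (h′ ⊕ (l′ ⊕ (m ⊕ l)))) refl-perm [ mid s ] [ mid s′ ] (hi s′) (lo s′) (lo s) ⟩
                [ mid s′ ] ++ hi s′ ++ lo s′ ++ [ mid s ] ++ lo s ∎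
            ; above    = above (isSplit sel)
            ; below    = ++⁺ (below (isSplit sel)) (m≼m′ ∷ All.map (λ x≼m → ≼-trans x≼m m≼m′) (below isS))
            }
          }
          where
          open PermutationReasoning
          refl-perm : ∀ {ys : List A} → ys ↭ ys
          refl-perm = ↭-refl
      ... | tri≈ _ j≡hi _ = record { isSplit = isS ; rank = sym j≡hi }
      ... | tri> _ _ hi<j = subst (Computes (rec s j′ (lo s) >>= _) _) (+-identityʳ c)
        (computes-bind (rec s j′ (lo s)) (rec-correct s j′ (lo s) lo≤ j′<lo) lower)
        where
        j′ : ℕ
        j′ = j ∸ suc (length (hi s))
        j≡ : suc (length (hi s)) + j′ ≡ j
        j≡ = m+[n∸m]≡n hi<j
        j′<lo : j′ < length (lo s)
        j′<lo = +-cancelˡ-< (suc (length (hi s))) j′ (length (lo s)) (begin-strict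
          suc (length (hi s)) + j′  ≡⟨ j≡ ⟩
          j  <⟨ j< ⟩
          length xs  ≡⟨ ↭-length (permutes isS) ⟩
          suc (length (hi s ++ lo s))  ≡⟨ cong suc (length-++ (hi s)) ⟩
          suc (length (hi s)) + length (lo s) ∎)
          where open ≤-Reasoning
        lower : ∀ s′ → IsSelection key (lo s) j′ s′ →
          IsSelection key xs j (split (hi s ++ mid s ∷ hi s′) (mid s′) (lo s′))
        lower s′ sel with All-resp-↭ (permutes (isSplit sel)) (below isS)
        ... | m′≼m ∷ _ = record
          { rank    = trans (length-++ (hi s)) (trans (+-suc (length (hi s)) (length (hi s′)))
              (trans (cong (suc (length (hi s)) +_) (rank sel)) j≡))
          ; isSplit = record
            { permutes = begin
                xs  ↭⟨ permutes isS ⟩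
                [ mid s ] ++ hi s ++ lo s  ↭⟨ prep (mid s) (Perm.++⁺ˡ (hi s) (permutes (isSplit sel))) ⟩
                [ mid s ] ++ hi s ++ [ mid s′ ] ++ hi s′ ++ lo s′ ↭⟨ solve-↭ 5 (λ m m′ h h′ l′ → m ⊕ (h ⊕ (m′ ⊕ (h′ ⊕ l′))) ⊜ m′ ⊕ ((h ⊕ (m ⊕ h′)) ⊕ l′)) refl-perm [ mid s ] [ mid s′ ] (hi s) (hi s′) (lo s′) ⟩
                [ mid s′ ] ++ (hi s ++ [ mid s ] ++ hi s′) ++ lo s′ ∎
            ; above    = ++⁺ (All.map (≼-trans m′≼m) (above isS)) (m′≼m ∷ above (isSplit sel))
            ; below    = below (isSplit sel)
            }
          }
          where
          open PermutationReasoning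
          refl-perm : ∀ {ys : List A} → ys ↭ ys
          refl-perm = ↭-refl

      -- With `m` elements besides the pivot, partitioning costs `m` and a side of at most `m`
      -- elements at most `m * m`. The quadratic cost is harmless, since the procedure is only
      -- called on at most five elements.
      quickselect-correct : ∀ {A} (key : A → X) f →
        Selects key (quickselect key f) f (λ n → n * (n ∸ 1))
      quickselect-correct key (suc f) d j (x ∷ xs) (s≤s xs≤f) j< =
        computes-weaken (quickselect key (suc f) d j (x ∷ xs))
          (≤-reflexive (cong (length xs +_) (refl {x = length xs * length xs}))) id
          (computes-bind (partition key (key x) xs) (partition-correct key (key x) xs)
            λ (a , b) (perm , x≼a , b≼x) →
              adjust-correct key (length xs)
                (record { permutes = prep x perm ; above = x≼a ; below = b≼x }) j<
                (≤-trans (m≤m+n (length a) (length b)) (≤-reflexive (sym (trans (↭-length perm) (length-++ a)))))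
                (≤-trans (m≤n+m (length b) (length a)) (≤-reflexive (sym (trans (↭-length perm) (length-++ a)))))
                λ d j ys ys≤xs j<ys → computes-weaken (quickselect key f d j ys)
                  (*-mono-≤ ys≤xs (≤-trans (m∸n≤m (length ys) 1) ys≤xs)) id
                  (quickselect-correct key f d j ys (≤-trans ys≤xs xs≤f) j<ys))

      concatMap-↭ : ∀ {A B : Set} (f : A → List B) {xs ys} → xs ↭ ys → concatMap f xs ↭ concatMap f ys
      concatMap-↭ f _↭_.refl         = ↭-refl
      concatMap-↭ f (prep x p)       = Perm.++⁺ˡ (f x) (concatMap-↭ f p)
      concatMap-↭ f (swap x y p)     = ↭-trans (Perm.shifts (f x) (f y))
        (Perm.++⁺ˡ (f y) (Perm.++⁺ˡ (f x) (concatMap-↭ f p)))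
      concatMap-↭ f (_↭_.trans p q)  = ↭-trans (concatMap-↭ f p) (concatMap-↭ f q)

      concatMap-split : ∀ {A B : Set} {f g h : A → List B} → (∀ x → f x ↭ g x ++ h x) →
                        ∀ xs → concatMap f xs ↭ concatMap g xs ++ concatMap h xs
      concatMap-split f↭ []       = ↭-refl
      concatMap-split {f = f} {g} {h} f↭ (x ∷ xs) = ↭-trans
        (Perm.++⁺ (f↭ x) (concatMap-split f↭ xs))
        (solve-↭ 4 (λ a b c d → (a ⊕ b) ⊕ (c ⊕ d) ⊜ (a ⊕ c) ⊕ (b ⊕ d)) ↭-refl
          (g x) (h x) (concatMap g xs) (concatMap h xs))

      length-concatMap : ∀ {A B : Set} {f : A → List B} {c xs} → All (λ x → length (f x) ≡ c) xs →
                         length (concatMap f xs) ≡ length xs * c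
      length-concatMap []                          = refl
      length-concatMap {f = f} {xs = x ∷ _} (eq ∷ eqs) =
        trans (length-++ (f x)) (cong₂ _+_ eq (length-concatMap eqs))

      All-concatMap : ∀ {A B : Set} {P : B → Set} {f : A → List B} {xs} →
                      All (All P ∘ f) xs → All P (concatMap f xs)
      All-concatMap []         = []
      All-concatMap (ps ∷ pss) = ++⁺ ps (All-concatMap pss)

      record IsGroup {A} (key : A → X) (s : Split A) : Set where
        field
          above-mid : All (λ x → key (mid s) ≼ key x) (hi s)
          below-mid : All (λ x → key x ≼ key (mid s)) (lo s)
          length-hi : length (hi s) ≡ 2
          length-lo : length (lo s) ≡ 2

      open IsGroup

      record IsGrouping {A} (key : A → X) (xs : List A) (gs : List (Split A)) (rest : List A) : Set where
        field
          regroups : xs ↭ concatMap elements gs ++ rest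
          groups   : All (IsGroup key) gs
          few      : length rest ≤ 4
          size     : length xs ≡ 5 * length gs + length rest

      open IsGrouping

      -- Ordering a group of five costs at most `5 * 4` comparisons, hence 4 per element.
      add-group-correct : ∀ {A} (key : A → X) a five {xs} more → length five ≡ 5 →
        Computes more (λ (gs , rest) → IsGrouping key xs gs rest) (4 * length xs) →
        Computes (add-group key a five more) (λ (gs , rest) → IsGrouping key (five ++ xs) gs rest) (4 * (5 + length xs))
      add-group-correct key a five {xs} more five≡5 more-correct =
        computes-weaken (add-group key a five more) {c = 20 + (4 * length xs + 0)} (≤-reflexive
            (solve 1 (λ n → con 20 :+ (con 4 :* n :+ con 0) := con 4 :* (con 5 :+ n)) refl (length xs))) id
          (computes-bind (quickselect key 5 (split [] a []) 2 five) {c = 20} {4 * length xs + 0}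
            (subst (Computes (quickselect key 5 (split [] a []) 2 five) (IsSelection key five 2)) (cong (λ n → n * (n ∸ 1)) five≡5)
              (quickselect-correct key 5 (split [] a []) 2 five (≤-reflexive five≡5)
                (subst (2 <_) (sym five≡5) (s≤s (s≤s (s≤s z≤n))))))
            λ s sel → computes-bind more more-correct
              λ (gs , rest) grouping → record
                { regroups = ↭-trans (Perm.++⁺ (permutes (isSplit sel)) (regroups grouping))
                    (↭-sym (Perm.++-assoc (elements s) (concatMap elements gs) rest))
                ; groups = record
                    { above-mid = above (isSplit sel) ; below-mid = below (isSplit sel)
                    ; length-hi = rank sel ; length-lo = low-half s sel } ∷ groups grouping
                ; few = few grouping
                ; size = trans (length-++ five) (trans (cong₂ _+_ five≡5 (size grouping))
                    (solve 2 (λ q r → con 5 :+ (con 5 :* q :+ r) := con 5 :* (con 1 :+ q) :+ r) refl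
                      (length gs) (length rest)))
                })
        where
        open ℕ-Solver
        low-half : ∀ s → IsSelection key five 2 s → length (lo s) ≡ 2
        low-half s sel = +-cancelˡ-≡ 3 (length (lo s)) 2 (sym (trans (sym five≡5)
          (trans (↭-length (permutes (isSplit sel)))
            (trans (cong suc (length-++ (hi s))) (cong (λ z → suc (z + length (lo s))) (rank sel))))))

      medians-correct : ∀ {A} (key : A → X) xs →
        Computes (medians key xs) (λ (gs , rest) → IsGrouping key xs gs rest) (4 * length xs)
      medians-correct key []              = record { regroups = ↭-refl ; groups = [] ; few = z≤n ; size = refl }
      medians-correct key (a ∷ [])        = record { regroups = ↭-refl ; groups = [] ; few = s≤s z≤n ; size = refl }
      medians-correct key (a ∷ b ∷ [])    = record { regroups = ↭-refl ; groups = [] ; few = s≤s (s≤s z≤n) ; size = refl }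
      medians-correct key (a ∷ b ∷ c ∷ []) = record { regroups = ↭-refl ; groups = [] ; few = s≤s (s≤s (s≤s z≤n)) ; size = refl }
      medians-correct key (a ∷ b ∷ c ∷ d ∷ []) =
        record { regroups = ↭-refl ; groups = [] ; few = s≤s (s≤s (s≤s (s≤s z≤n))) ; size = refl }
      medians-correct key (a ∷ b ∷ c ∷ d ∷ e ∷ xs) =
        add-group-correct key a (a ∷ b ∷ c ∷ d ∷ e ∷ []) (medians key xs) refl (medians-correct key xs)

      private
        half : ℕ → ℕ → ℕ
        half q r = ⌊ 7 * q + 2 * r /2⌋

        n≤1+2⌊n/2⌋ : ∀ n → n ≤ 1 + 2 * ⌊ n /2⌋
        n≤1+2⌊n/2⌋ zero          = z≤n
        n≤1+2⌊n/2⌋ (suc zero)    = s≤s z≤n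
        n≤1+2⌊n/2⌋ (suc (suc n)) = ≤-trans (+-monoʳ-≤ 2 (n≤1+2⌊n/2⌋ n))
          (≤-reflexive (solve 1 (λ h → con 2 :+ (con 1 :+ con 2 :* h) := con 1 :+ con 2 :* (con 1 :+ h)) refl ⌊ n /2⌋))
          where open ℕ-Solver

        2⌊n/2⌋≤n : ∀ n → 2 * ⌊ n /2⌋ ≤ n
        2⌊n/2⌋≤n zero          = z≤n
        2⌊n/2⌋≤n (suc zero)    = z≤n
        2⌊n/2⌋≤n (suc (suc n)) = ≤-trans
          (≤-reflexive (solve 1 (λ h → con 2 :* (con 1 :+ h) := con 2 :+ con 2 :* h) refl ⌊ n /2⌋))
          (+-monoʳ-≤ 2 (2⌊n/2⌋≤n n))
          where open ℕ-Solver

        -- A side of the pivot misses the pivot, its two companions and three elements of each of c groups.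
        side≤half : ∀ {x c q r} → x + (3 + 3 * c) ≤ 5 * q + r → q ≤ 2 + 2 * c → x ≤ half q r
        side≤half {x} {c} {q} {r} x≤ q≤ = ≤-trans (≤-reflexive (n≡⌊n+n/2⌋ x)) (⌊n/2⌋-mono
          (+-cancelʳ-≤ (3 * q) (x + x) (7 * q + 2 * r) (begin
            x + x + 3 * q  ≤⟨ +-monoʳ-≤ (x + x) (*-monoʳ-≤ 3 q≤) ⟩
            x + x + 3 * (2 + 2 * c)  ≡⟨ solve 2 (λ x c → x :+ x :+ con 3 :* (con 2 :+ con 2 :* c) := con 2 :* (x :+ (con 3 :+ con 3 :* c))) refl x c ⟩
            2 * (x + (3 + 3 * c))  ≤⟨ *-monoʳ-≤ 2 x≤ ⟩
            2 * (5 * q + r)  ≡⟨ solve 2 (λ q r → con 2 :* (con 5 :* q :+ r) := con 7 :* q :+ con 2 :* r :+ con 3 :* q) refl q r ⟩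
            7 * q + 2 * r + 3 * q ∎)))
          where
          open ≤-Reasoning
          open ℕ-Solver

        half<size : ∀ {q r} → 1 ≤ q → half q r < 5 * q + r
        half<size {q} {r} 1≤q = *-cancelˡ-< 2 (half q r) (5 * q + r) (begin-strict
          2 * half q r  ≤⟨ 2⌊n/2⌋≤n (7 * q + 2 * r) ⟩
          7 * q + 2 * r  <⟨ m<m+n (7 * q + 2 * r) (≤-trans 1≤q (m≤n*m q 3)) ⟩
          7 * q + 2 * r + 3 * q  ≡⟨ solve 2 (λ q r → con 7 :* q :+ con 2 :* r :+ con 3 :* q := con 2 :* (con 5 :* q :+ r)) refl q r ⟩
          2 * (5 * q + r) ∎)
          where
          open ≤-Reasoning
          open ℕ-Solver

        -- Grouping costs `4 n`, the medians `100 q`, the pivot `n` and the remaining side about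
        -- `70 n`. Without the remainder `r` this is `95 n`; the slack of `5 n` under `100 n` pays
        -- for the at most four ungrouped elements, since `5 * r ≤ 25 * q`.
        recurrence : ∀ {n q r} → n ≡ 5 * q + r → r ≤ 4 → 1 ≤ q →
                     100 * q + (n + 100 * half q r) ≤ 96 * n
        recurrence {n} {q} {r} refl r≤4 1≤q = +-cancelˡ-≤ (4 * n) _ _ (begin
          4 * n + (100 * q + (n + 100 * half q r))
            ≤⟨ +-monoʳ-≤ (4 * n) (+-monoʳ-≤ (100 * q) (+-monoʳ-≤ n
                 (≤-trans (≤-reflexive (*-assoc 50 2 (half q r))) (*-monoʳ-≤ 50 (2⌊n/2⌋≤n (7 * q + 2 * r)))))) ⟩
          4 * n + (100 * q + (n + 50 * (7 * q + 2 * r)))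
            ≡⟨ solve 2 (λ q r → con 4 :* (con 5 :* q :+ r) :+ (con 100 :* q :+ ((con 5 :* q :+ r) :+ con 50 :* (con 7 :* q :+ con 2 :* r))) := con 475 :* q :+ con 100 :* r :+ con 5 :* r) refl q r ⟩
          475 * q + 100 * r + 5 * r
            ≤⟨ +-monoʳ-≤ (475 * q + 100 * r) (*-monoʳ-≤ 5 (≤-trans r≤4 (≤-trans (*-monoʳ-≤ 4 1≤q) (*-monoˡ-≤ q {4} {5} (n≤1+n 4))))) ⟩
          475 * q + 100 * r + 5 * (5 * q)
            ≡⟨ solve 2 (λ q r → con 475 :* q :+ con 100 :* r :+ con 5 :* (con 5 :* q)
                 := con 4 :* (con 5 :* q :+ r) :+ con 96 :* (con 5 :* q :+ r)) refl q r ⟩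
          4 * n + 96 * n ∎)
          where
          open ≤-Reasoning
          open ℕ-Solver

      module _ {A : Set} {key : A → X} {xs : List A} {gs : List (Split A)} {rest : List A} (grouping : IsGrouping key xs gs rest)
               {G : Split (Split A)} (sel : IsSelection (key ∘ mid) gs ⌊ length gs /2⌋ G)
               {above′ below′ : List A} (part : IsPartition key (key (mid (mid G))) (unknown G ++ rest) (above′ , below′)) where

        private
          pivot : A
          pivot = mid (mid G)
          upper lower : List A
          upper = above′ ++ known-above G
          lower = below′ ++ known-below G
          groupsG : All (IsGroup key) (elements G)
          groupsG = All-resp-↭ (permutes (isSplit sel)) (groups grouping)
          mid-group : IsGroup key (mid G)
          mid-group = All.head groupsG
          hi-groups : All (IsGroup key) (hi G)
          hi-groups = proj₁ (++⁻ (hi G) (All.tail groupsG))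
          lo-groups : All (IsGroup key) (lo G)
          lo-groups = proj₂ (++⁻ (hi G) (All.tail groupsG))

        pivot-split : IsSplit key xs (split upper pivot lower)
        pivot-split = record
          { permutes = begin
              xs
                ↭⟨ regroups grouping ⟩
              concatMap elements gs ++ rest
                ↭⟨ Perm.++⁺ʳ rest (concatMap-↭ elements (permutes (isSplit sel))) ⟩
              (elements (mid G) ++ concatMap elements (hi G ++ lo G)) ++ rest
                ≡⟨ cong (λ z → (elements (mid G) ++ z) ++ rest) (concatMap-++ elements (hi G) (lo G)) ⟩
              (elements (mid G) ++ concatMap elements (hi G) ++ concatMap elements (lo G)) ++ rest
                ↭⟨ Perm.++⁺ʳ rest (Perm.++⁺ˡ (elements (mid G)) (Perm.++⁺
                     (concatMap-split {g = λ s → mid s ∷ hi s} {lo} (λ s → ↭-refl) (hi G))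
                     (concatMap-split {g = λ s → mid s ∷ lo s} {hi} (λ s → prep (mid s) (Perm.++-comm (hi s) (lo s))) (lo G)))) ⟩
              (([ pivot ] ++ hi (mid G) ++ lo (mid G)) ++ (HA ++ HL) ++ (LB ++ LH)) ++ rest
                ↭⟨ solve-↭ 8 (λ p h l ha hl lb lh r → ((p ⊕ (h ⊕ l)) ⊕ ((ha ⊕ hl) ⊕ (lb ⊕ lh))) ⊕ r
                     ⊜ p ⊕ (((hl ⊕ lh) ⊕ r) ⊕ ((h ⊕ ha) ⊕ (l ⊕ lb)))) ↭-refl
                     [ pivot ] (hi (mid G)) (lo (mid G)) HA HL LB LH rest ⟩
              [ pivot ] ++ (unknown G ++ rest) ++ (known-above G ++ known-below G)
                ↭⟨ prep pivot (Perm.++⁺ʳ (known-above G ++ known-below G) (proj₁ part)) ⟩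
              [ pivot ] ++ (above′ ++ below′) ++ (known-above G ++ known-below G)
                ↭⟨ solve-↭ 5 (λ p a b c d → p ⊕ ((a ⊕ b) ⊕ (c ⊕ d)) ⊜ p ⊕ ((a ⊕ c) ⊕ (b ⊕ d))) ↭-refl
                     [ pivot ] above′ below′ (known-above G) (known-below G) ⟩
              [ pivot ] ++ upper ++ lower ∎
          ; above = ++⁺ (proj₁ (proj₂ part)) (++⁺ (above-mid mid-group) (All-concatMap
              (All.zipWith (λ (p≼m , g) → p≼m ∷ All.map (≼-trans p≼m) (above-mid g))
                (above (isSplit sel) , hi-groups))))
          ; below = ++⁺ (proj₂ (proj₂ part)) (++⁺ (below-mid mid-group) (All-concatMap
              (All.zipWith (λ (m≼p , g) → m≼p ∷ All.map (λ x≼m → ≼-trans x≼m m≼p) (below-mid g))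
                (below (isSplit sel) , lo-groups))))
          }
          where
          open PermutationReasoning
          HA = concatMap (λ s → mid s ∷ hi s) (hi G)
          HL = concatMap lo (hi G)
          LB = concatMap (λ s → mid s ∷ lo s) (lo G)
          LH = concatMap hi (lo G)

        private
          q r : ℕ
          q = length gs
          r = length rest
          total : length upper + length lower + 1 ≡ 5 * q + r
          total = trans (+-comm (length upper + length lower) 1) (trans (cong suc (sym (length-++ upper)))
            (trans (sym (↭-length (permutes pivot-split))) (size grouping)))
          q≡ : q ≡ suc (⌊ q /2⌋ + length (lo G))
          q≡ = trans (↭-length (permutes (isSplit sel))) (cong suc (trans (length-++ (hi G))
            (cong (_+ length (lo G)) (rank sel))))
          length-known-above : length (known-above G) ≡ 2 + ⌊ q /2⌋ * 3
          length-known-above = trans (length-++ (hi (mid G))) (cong₂ _+_ (length-hi mid-group)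
            (trans (length-concatMap (All.map (λ g → cong suc (length-hi g)) hi-groups)) (cong (_* 3) (rank sel))))
          length-known-below : length (known-below G) ≡ 2 + length (lo G) * 3
          length-known-below = trans (length-++ (lo (mid G))) (cong₂ _+_ (length-lo mid-group)
            (length-concatMap (All.map (λ g → cong suc (length-lo g)) lo-groups)))
          missing : ∀ c {x y K} → x + y + 1 ≡ 5 * q + r → K ≡ 2 + c * 3 → K ≤ y → x + (3 + 3 * c) ≤ 5 * q + r
          missing c {x} {y} {K} eq refl K≤y = begin
            x + (3 + 3 * c)  ≡⟨ solve 2 (λ x c → x :+ (con 3 :+ con 3 :* c) := x :+ (con 2 :+ c :* con 3) :+ con 1) refl x c ⟩
            x + (2 + c * 3) + 1  ≤⟨ +-monoˡ-≤ 1 (+-monoʳ-≤ x K≤y) ⟩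
            x + y + 1  ≡⟨ eq ⟩
            5 * q + r ∎
            where
            open ≤-Reasoning
            open ℕ-Solver

        upper≤half : length upper ≤ half q r
        upper≤half = side≤half {c = length (lo G)} (missing (length (lo G)) total length-known-below
          (≤-trans (m≤n+m _ (length below′)) (≤-reflexive (sym (length-++ below′)))))
          (begin
            q  ≡⟨ q≡ ⟩
            suc (⌊ q /2⌋ + length (lo G))  ≤⟨ s≤s (+-monoˡ-≤ (length (lo G)) lemma) ⟩
            suc (suc (length (lo G)) + length (lo G)) ≡⟨ solve 1 (λ l → con 1 :+ (con 1 :+ l :+ l) := con 2 :+ con 2 :* l) refl (length (lo G)) ⟩
            2 + 2 * length (lo G) ∎)
          where
          open ≤-Reasoning
          open ℕ-Solver
          -- For even `q` there is one group fewer below the median group than above it; hence the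
          -- `2 + 2 * c` in `side≤half`.
          lemma : ⌊ q /2⌋ ≤ suc (length (lo G))
          lemma = +-cancelˡ-≤ ⌊ q /2⌋ ⌊ q /2⌋ (suc (length (lo G))) (begin
            ⌊ q /2⌋ + ⌊ q /2⌋  ≡⟨ solve 1 (λ h → h :+ h := con 2 :* h) refl ⌊ q /2⌋ ⟩
            2 * ⌊ q /2⌋  ≤⟨ 2⌊n/2⌋≤n q ⟩
            q  ≡⟨ q≡ ⟩
            suc (⌊ q /2⌋ + length (lo G)) ≡⟨ sym (+-suc ⌊ q /2⌋ (length (lo G))) ⟩
            ⌊ q /2⌋ + suc (length (lo G)) ∎)

        lower≤half : length lower ≤ half q r
        lower≤half = side≤half {c = ⌊ q /2⌋} (missing ⌊ q /2⌋
            (trans (cong (_+ 1) (+-comm (length lower) (length upper))) total) length-known-above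
          (≤-trans (m≤n+m _ (length above′)) (≤-reflexive (sym (length-++ above′)))))
          (≤-trans (n≤1+2⌊n/2⌋ q) (n≤1+n _))

        unknown≤ : length (unknown G ++ rest) ≤ length xs
        unknown≤ = begin
          length (unknown G ++ rest)  ≡⟨ trans (↭-length (proj₁ part)) (length-++ above′) ⟩
          length above′ + length below′  ≤⟨ +-mono-≤ (length-≤-++ above′) (length-≤-++ below′) ⟩
          length upper + length lower  ≤⟨ m≤m+n _ 1 ⟩
          length upper + length lower + 1  ≡⟨ trans total (sym (size grouping)) ⟩
          length xs ∎
          where
          open ≤-Reasoning
          length-≤-++ : ∀ (ys : List A) {zs} → length ys ≤ length (ys ++ zs)
          length-≤-++ ys = ≤-trans (m≤m+n _ _) (≤-reflexive (sym (length-++ ys)))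

      select-correct : ∀ {A} (key : A → X) f → Selects key (select key f) f (100 *_)
      select-correct key zero    d j []       _ ()
      select-correct {A} key (suc f) d j xs xs≤ j< with length xs ≤ᵇ 4 in eq
      ... | true  = computes-weaken (quickselect key 4 d j xs)
        (≤-trans (*-monoʳ-≤ (length xs) (≤-trans (m∸n≤m (length xs) 1) (≤-trans xs≤4 (m≤m+n 4 96))))
          (≤-reflexive (*-comm (length xs) 100))) id
        (quickselect-correct key 4 d j xs xs≤4 j<)
        where
        xs≤4 : length xs ≤ 4
        xs≤4 = ≤ᵇ⇒≤ (length xs) 4 (subst T (sym eq) tt)

      ... | false = computes-weaken (medians key xs >>= _) {c = 4 * length xs + 96 * length xs}
        (≤-reflexive (sym (*-distribʳ-+ (length xs) 4 96))) id
        (computes-bind (medians key xs) (medians-correct key xs) λ (gs , rest) grouping →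
          computes-weaken (continue gs rest)
            (recurrence {length xs} (size grouping) (few grouping) (nonempty grouping)) id
            (continue-correct gs rest grouping))
        where
        continue : List (Split A) → List A → Comparing X (Split A)
        continue gs rest = select (key ∘ mid) f (split [] d []) ⌊ length gs /2⌋ gs >>= λ G →
          partition key (key (mid (mid G))) (unknown G ++ rest) >>= λ (above , below) →
          adjust (select key f) j (split (above ++ known-above G) (mid (mid G)) (below ++ known-below G))
        5≤xs : 5 ≤ length xs
        5≤xs = ≰⇒> λ xs≤4 → subst T eq (≤⇒≤ᵇ xs≤4)
        nonempty : ∀ {gs rest} → IsGrouping key xs gs rest → 1 ≤ length gs
        nonempty {[]} grouping = contradiction (≤-trans 5≤xs (≤-reflexive (size grouping))) (<⇒≱ (s≤s (few grouping)))
        nonempty {_ ∷ _} _ = s≤s z≤n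
        q≤half : ∀ q {r} → q ≤ half q r
        q≤half q {r} = ≤-trans (≤-reflexive (n≡⌊n+n/2⌋ q)) (⌊n/2⌋-mono
          (≤-trans (+-monoʳ-≤ q (m≤n*m q 6)) (m≤m+n (7 * q) (2 * r))))
        ⌊q/2⌋<q : ∀ {q} → 1 ≤ q → ⌊ q /2⌋ < q
        ⌊q/2⌋<q {suc q} _ = ⌊n/2⌋<n q
        continue-correct : ∀ gs rest → IsGrouping key xs gs rest →
          Computes (continue gs rest) (IsSelection key xs j)
            (100 * length gs + (length xs + 100 * half (length gs) (length rest)))
        continue-correct gs rest grouping = computes-bind (select (key ∘ mid) f (split [] d []) ⌊ q /2⌋ gs)
          (select-correct (key ∘ mid) f (split [] d []) ⌊ q /2⌋ gs (≤-trans (q≤half q {r}) half≤f)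
            (⌊q/2⌋<q (nonempty grouping)))
          λ G sel → computes-bind (pivoting G)
              -- The number of pivot comparisons is read off the permutation in `pivot-split`, which
              -- presupposes a partition; the truthful run supplies one.
              (computes-weaken (pivoting G) (unknown≤ grouping sel (proj₂ (computes-result (pivoting G) (partitions G)))) id
                (partitions G))
              λ (a , b) part → adjust-correct key (half q r) (pivot-split grouping sel part) j<
                (upper≤half grouping sel part) (lower≤half grouping sel part)
                λ d j ys ys≤ j<ys → computes-weaken (select key f d j ys) (*-monoʳ-≤ 100 ys≤) id
                  (select-correct key f d j ys (≤-trans ys≤ half≤f) j<ys)
          where
          q = length gs
          r = length rest
          pivoting : Split (Split A) → Comparing X (List A × List A)
          pivoting G = partition key (key (mid (mid G))) (unknown G ++ rest)
          partitions : ∀ G → Computes (pivoting G) (IsPartition key (key (mid (mid G))) (unknown G ++ rest))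
                                      (length (unknown G ++ rest))
          partitions G = partition-correct key (key (mid (mid G))) (unknown G ++ rest)
          half≤f : half q r ≤ f
          half≤f = ≤-pred (≤-trans (half<size {q} {r} (nonempty grouping))
            (≤-trans (≤-reflexive (sym (size grouping))) xs≤))

      -- Since `100 * n ≤ 200 * (n - 1)` for `n ≥ 2`, the cost can be stated as a multiple of
      -- `n - 1`; a single candidate then costs nothing, as a block of length 1 requires.
      select-cost : ∀ {A} (key : A → X) d j xs → j < length xs →
        Computes (select key (length xs) d j xs) (IsSelection key xs j) (200 * (length xs ∸ 1))
      select-cost key d j (x ∷ [])     j< = quickselect-correct key 4 d j (x ∷ []) (s≤s z≤n) j<
      select-cost key d j (x ∷ y ∷ xs) j< =
        computes-weaken (select key (length (x ∷ y ∷ xs)) d j (x ∷ y ∷ xs)) (begin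
            100 * (2 + length xs)  ≤⟨ m≤m+n _ (100 * length xs) ⟩
            100 * (2 + length xs) + 100 * length xs ≡⟨ solve 1 (λ n → con 100 :* (con 2 :+ n) :+ con 100 :* n := con 200 :* (con 1 :+ n)) refl (length xs) ⟩
            200 * (1 + length xs) ∎) id
          (select-correct key (length (x ∷ y ∷ xs)) d j (x ∷ y ∷ xs) ≤-refl j<)
        where
        open ≤-Reasoning
        open ℕ-Solver

-- The algorithm and its worst-case resources

module TopAlgorithm where

  open import Data.Bool using (Bool; true; false; if_then_else_; T)
  open import Data.Fin using (Fin; zero; suc; toℕ; fromℕ<)
  open import Data.Fin.Properties using (toℕ-fromℕ<; _≟_)
  open import Data.Fin.Subset using (Subset; _∈_; _⊆_; _∪_; ⁅_⁆; _-_; ∣_∣; ⊥; inside; outside)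
  open import Data.Fin.Subset.Properties using (∪-identityʳ; ∉⊥; ∣⊥∣≡0; ∣p─q∣≤∣p∣; x∈p∪q⁻; x∈⁅y⁆⇒x≡y)
  open import Data.List using (List; []; _∷_; length; lookup; map; foldr)
  open import Data.List.Properties using (length-map)
  open import Data.Nat hiding (compare; _≟_)
  open import Data.Nat.Properties hiding (_≟_)
  open import Data.Product using (∃; _,_; proj₁; proj₂)
  open import Data.Sum using (inj₁; inj₂)
  open import Data.Vec using ([]; _∷_; here; there)
  open import Data.Vec.Functional as Functional using (updateAt)
  open import Function using (_∘_; id; const)
  open import Relation.Binary.PropositionalEquality
  open import Relation.Nullary using (yes; no; contradiction)
  open NoisyComparisons using (vote)
  open Selection

  Member : ∀ {n} → Subset n → Set
  Member M = ∃ (_∈ M)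

  members : ∀ {n} (M : Subset n) → List (Member M)
  members []            = []
  members (inside ∷ M)  = (zero , here) ∷ map (λ (x , x∈M) → suc x , there x∈M) (members M)
  members (outside ∷ M) = map (λ (x , x∈M) → suc x , there x∈M) (members M)

  length-members : ∀ {n} (M : Subset n) → length (members M) ≡ ∣ M ∣
  length-members []            = refl
  length-members (inside ∷ M)  = cong suc (trans (length-map _ (members M)) (length-members M))
  length-members (outside ∷ M) = trans (length-map _ (members M)) (length-members M)

  subset : ∀ {n} {M : Subset n} → List (Member M) → Subset n
  subset = foldr (λ x S → S ∪ ⁅ proj₁ x ⁆) ⊥

  subset⊆ : ∀ {n} {M : Subset n} (xs : List (Member M)) → subset xs ⊆ M
  subset⊆ []       x∈⊥ = contradiction x∈⊥ ∉⊥
  subset⊆ {M = M} (y ∷ ys) x∈S with x∈p∪q⁻ (subset ys) ⁅ proj₁ y ⁆ x∈S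
  ... | inj₁ x∈ys = subset⊆ ys x∈ys
  ... | inj₂ x∈y  = subst (_∈ M) (sym (x∈⁅y⁆⇒x≡y _ x∈y)) (proj₂ y)

  Scores : ℕ → Set
  Scores n = Fin n → ℕ

  -- The order of the updates matters when `winner` and `loser` coincide: the truncated subtraction
  -- comes last, so an element with one point drops to 0 in a duel with itself.
  replay : ∀ {n} → Scores n → (winner loser : Fin n) → Scores n
  replay s winner loser = updateAt (updateAt s winner suc) loser (_∸ 2)

  give-up : ∀ {n} r {t M} → r + t ≡ n → Program n t M
  give-up zero    refl = output ⊥ (λ x∈⊥ → contradiction x∈⊥ ∉⊥)
  give-up (suc r) {t} eq = next (subst (suc t ≤_) eq (s≤s (m≤n+m t r))) (give-up r (trans (+-suc r t) eq))

  -- The cost of `select` is proved for truthful answers; under noise the budget enforces it, since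
  -- comparisons are counted in the worst case. A comparison of an element with itself is answered
  -- without a query, by `false` as in any strict order.
  simulate : ∀ {n M} {A : Set} → (votes budget : ℕ) → Comparing (Member M) A → (A → Program n n M) → Program n n M
  simulate N D       (done a)                           P = P a
  simulate N zero    (compare _ _ _)                    P = give-up 0 refl
  simulate N (suc D) (compare (x , x∈M) (y , y∈M) m) P with x ≟ y
  ... | yes _  = simulate N D (m false) P
  ... | no x≢y = vote x y x≢y (inj₁ x∈M) (inj₁ y∈M) N 0 0 λ b → simulate N D (m b) P

  largest-of : ∀ {n M} → (k N D : ℕ) → List (Member M) → Program n n M
  largest-of k N D []       = give-up 0 refl
  largest-of k N D (x ∷ xs) = simulate N D
    (select id (length (x ∷ xs)) (split [] x []) (k ∸ 1) (x ∷ xs))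
    λ s → output (subset (mid s ∷ hi s)) (subset⊆ (mid s ∷ hi s))

  module _ {n t : ℕ} (rest : ∀ M → Scores n → Program n t M) where

    settle : ∀ M → Scores n → (winner loser : Fin n) → Program n t M
    settle M s winner loser = if replay s winner loser loser ≡ᵇ 0
      then discard loser (rest (M - loser) (replay s winner loser))
      else rest M (replay s winner loser)

  module _ {n t : ℕ} (R : ℕ) (fallback : ∀ {M} → Program n t M) (rest : ∀ M → Scores n → Program n t M) where

    -- An element drawn against itself wins and loses, hence pays one point.
    duel : ∀ {M} → Scores n → Member M → Member M → Program n t M
    duel {M} s (x , x∈M) (y , y∈M) with x ≟ y
    ... | yes _  = settle rest M s x x
    ... | no x≢y = vote x y x≢y (inj₁ x∈M) (inj₁ y∈M) R 0 0 λ b →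
      if b then settle rest M s y x else settle rest M s x y

    random-duel : ∀ {M} → Scores n → List (Member M) → Program n t M
    random-duel s []       = fallback
    random-duel s (x ∷ xs) = random (length xs) λ i → random (length xs) λ j →
      duel s (lookup (x ∷ xs) i) (lookup (x ∷ xs) j)

  module _ {n : ℕ} (k R : ℕ) where

    -- A duel need not discard anybody, so duels are repeated until there is room. The fuel is never
    -- renewed: what is left goes to `rest`, so it limits the duels of the whole stream together.
    shrink : ∀ {t} → (∀ {M} → Program n t M) → (ℕ → ∀ M → Scores n → Program n t M) →
             (fuel : ℕ) → ∀ M → Scores n → Program n t M
    shrink fallback rest zero    M s = if ∣ M ∣ <ᵇ 16 * k then rest zero M s else fallback
    shrink fallback rest (suc f) M s = if ∣ M ∣ <ᵇ 16 * k then rest (suc f) M s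
      else random-duel R fallback (shrink fallback rest f) s (members M)

  module _ {n : ℕ} (k R N D start : ℕ) where

    -- Only arrivals from position `start` on are stored, and only as long as the quota lasts.
    stream : ∀ r {t} → r + t ≡ n → (quota fuel : ℕ) → ∀ M → Scores n → Program n t M
    stream zero        refl c       f M s = largest-of k N D (members M)
    stream (suc r) {t} eq   zero    f M s = next (subst (suc t ≤_) eq (s≤s (m≤n+m t r)))
      (stream r (trans (+-suc r t) eq) zero f M s)
    stream (suc r) {t} eq   (suc c) f M s = next t<n (if start ≤ᵇ t
      then store (fromℕ< t<n) (cong suc (toℕ-fromℕ< t<n))
        (shrink k R (give-up r eq′) (λ f M s → stream r eq′ c f M s) f (M ∪ ⁅ fromℕ< t<n ⁆) s)
      else stream r eq′ (suc c) f M s)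
      where
      t<n : t < n
      t<n = subst (suc t ≤_) eq (s≤s (m≤n+m t r))
      eq′ : r + suc t ≡ n
      eq′ = trans (+-suc r t) eq

  -- 1/G is a lower bound of γ, h the initial score; one of `blocks` blocks of length w is
  -- examined.  The budgets are multiples of w - 1, since a block of length 1 must cost no
  -- comparison: for very small success probabilities fewer than one comparison is allowed.
  algorithm : ∀ n (k G h blocks w : ℕ) → StreamingAlgorithm n
  algorithm n k G h blocks w = random (blocks ∸ 1) λ o →
    -- By `drift-power`, a duel errs with probability at most 1/16 and a final comparison with
    -- probability at most `½ ^ h`. The fuel pays for `h + 2` units of potential per stored element;
    -- the factor 2 makes up for `w ∸ 1` in place of `w`.
    stream k (G * G * 4) (G * G * h) (200 * ((w ∸ 1) ⊓ (16 * k))) (toℕ o * w)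
      n (+-identityʳ n) w (2 * (h + 2) * (w ∸ 1)) ⊥ (const h)

  record Within (memory queries : ℕ) {n t M} (P : Program n t M) : Set where
    constructor within
    field
      memory≤  : peakMemory P ≤ memory
      queries≤ : comparisons P ≤ queries

  open Within

  module _ {c : ℕ} where

    within-mono : ∀ {q q′ n t M} {P : Program n t M} → q ≤ q′ → Within c q P → Within c q′ P
    within-mono q≤q′ (within m p) = within m (≤-trans p q≤q′)

    within-next : ∀ {q n t M t<n} {P : Program n (suc t) M} → ∣ M ∣ ≤ c → Within c q P → Within c q (next t<n P)
    within-next M≤c (within m p) = within (⊔-lub M≤c m) p

    within-query : ∀ {q n t M i j i≢j i∈ j∈} {P : Bool → Program n t M} → ∣ M ∣ ≤ c →
      (∀ b → Within c q (P b)) → Within c (suc q) (query i j i≢j i∈ j∈ P)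
    within-query M≤c P≤ = within (⊔-lub M≤c (⊔-lub (memory≤ (P≤ true)) (memory≤ (P≤ false))))
      (s≤s (⊔-lub (queries≤ (P≤ true)) (queries≤ (P≤ false))))

    within-random : ∀ {q n t M m} {P : Fin (suc m) → Program n t M} → ∣ M ∣ ≤ c →
      (∀ x → Within c q (P x)) → Within c q (random m P)
    within-random M≤c P≤ = within (⊔-lub M≤c (maximum (memory≤ ∘ P≤))) (maximum (queries≤ ∘ P≤))
      where
      maximum : ∀ {m b} {f : Fin m → ℕ} → (∀ x → f x ≤ b) → Functional.foldr _⊔_ 0 f ≤ b
      maximum {zero}  _   = z≤n
      maximum {suc m} f≤b = ⊔-lub (f≤b zero) (maximum (f≤b ∘ suc))

    within-vote : ∀ {q n t M i j i≢j i∈ j∈} N y z {P : Bool → Program n t M} → ∣ M ∣ ≤ c →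
      (∀ b → Within c q (P b)) → Within c (N + q) (vote i j i≢j i∈ j∈ N y z P)
    within-vote zero    y z M≤c P≤ = P≤ (z <ᵇ y)
    within-vote (suc N) y z M≤c P≤ = within-query M≤c λ where
      true  → within-vote N (suc y) z M≤c P≤
      false → within-vote N y (suc z) M≤c P≤

    within-give-up : ∀ {q n} r {t M} (eq : r + t ≡ n) → ∣ M ∣ ≤ c → Within c q (give-up r {M = M} eq)
    within-give-up zero    refl M≤c = within M≤c z≤n
    within-give-up (suc r) eq   M≤c = within-next M≤c (within-give-up r _ M≤c)

    within-simulate : ∀ {n M A} N D (m : Comparing (Member M) A) {P : A → Program n n M} → ∣ M ∣ ≤ c →
      (∀ a → Within c 0 (P a)) → Within c (D * N) (simulate N D m P)
    within-simulate N D       (done a)        M≤c P≤ = within-mono z≤n (P≤ a)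
    within-simulate N zero    (compare _ _ _) M≤c P≤ = within-give-up 0 refl M≤c
    within-simulate N (suc D) (compare (x , x∈M) (y , y∈M) m) M≤c P≤ with x ≟ y
    ... | yes _  = within-mono (m≤n+m (D * N) N) (within-simulate N D (m false) M≤c P≤)
    ... | no x≢y = within-vote N 0 0 M≤c λ b → within-simulate N D (m b) M≤c P≤

    within-largest-of : ∀ {n} {M : Subset n} k N D xs → ∣ M ∣ ≤ c → Within c (D * N) (largest-of {M = M} k N D xs)
    within-largest-of k N D []       M≤c = within-give-up 0 refl M≤c
    within-largest-of k N D (x ∷ xs) M≤c = within-simulate N D
      (select id (length (x ∷ xs)) (split [] x []) (k ∸ 1) (x ∷ xs)) M≤c λ _ → within M≤c z≤n

    within-settle : ∀ {n t q} {rest : ∀ M → Scores n → Program n t M} {M s} w l →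
      ∣ M ∣ ≤ c → (∀ M s → ∣ M ∣ ≤ c → Within c q (rest M s)) → Within c q (settle rest M s w l)
    within-settle {M = M} {s} w l M≤c rest≤ with replay s w l l ≡ᵇ 0
    ... | false = rest≤ M (replay s w l) M≤c
    ... | true  = within (⊔-lub M≤c (memory≤ rest′)) (queries≤ rest′)
      where rest′ = rest≤ (M - l) (replay s w l) (≤-trans (∣p─q∣≤∣p∣ M ⁅ l ⁆) M≤c)

    within-random-duel : ∀ {n t q} R {fallback : ∀ {M} → Program n t M} {rest : ∀ M → Scores n → Program n t M} {M s} xs →
      ∣ M ∣ ≤ c → Within c (R + q) (fallback {M}) → (∀ M s → ∣ M ∣ ≤ c → Within c q (rest M s)) →
      Within c (R + q) (random-duel R fallback rest {M} s xs)
    within-random-duel R []       M≤c fallback≤ rest≤ = fallback≤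
    within-random-duel {n} {t} {q} R {fallback} {rest} {M} {s} (x ∷ xs) M≤c fallback≤ rest≤ =
      within-random M≤c λ i → within-random M≤c λ j → within-duel (lookup (x ∷ xs) i) (lookup (x ∷ xs) j)
      where
      within-duel : ∀ a b → Within c (R + q) (duel R fallback rest s a b)
      within-duel (a , a∈M) (b , b∈M) with a ≟ b
      ... | yes _  = within-mono (m≤n+m q R) (within-settle {rest = rest} a a M≤c rest≤)
      ... | no a≢b = within-vote R 0 0 M≤c λ where
        true  → within-settle {rest = rest} b a M≤c rest≤
        false → within-settle {rest = rest} a b M≤c rest≤

  ∣p∪⁅x⁆∣≤1+∣p∣ : ∀ {n} (p : Subset n) x → ∣ p ∪ ⁅ x ⁆ ∣ ≤ suc ∣ p ∣
  ∣p∪⁅x⁆∣≤1+∣p∣ (inside ∷ p)  zero    = ≤-trans (≤-reflexive (cong (suc ∘ ∣_∣) (∪-identityʳ p))) (n≤1+n _)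
  ∣p∪⁅x⁆∣≤1+∣p∣ (outside ∷ p) zero    = ≤-reflexive (cong (suc ∘ ∣_∣) (∪-identityʳ p))
  ∣p∪⁅x⁆∣≤1+∣p∣ (inside ∷ p)  (suc x) = s≤s (∣p∪⁅x⁆∣≤1+∣p∣ p x)
  ∣p∪⁅x⁆∣≤1+∣p∣ (outside ∷ p) (suc x) = ∣p∪⁅x⁆∣≤1+∣p∣ p x

  module _ {n : ℕ} (k R N D start : ℕ) (1≤k : 1 ≤ k) where

    within-shrink : ∀ {t q} {fallback : ∀ {M} → Program n t M} {rest : ℕ → ∀ M → Scores n → Program n t M} →
      (∀ {M q} → ∣ M ∣ ≤ 17 * k → Within (17 * k) q (fallback {M})) →
      (∀ f M s → ∣ M ∣ ≤ 16 * k → Within (17 * k) (f * R + q) (rest f M s)) →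
      ∀ f M s → ∣ M ∣ ≤ 17 * k → Within (17 * k) (f * R + q) (shrink k R fallback rest f M s)
    within-shrink fallback≤ rest≤ zero M s M≤ with ∣ M ∣ <ᵇ 16 * k in eq
    ... | true  = rest≤ zero M s (<⇒≤ (<ᵇ⇒< _ _ (subst T (sym eq) _)))
    ... | false = fallback≤ M≤
    within-shrink {q = q} {fallback} {rest} fallback≤ rest≤ (suc f) M s M≤ with ∣ M ∣ <ᵇ 16 * k in eq
    ... | true  = rest≤ (suc f) M s (<⇒≤ (<ᵇ⇒< _ _ (subst T (sym eq) _)))
    ... | false = within-mono (≤-reflexive (sym (+-assoc R (f * R) q)))
      (within-random-duel R {fallback} {shrink k R fallback rest f} (members M) M≤ (fallback≤ M≤)
        (within-shrink {fallback = fallback} {rest} fallback≤ rest≤ f))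

    within-stream : ∀ r {t} (eq : r + t ≡ n) c f M s → ∣ M ∣ ≤ 16 * k →
      Within (17 * k) (f * R + D * N) (stream k R N D start r eq c f M s)
    within-stream zero    refl c       f M s M≤ = within-mono (m≤n+m (D * N) (f * R))
      (within-largest-of k N D (members M) (≤-trans M≤ (m≤n+m (16 * k) k)))
    within-stream (suc r) eq   zero    f M s M≤ = within-next (≤-trans M≤ (m≤n+m (16 * k) k))
      (within-stream r _ zero f M s M≤)
    within-stream (suc r) {t} eq (suc c) f M s M≤ = within-next (≤-trans M≤ (m≤n+m (16 * k) k)) arrival
      where
      arrival : Within (17 * k) (f * R + D * N) (if start ≤ᵇ t then _ else _)
      arrival with start ≤ᵇ t
      ... | false = within-stream r _ (suc c) f M s M≤
      ... | true  = within (⊔-lub (≤-trans M≤ (m≤n+m (16 * k) k)) (memory≤ shrunk)) (queries≤ shrunk)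
        where
        shrunk = within-shrink (λ {M} → within-give-up r {M = M} _)
          (λ f M s → within-stream r _ c f M s) f (M ∪ ⁅ fromℕ< _ ⁆) s
          (≤-trans (∣p∪⁅x⁆∣≤1+∣p∣ M _) (+-mono-≤ 1≤k M≤))

  -- From `h ≥ 1`, `2 * (h + 2) ≤ 6 * h`; with 4 votes per `G * G` the duels account for 24, the
  -- selection for 200. Memory exceeds `16 * k` by at most the one element just stored, hence 17.
  within-algorithm : ∀ n k G h blocks w → 1 ≤ k → 1 ≤ h →
    Within (17 * k) (224 * ((w ∸ 1) * h * (G * G))) (algorithm n k G h blocks w)
  within-algorithm n k G h blocks w 1≤k 1≤h = within-random (≤-trans (≤-reflexive (∣⊥∣≡0 n)) z≤n) λ o →
    within-mono (begin
      2 * (h + 2) * v * (G * G * 4) + 200 * (v ⊓ (16 * k)) * (G * G * h)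
        ≤⟨ +-mono-≤ (*-monoˡ-≤ (G * G * 4) (*-monoˡ-≤ v (*-monoʳ-≤ 2 (+-monoʳ-≤ h (*-monoʳ-≤ 2 1≤h)))))
             (*-monoˡ-≤ (G * G * h) (*-monoʳ-≤ 200 (m⊓n≤m v (16 * k)))) ⟩
      2 * (h + 2 * h) * v * (G * G * 4) + 200 * v * (G * G * h)
        ≡⟨ solve 3 (λ v h g → con 2 :* (h :+ con 2 :* h) :* v :* (g :* con 4) :+ con 200 :* v :* (g :* h)
             := con 224 :* (v :* h :* g)) refl v h (G * G) ⟩
      224 * (v * h * (G * G)) ∎)
    (within-stream k (G * G * 4) (G * G * h) (200 * (v ⊓ (16 * k))) (toℕ o * w) 1≤k n _ w
      (2 * (h + 2) * v) ⊥ (const h) (≤-trans (≤-reflexive (∣⊥∣≡0 n)) z≤n))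
    where
    open ≤-Reasoning
    open ℕ-Solver
    v : ℕ
    v = w ∸ 1

-- The k largest elements and the output of the selection

module LargestElements where

  open import Data.Bool using (Bool; true; false)
  open import Data.Fin using (Fin; zero; suc)
  open import Data.Fin.Properties as Finₚ using (any?)
  open import Data.Fin.Subset using (Subset; _∈_; _∉_; _⊆_; _∪_; ⁅_⁆; ∣_∣; ⊤; inside; outside)
  open import Data.Fin.Subset.Properties
    using (_∈?_; ∪-identityʳ; ∉⊥; ∣⊥∣≡0; ∣⊤∣≡n; ∈⊤; x∈p∪q⁻; x∈p∪q⁺; x∈⁅x⁆; x∈⁅y⁆⇒x≡y; p⊂q⇒∣p∣<∣q∣)
  open import Data.List using (List; []; _∷_; length; lookup; map; _++_)
  open import Data.List.Membership.Propositional using () renaming (_∈_ to _∈ₗ_)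
  open import Data.List.Membership.Propositional.Properties using (∈-map⁺; ∈-++⁻; ∈-map⁻)
  open import Data.List.Properties using (map-∘)
  open import Data.List.Relation.Binary.Permutation.Propositional using (_↭_; ↭⇒↭ₛ)
  open import Data.List.Relation.Binary.Permutation.Propositional.Properties using (∈-resp-↭; map⁺)
  open import Data.List.Relation.Binary.Permutation.Setoid.Properties using (Unique-resp-↭)
  open import Data.List.Relation.Unary.All as All using (All; []; _∷_)
  open import Data.List.Relation.Unary.Any using (here; there)
  open import Data.List.Relation.Unary.AllPairs using ([]; _∷_)
  open import Data.List.Relation.Unary.Unique.Propositional using (Unique)
  open import Data.List.Relation.Unary.Unique.Propositional.Properties as Unique using ()
  open import Data.Nat hiding (compare; less; _≟_; _<?_)
  open import Data.Nat.Properties hiding (_≟_; _<?_)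
  open import Data.Product using (∃; _×_; _,_; proj₁)
  open import Data.Sum using (_⊎_; inj₁; inj₂)
  open import Data.Vec using ([]; _∷_; here; there)
  open import Function using (_∘_; id)
  open import Relation.Binary using (Rel; IsStrictTotalOrder; tri<; tri≈; tri>)
  open import Relation.Binary.PropositionalEquality renaming (setoid to ≡-setoid)
  open import Relation.Nullary using (¬_; yes; no; does; contradiction; ¬?)
  open import Relation.Nullary.Decidable using (dec-true; _×-dec_)
  open Selection hiding (compare)
  open TopAlgorithm

  map-proj₁-shift : ∀ {n} (M : Subset n) (xs : List (Member M)) {b} →
    map proj₁ (map {B = Member (b ∷ M)} (λ (x , x∈M) → suc x , there x∈M) xs) ≡ map suc (map proj₁ xs)
  map-proj₁-shift M xs = trans (sym (map-∘ xs)) (map-∘ xs)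

  ∈⇒∈-members : ∀ {n} {M : Subset n} {x} → x ∈ M → x ∈ₗ map proj₁ (members M)
  ∈⇒∈-members {M = inside ∷ M}  here      = here refl
  ∈⇒∈-members {M = inside ∷ M}  (there p) rewrite map-proj₁-shift M (members M) {inside} = there (∈-map⁺ suc (∈⇒∈-members p))
  ∈⇒∈-members {M = outside ∷ M} (there p) rewrite map-proj₁-shift M (members M) {outside} = ∈-map⁺ suc (∈⇒∈-members p)

  members-unique : ∀ {n} (M : Subset n) → Unique (map proj₁ (members M))
  members-unique []            = []
  members-unique (inside ∷ M)  rewrite map-proj₁-shift M (members M) {inside} =
    All.tabulate (λ {y} y∈ 0≡y → 0∉suc y∈ 0≡y) ∷ Unique.map⁺ Finₚ.suc-injective (members-unique M)
    where
    0∉suc : ∀ {m} {xs : List (Fin m)} {y : Fin (suc m)} → y ∈ₗ map Fin.suc xs → Fin.zero ≢ y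
    0∉suc y∈ refl with ∈-map⁻ Fin.suc y∈
    ... | _ , _ , ()
  members-unique (outside ∷ M) rewrite map-proj₁-shift M (members M) {outside} =
    Unique.map⁺ Finₚ.suc-injective (members-unique M)

  ∈-subset⁺ : ∀ {n} {M : Subset n} {x} {xs : List (Member M)} → x ∈ₗ map proj₁ xs → x ∈ subset xs
  ∈-subset⁺ {xs = y ∷ ys} (here refl) = x∈p∪q⁺ {p = subset ys} (inj₂ (x∈⁅x⁆ (proj₁ y)))
  ∈-subset⁺ {xs = y ∷ ys} (there x∈)  = x∈p∪q⁺ (inj₁ (∈-subset⁺ x∈))

  ∈-subset⁻ : ∀ {n} {M : Subset n} {x} (xs : List (Member M)) → x ∈ subset xs → x ∈ₗ map proj₁ xs
  ∈-subset⁻ []       x∈ = contradiction x∈ ∉⊥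
  ∈-subset⁻ (y ∷ ys) x∈ with x∈p∪q⁻ (subset ys) ⁅ proj₁ y ⁆ x∈
  ... | inj₁ x∈ys = there (∈-subset⁻ ys x∈ys)
  ... | inj₂ x∈y  = here (x∈⁅y⁆⇒x≡y (proj₁ y) x∈y)

  x∉p⇒∣p∪⁅x⁆∣≡1+∣p∣ : ∀ {n} {p : Subset n} {x} → x ∉ p → ∣ p ∪ ⁅ x ⁆ ∣ ≡ suc ∣ p ∣
  x∉p⇒∣p∪⁅x⁆∣≡1+∣p∣ {p = inside ∷ p}  {zero}  x∉ = contradiction here x∉
  x∉p⇒∣p∪⁅x⁆∣≡1+∣p∣ {p = outside ∷ p} {zero}  x∉ = cong (suc ∘ ∣_∣) (∪-identityʳ p)
  x∉p⇒∣p∪⁅x⁆∣≡1+∣p∣ {p = inside ∷ p}  {suc x} x∉ = cong suc (x∉p⇒∣p∪⁅x⁆∣≡1+∣p∣ (x∉ ∘ there))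
  x∉p⇒∣p∪⁅x⁆∣≡1+∣p∣ {p = outside ∷ p} {suc x} x∉ = x∉p⇒∣p∪⁅x⁆∣≡1+∣p∣ (x∉ ∘ there)

  ∣subset∣ : ∀ {n} {M : Subset n} (xs : List (Member M)) → Unique (map proj₁ xs) → ∣ subset xs ∣ ≡ length xs
  ∣subset∣ {n} []   _            = ∣⊥∣≡0 n
  ∣subset∣ (x ∷ xs) (x≢ ∷ unique) = trans
    (x∉p⇒∣p∪⁅x⁆∣≡1+∣p∣ (λ x∈ → All.lookup x≢ (∈-subset⁻ xs x∈) refl)) (cong suc (∣subset∣ xs unique))

  module _ {n : ℕ} {_≺_ : Rel (Fin n) 0ℓ} (order : IsStrictTotalOrder _≡_ _≺_) where

    open IsStrictTotalOrder order using (_<?_; compare; irrefl; asym) renaming (trans to ≺-trans)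

    _≼_ : Fin n → Fin n → Set
    x ≼ y = ¬ (y ≺ x)

    ≼-trans : ∀ {x y z} → x ≼ y → y ≼ z → x ≼ z
    ≼-trans {x} {y} {z} x≼y y≼z z≺x with compare y z
    ... | tri< y≺z _ _    = x≼y (≺-trans y≺z z≺x)
    ... | tri≈ _ refl _   = x≼y z≺x
    ... | tri> _ _ z≺y    = y≼z z≺y

    ≼∧≢⇒≺ : ∀ {x y} → x ≼ y → x ≢ y → x ≺ y
    ≼∧≢⇒≺ {x} {y} x≼y x≢y with compare x y
    ... | tri< x≺y _ _ = x≺y
    ... | tri≈ _ x≡y _ = contradiction x≡y x≢y
    ... | tri> _ _ y≺x = contradiction y≺x x≼y

    module _ (M : Subset n) where

      _≼ₘ_ : Member M → Member M → Set
      x ≼ₘ y = proj₁ x ≼ proj₁ y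

      less : Member M → Member M → Bool
      less x y = does (proj₁ x <? proj₁ y)

      private
        less⇒≼ : ∀ {x y} → less x y ≡ true → x ≼ₘ y
        less⇒≼ {x , _} {y , _} eq y≺x with x <? y
        ... | yes x≺y = asym x≺y y≺x
        less⇒≼ {x , _} {y , _} () y≺x | no _

        ¬less⇒≽ : ∀ {x y} → less x y ≡ false → y ≼ₘ x
        ¬less⇒≽ {x , _} {y , _} eq x≺y with trans (sym eq) (dec-true (x <? y) x≺y)
        ... | ()

      open Correctness _≼ₘ_ less ≼-trans (λ {x} {y} → less⇒≼ {x} {y}) (λ {x} {y} → ¬less⇒≽ {x} {y}) public
        using (select-cost)

      LargestOf : Split (Member M) → Set
      LargestOf s = ∀ i → i ∈ subset (mid s ∷ hi s) → ∀ j → j ∈ M → j ∉ subset (mid s ∷ hi s) → j ≺ i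

      selection-largest : ∀ {j s} → IsSelection _≼ₘ_ less id (members M) j s →
        ∣ subset (mid s ∷ hi s) ∣ ≡ suc j × LargestOf s
      selection-largest {j} {s} sel = trans (∣subset∣ (mid s ∷ hi s) hi-unique) (cong suc rank) , largest
        where
        open IsSelection sel
        open IsSplit isSplit
        perm : map proj₁ (members M) ↭ map proj₁ (mid s ∷ hi s ++ lo s)
        perm = map⁺ proj₁ permutes
        unique-prefix : ∀ (xs : List (Member M)) {ys} → Unique (map proj₁ (xs ++ ys)) → Unique (map proj₁ xs)
        unique-prefix []       _        = []
        unique-prefix (x ∷ xs) (p ∷ u) = All.tabulate (λ {y} y∈ → All.lookup p
          (prefix xs y∈)) ∷ unique-prefix xs u
          where
          prefix : ∀ (xs : List (Member M)) {ys y} → y ∈ₗ map proj₁ xs → y ∈ₗ map proj₁ (xs ++ ys)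
          prefix (x ∷ xs) (here eq)  = here eq
          prefix (x ∷ xs) (there y∈) = there (prefix xs y∈)
        hi-unique : Unique (map proj₁ (mid s ∷ hi s))
        hi-unique = unique-prefix (mid s ∷ hi s) (Unique-resp-↭ (≡-setoid (Fin n)) (↭⇒↭ₛ perm) (members-unique M))
        mid≼ : ∀ {i} → i ∈ₗ map proj₁ (mid s ∷ hi s) → proj₁ (mid s) ≼ i
        mid≼ (here refl) = irrefl refl
        mid≼ (there i∈) with ∈-map⁻ proj₁ i∈
        ... | _ , x∈hi , refl = All.lookup above x∈hi
        side : ∀ {j} → j ∈ₗ map proj₁ (mid s ∷ hi s ++ lo s) → j ∈ₗ map proj₁ (mid s ∷ hi s) ⊎ j ≼ proj₁ (mid s)
        side (here refl) = inj₁ (here refl)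
        side (there j∈) with ∈-map⁻ proj₁ j∈
        ... | _ , x∈ , refl with ∈-++⁻ (hi s) x∈
        ...   | inj₁ x∈hi = inj₁ (there (∈-map⁺ proj₁ x∈hi))
        ...   | inj₂ x∈lo = inj₂ (All.lookup below x∈lo)
        largest : LargestOf s
        largest i i∈S j j∈M j∉S with side (∈-resp-↭ perm (∈⇒∈-members j∈M))
        ... | inj₁ j∈hi  = contradiction (∈-subset⁺ {xs = mid s ∷ hi s} j∈hi) j∉S
        ... | inj₂ j≼mid = ≼∧≢⇒≺ (≼-trans j≼mid (mid≼ (∈-subset⁻ {x = i} (mid s ∷ hi s) i∈S)))
          λ { refl → j∉S i∈S }

    -- The set is computed by the selection procedure itself, run with truthful answers on all
    -- elements.
    largest-exists : ∀ {k} → 1 ≤ k → k ≤ n → ∃ (IsLargest order k)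
    largest-exists {suc k} _ k<n with members {n} ⊤ in eq
    ... | []     = contradiction k<n (<⇒≱ (s≤s (≤-trans (≤-reflexive (trans (sym (∣⊤∣≡n n))
                     (trans (sym (length-members {n} ⊤)) (cong length eq)))) z≤n)))
    ... | x ∷ xs with computes-result (_≼ₘ_ ⊤) (less ⊤) (select id (length (members {n} ⊤)) (split [] x []) k (members ⊤))
                        (select-cost ⊤ id (split [] x []) k (members ⊤)
                          (subst (k <_) (sym (trans (length-members {n} ⊤) (∣⊤∣≡n n))) k<n))
    ...   | s , sel with selection-largest ⊤ sel
    ...     | size , largest = subset (mid s ∷ hi s) , size , λ i i∈ j j∉ → largest i i∈ j ∈⊤ j∉

    -- A `j` outside `M` is outside `top`, hence below every `i` in `top`. If some `i` of `S` were
    -- not in `top`, equal sizes would leave a `y` of `top` outside `S`; as `y` is in `M`, it would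
    -- be both below and above `i`.
    largest-within : ∀ {k top M S} → IsLargest order k top → top ⊆ M → ∣ S ∣ ≡ k →
      (∀ i → i ∈ S → ∀ j → j ∈ M → j ∉ S → j ≺ i) → IsLargest order k S
    largest-within {k} {top} {M} {S} (size , top-largest) top⊆M ∣S∣≡k largest = ∣S∣≡k , bound
      where
      bound : ∀ i → i ∈ S → ∀ j → j ∉ S → j ≺ i
      bound i i∈S j j∉S with j ∈? M | i ∈? top
      ... | yes j∈M | _         = largest i i∈S j j∈M j∉S
      ... | no j∉M  | yes i∈top = top-largest i i∈top j (j∉M ∘ top⊆M)
      ... | no j∉M  | no i∉top  with any? (λ y → (y ∈? top) ×-dec ¬? (y ∈? S))
      ...   | yes (y , y∈top , y∉S) = contradiction (largest i i∈S y (top⊆M y∈top) y∉S)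
                (asym (top-largest y y∈top i i∉top))
      ...   | no ¬∃ = contradiction (p⊂q⇒∣p∣<∣q∣ (top⊆S , i , i∈S , i∉top))
                (<-irrefl (trans size (sym ∣S∣≡k)))
        where
        top⊆S : top ⊆ S
        top⊆S {y} y∈top with y ∈? S
        ... | yes y∈S = y∈S
        ... | no y∉S  = contradiction (y , y∈top , y∉S) ¬∃

-- Sums, averages and the potential of the score game

module ScoreGame where

  open import Data.Bool using (if_then_else_)
  open import Data.Fin using (Fin; zero; suc)
  open import Data.Fin.Properties as Finₚ using (_≟_)
  open import Data.Fin.Subset using (Subset; _∈_; _∉_; _⊆_; _∪_; ⁅_⁆; ∣_∣; inside; outside)
    renaming (_-_ to _∖_)
  open import Data.Fin.Subset.Properties
    using (_∈?_; x∈p∪q⁻; x∈⁅y⁆⇒x≡y)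
  open import Data.List using (List; []; _∷_; lookup; map)
  open import Data.Nat as ℕ using (ℕ; zero; suc; _∸_)
  open import Data.Product using (proj₁)
  open import Data.Rational hiding (_≟_; _<?_; _⊔_; _⊓_; ∣_∣)
  open import Data.Rational.Properties hiding (_≟_; _<?_)
  open import Data.Sum using (inj₁; inj₂)
  open import Data.Vec using ([]; _∷_; there)
  open import Data.Vec.Functional.Properties using (updateAt-updates; updateAt-minimal)
  open import Function using (_∘_)
  open import Level using (Level)
  open import Relation.Binary.PropositionalEquality
  open import Relation.Nullary using (yes; no; does; contradiction)
  open import Algebra.Bundles using (CommutativeMonoid; CommutativeRing)
  open import Algebra.Properties.Semiring.Sum (CommutativeRing.semiring +-*-commutativeRing)
    using (sum; ∑-distrib-+; *-distribˡ-sum; *-distribʳ-sum; sum-cong-≗)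
  open import Algebra.Properties.CommutativeMonoid.Sum ℕₚ.+-0-commutativeMonoid
    using () renaming (sum to sumₙ; ∑-distrib-+ to ∑ₙ-distrib-+)
  open RationalArithmetic
  open RealBounds
  open NoisyComparisons
  open Selection hiding (compare)
  open TopAlgorithm
  open LargestElements

  module _ {c ℓ : Level} (A : CommutativeMonoid c ℓ) where

    open CommutativeMonoid A renaming (Carrier to ⟨A⟩; sym to ≈-sym; trans to ≈-trans; refl to ≈-refl)
    open import Algebra.Properties.CommutativeMonoid.Sum A using ()
      renaming (sum to sumₐ; sum-remove to sumₐ-remove; sum-cong-≋ to sumₐ-cong; sum-replicate-zero to sumₐ-zero)

    sum-indicator : ∀ {m} (a : Fin m) v → sumₐ (λ x → if does (x ≟ a) then v else ε) ≈ v
    sum-indicator {suc m} a v = ≈-trans (sumₐ-remove {i = a} (λ x → if does (x ≟ a) then v else ε)) (≈-trans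
      (∙-cong (at (a ≟ a)) (≈-trans (sumₐ-cong off) (sumₐ-zero m))) (identityʳ v))
      where
      at : ∀ d → (if does d then v else ε) ≈ v
      at (yes _)  = ≈-refl
      at (no a≢a) = contradiction refl a≢a
      off : ∀ i → (if does (Data.Fin.punchIn a i ≟ a) then v else ε) ≈ ε
      off i with Data.Fin.punchIn a i ≟ a
      ... | yes eq = contradiction eq (Finₚ.punchInᵢ≢i a i)
      ... | no _   = ≈-refl

  single : ∀ {n} → Fin n → ℚ → Fin n → ℚ
  single a v x = if does (x ≟ a) then v else 0ℚ

  ∑-single : ∀ {n} (a : Fin n) v → sum (single a v) ≡ v
  ∑-single = sum-indicator +-0-commutativeMonoid

  singleₙ : ∀ {n} → Fin n → ℕ → Fin n → ℕ
  singleₙ a v x = if does (x ≟ a) then v else 0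

  ∑ₙ-single : ∀ {n} (a : Fin n) v → sumₙ (singleₙ a v) ≡ v
  ∑ₙ-single = sum-indicator ℕₚ.+-0-commutativeMonoid

  ∑ₙ-mono : ∀ {m} {f g : Fin m → ℕ} → (∀ i → f i ℕ.≤ g i) → sumₙ f ℕ.≤ sumₙ g
  ∑ₙ-mono {zero}  _   = ℕ.z≤n
  ∑ₙ-mono {suc m} f≤g = ℕₚ.+-mono-≤ (f≤g zero) (∑ₙ-mono (f≤g ∘ suc))

  ∑-nonneg : ∀ {m} {f : Fin m → ℚ} → (∀ i → 0ℚ ≤ f i) → 0ℚ ≤ sum f
  ∑-nonneg {zero}  _   = ≤-refl
  ∑-nonneg {suc m} 0≤f = 0≤+ (0≤f zero) (∑-nonneg (0≤f ∘ suc))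

  term≤∑ : ∀ {m} {f : Fin m → ℚ} → (∀ i → 0ℚ ≤ f i) → ∀ a → f a ≤ sum f
  term≤∑ {f = f} 0≤f a = ≤-trans (≤-reflexive (sym (∑-single a (f a)))) (∑-mono pointwise)
    where
    pointwise : ∀ x → single a (f a) x ≤ f x
    pointwise x with x ≟ a
    ... | yes refl = ≤-refl
    ... | no _     = 0≤f x

  -- The mean of a symmetric bilinear form over two independent uniform draws is a product of sums.
  -- With weights for `u` and charges for `c`, its sign depends on the charges alone, not on how the
  -- weights are spread.
  double-average : ∀ {m} w (u c : Fin (suc m) → ℚ) →
    uniform m * sum (λ i → uniform m * sum (λ j → w + (u i * c j + u j * c i))) ≡
    w + (1ℚ + 1ℚ) * (uniform m * uniform m) * (sum u * sum c)
  double-average {m} w u c = begin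
    U * sum (λ i → U * sum (λ j → w + (u i * c j + u j * c i)))
      ≡⟨ cong (U *_) (sum-cong-≗ (λ i → cong (U *_) (inner i))) ⟩
    U * sum (λ i → U * (L * w + (u i * C + S * c i)))
      ≡⟨ cong (U *_) (sym (*-distribˡ-sum U (λ i → L * w + (u i * C + S * c i)))) ⟩
    U * (U * sum (λ i → L * w + (u i * C + S * c i)))
      ≡⟨ cong (λ z → U * (U * z)) (trans (∑-distrib-+ (λ _ → L * w) (λ i → u i * C + S * c i))
           (cong₂ _+_ (∑-const (suc m) (L * w)) (trans (∑-distrib-+ (λ i → u i * C) (λ i → S * c i))
             (cong₂ _+_ (sym (*-distribʳ-sum C u)) (sym (*-distribˡ-sum S c)))))) ⟩
    U * (U * (L * (L * w) + (S * C + S * C)))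
      ≡⟨ solve 5 (λ U L w S C → U :* (U :* (L :* (L :* w) :+ (S :* C :+ S :* C)))
           := (U :* L) :* (U :* L) :* w :+ (con 1ℚ :+ con 1ℚ) :* (U :* U) :* (S :* C)) refl U L w S C ⟩
    U * L * (U * L) * w + (1ℚ + 1ℚ) * (U * U) * (S * C)
      ≡⟨ cong (λ z → z * z * w + (1ℚ + 1ℚ) * (U * U) * (S * C)) (uniform-ι m) ⟩
    1ℚ * 1ℚ * w + (1ℚ + 1ℚ) * (U * U) * (S * C)
      ≡⟨ cong (_+ (1ℚ + 1ℚ) * (U * U) * (S * C)) (*-identityˡ w) ⟩
    w + (1ℚ + 1ℚ) * (U * U) * (S * C) ∎
    where
    open ≡-Reasoning
    open ℚ-Solver
    U L S C : ℚ
    U = uniform m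
    L = ι (suc m)
    S = sum u
    C = sum c
    inner : ∀ i → sum (λ j → w + (u i * c j + u j * c i)) ≡ L * w + (u i * C + S * c i)
    inner i = trans (∑-distrib-+ (λ _ → w) (λ j → u i * c j + u j * c i))
      (cong₂ _+_ (∑-const (suc m) w) (trans (∑-distrib-+ (λ j → u i * c j) (λ j → u j * c i))
        (cong₂ _+_ (sym (*-distribˡ-sum (u i) c)) (sym (*-distribʳ-sum (c i) u)))))

  ∑-members≤∑ : ∀ {n} (M : Subset n) {f : Fin n → ℚ} → (∀ x → 0ℚ ≤ f x) →
    sum (λ i → f (proj₁ (lookup (members M) i))) ≤ sum f
  ∑-members≤∑ M {f} 0≤f = ≤-trans (≤-reflexive (as-list f (members M))) (list≤ M 0≤f)
    where
    sumₗ : ∀ {m} → (Fin m → ℚ) → List (Fin m) → ℚ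
    sumₗ f []       = 0ℚ
    sumₗ f (x ∷ xs) = f x + sumₗ f xs
    as-list : ∀ {m} {M : Subset m} (f : Fin m → ℚ) (xs : List (Member M)) →
      sum (λ i → f (proj₁ (lookup xs i))) ≡ sumₗ f (map proj₁ xs)
    as-list f []       = refl
    as-list f (x ∷ xs) = cong (f (proj₁ x) +_) (as-list f xs)
    shifted : ∀ {m} (f : Fin (suc m) → ℚ) xs → sumₗ f (map suc xs) ≡ sumₗ (f ∘ suc) xs
    shifted f []       = refl
    shifted f (x ∷ xs) = cong (f (suc x) +_) (shifted f xs)
    list≤ : ∀ {m} (M : Subset m) {f : Fin m → ℚ} → (∀ x → 0ℚ ≤ f x) → sumₗ f (map proj₁ (members M)) ≤ sum f
    list≤ []            0≤f = ≤-refl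
    list≤ (inside ∷ M)  {f} 0≤f rewrite map-proj₁-shift M (members M) {inside} | shifted f (map proj₁ (members M)) =
      +-monoʳ-≤ (f zero) (list≤ M (0≤f ∘ suc))
    list≤ (outside ∷ M) {f} 0≤f rewrite map-proj₁-shift M (members M) {outside} | shifted f (map proj₁ (members M)) =
      ≤-trans (list≤ M (0≤f ∘ suc)) (≤-by-gap (f zero) (0≤f zero) (+-comm (sum (f ∘ suc)) (f zero)))

  ∑-subset : ∀ {n} (p : Subset n) → sum (λ x → if does (x ∈? p) then 1ℚ else 0ℚ) ≡ ι ∣ p ∣
  ∑-subset []            = sym ι-0
  ∑-subset (inside ∷ p)  = trans (cong (1ℚ +_) (∑-subset p)) (sym (ι-suc ∣ p ∣))
  ∑-subset (outside ∷ p) = trans (+-identityˡ _) (∑-subset p)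

  x∉p-x : ∀ {n} (p : Subset n) x → x ∉ p ∖ x
  x∉p-x (inside ∷ p)  zero    ()
  x∉p-x (outside ∷ p) zero    ()
  x∉p-x (_ ∷ p)       (suc x) (there x∈) = x∉p-x p x x∈

  module _ {n : ℕ} (s : Scores n) where

    replay-other : ∀ {w l x} → x ≢ w → x ≢ l → replay s w l x ≡ s x
    replay-other {w} {l} {x} x≢w x≢l = trans (updateAt-minimal x l _ x≢l) (updateAt-minimal x w s x≢w)

    replay-winner : ∀ {w l} → w ≢ l → replay s w l w ≡ suc (s w)
    replay-winner {w} {l} w≢l = trans (updateAt-minimal w l _ w≢l) (updateAt-updates w s)

    replay-loser : ∀ {w l} → w ≢ l → replay s w l l ≡ s l ∸ 2
    replay-loser {w} {l} w≢l = trans (updateAt-updates l _) (cong (_∸ 2) (updateAt-minimal l w s (w≢l ∘ sym)))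

    replay-self : ∀ w → replay s w w w ≡ s w ∸ 1
    replay-self w = trans (updateAt-updates w _) (cong (_∸ 2) (updateAt-updates w s))

  -- Truncation can only raise the remaining exponent, so a loss at a score near 0 still multiplies
  -- the weight by no more than a full loss does.
  ½^-∸ : ∀ a b → ½ ^ (a ∸ b) * ½ ^ b ≤ ½ ^ a
  ½^-∸ a b = ≤-trans (≤-reflexive (sym (^-homo-* ½ (a ∸ b) b)))
    (^-anti (nonNegative⁻¹ ½) (≤ᵇ⇒≤ _) (ℕₚ.≤-trans (ℕₚ.m≤n+m∸n a b) (ℕₚ.≤-reflexive (ℕₚ.+-comm b (a ∸ b)))))

  -- The sum of the scores may stand still: a loser with one point pays only that one, and the
  -- winner gains it. Two further units for being stored are released when such a loser is
  -- discarded.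
  potential : ∀ {n} → Subset n → Scores n → ℕ
  potential M s = sumₙ (λ x → if does (x ∈? M) then s x ℕ.+ 2 else 0)

  module _ {n : ℕ} where

    potential-store : ∀ M (s : Scores n) i → potential (M ∪ ⁅ i ⁆) s ℕ.≤ potential M s ℕ.+ (s i ℕ.+ 2)
    potential-store M s i = ℕₚ.≤-trans (∑ₙ-mono pointwise) (ℕₚ.≤-reflexive
      (trans (∑ₙ-distrib-+ (λ x → if does (x ∈? M) then s x ℕ.+ 2 else 0) (singleₙ i (s i ℕ.+ 2)))
        (cong (potential M s ℕ.+_) (∑ₙ-single i (s i ℕ.+ 2)))))
      where
      pointwise : ∀ x → (if does (x ∈? (M ∪ ⁅ i ⁆)) then s x ℕ.+ 2 else 0) ℕ.≤
        (if does (x ∈? M) then s x ℕ.+ 2 else 0) ℕ.+ singleₙ i (s i ℕ.+ 2) x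
      pointwise x with x ∈? (M ∪ ⁅ i ⁆) | x ∈? M | x ≟ i
      ... | no _   | _       | _        = ℕ.z≤n
      ... | yes _  | yes _   | _        = ℕₚ.m≤m+n _ _
      ... | yes _  | no _    | yes refl = ℕₚ.≤-refl
      ... | yes x∈ | no x∉M | no x≢i with x∈p∪q⁻ M ⁅ i ⁆ x∈
      ...   | inj₁ x∈M = contradiction x∈M x∉M
      ...   | inj₂ x∈i = contradiction (x∈⁅y⁆⇒x≡y i x∈i) x≢i

    -- A duel moves one point to the winner and costs the loser two; a loser that leaves
    -- the memory with at most two points also gives back the two units of its presence.
    potential-replay : ∀ {M M′} (s : Scores n) {w l} → w ∈ M → l ∈ M → M′ ⊆ M →
      (l ∈ M′ → replay s w l l ≢ 0) → potential M′ (replay s w l) ℕ.+ 1 ℕ.≤ potential M s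
    potential-replay {M} {M′} s {w} {l} w∈M l∈M M′⊆M alive = ℕₚ.+-cancelʳ-≤ 1 _ _ (begin
      potential M′ s′ ℕ.+ 1 ℕ.+ 1  ≡⟨ ℕₚ.+-assoc (potential M′ s′) 1 1 ⟩
      -- With 2 added at `l` on the left and 1 at `w` on the right, the inequality holds coordinate
      -- by coordinate, also for `w ≡ l`.
      potential M′ s′ ℕ.+ 2  ≡⟨ cong (potential M′ s′ ℕ.+_) (sym (∑ₙ-single l 2)) ⟩
      potential M′ s′ ℕ.+ sumₙ (singleₙ l 2) ≡⟨ sym (∑ₙ-distrib-+ (λ x → if does (x ∈? M′) then s′ x ℕ.+ 2 else 0) (singleₙ l 2)) ⟩
      sumₙ (λ x → (if does (x ∈? M′) then s′ x ℕ.+ 2 else 0) ℕ.+ singleₙ l 2 x) ≤⟨ ∑ₙ-mono pointwise ⟩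
      sumₙ (λ x → (if does (x ∈? M) then s x ℕ.+ 2 else 0) ℕ.+ singleₙ w 1 x) ≡⟨ ∑ₙ-distrib-+ (λ x → if does (x ∈? M) then s x ℕ.+ 2 else 0) (singleₙ w 1) ⟩
      potential M s ℕ.+ sumₙ (singleₙ w 1) ≡⟨ cong (potential M s ℕ.+_) (∑ₙ-single w 1) ⟩
      potential M s ℕ.+ 1 ∎)
      where
      open ℕₚ.≤-Reasoning
      s′ : Scores n
      s′ = replay s w l
      -- A loser that stays has a nonzero score, so its subtraction was not truncated.
      regained : ∀ a b → a ∸ b ≢ 0 → a ∸ b ℕ.+ b ≡ a
      regained a b a∸b≢0 = ℕₚ.m∸n+n≡m (ℕₚ.<⇒≤ (ℕₚ.m∸n≢0⇒n<m {a} {b} a∸b≢0))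
      pointwise : ∀ x → (if does (x ∈? M′) then s′ x ℕ.+ 2 else 0) ℕ.+ singleₙ l 2 x ℕ.≤
                        (if does (x ∈? M) then s x ℕ.+ 2 else 0) ℕ.+ singleₙ w 1 x
      pointwise x with x ≟ l | x ≟ w
      pointwise x | no x≢l | no x≢w with x ∈? M′ | x ∈? M
      ... | no _     | _       = ℕ.z≤n
      ... | yes x∈M′ | no x∉M = contradiction (M′⊆M x∈M′) x∉M
      ... | yes _    | yes _   = ℕₚ.≤-reflexive (cong (λ z → z ℕ.+ 2 ℕ.+ 0) (replay-other s x≢w x≢l))
      pointwise x | no x≢l | yes refl with x ∈? M′ | x ∈? M
      ... | no _     | _       = ℕ.z≤n
      ... | yes _    | no x∉M = contradiction w∈M x∉M
      ... | yes _    | yes _   = ℕₚ.≤-reflexive (trans (cong (λ z → z ℕ.+ 2 ℕ.+ 0) (replay-winner s x≢l))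
        (solve 1 (λ a → con 1 :+ a :+ con 2 :+ con 0 := a :+ con 2 :+ con 1) refl (s x)))
        where open ℕ-Solver
      pointwise x | yes refl | no x≢w with x ∈? M′ | x ∈? M
      ... | _        | no x∉M = contradiction l∈M x∉M
      ... | no _     | yes _   = ℕₚ.≤-trans (ℕₚ.m≤n+m 2 (s x)) (ℕₚ.m≤m+n (s x ℕ.+ 2) 0)
      ... | yes x∈M′ | yes _   = ℕₚ.≤-reflexive (trans
        (cong (λ z → z ℕ.+ 2) (trans (cong (ℕ._+ 2) (replay-loser s (x≢w ∘ sym))) (regained (s x) 2
          (λ eq → alive x∈M′ (trans (replay-loser s (x≢w ∘ sym)) eq)))))
        (sym (ℕₚ.+-identityʳ (s x ℕ.+ 2))))
      pointwise x | yes refl | yes refl with x ∈? M′ | x ∈? M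
      ... | _        | no x∉M = contradiction l∈M x∉M
      ... | no _     | yes _   = ℕₚ.≤-trans (ℕₚ.m≤n+m 2 (s x)) (ℕₚ.m≤m+n (s x ℕ.+ 2) 1)
      ... | yes x∈M′ | yes _   = ℕₚ.≤-reflexive (trans
        (cong (λ z → z ℕ.+ 2 ℕ.+ 2) (replay-self s x))
        (trans (solve 1 (λ a → a :+ con 2 :+ con 2 := a :+ con 1 :+ con 3) refl (s x ∸ 1))
          (trans (cong (ℕ._+ 3) (regained (s x) 1 (λ eq → alive x∈M′ (trans (replay-self s x) eq))))
            (solve 1 (λ a → a :+ con 3 := a :+ con 2 :+ con 1) refl (s x)))))
        where open ℕ-Solver

-- The supermartingale and the success probability

module SuccessProbability where

  open import Data.Bool using (Bool; true; false; if_then_else_; T; not)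
  open import Data.Fin using (Fin; zero; suc; toℕ; fromℕ<)
  open import Data.Fin.Properties as Finₚ using (_≟_; any?; toℕ-fromℕ<; toℕ-injective; toℕ<n)
  open import Data.Fin.Subset using (Subset; _∈_; _∉_; _⊆_; _∪_; ⁅_⁆; ∣_∣; ⊥)
    renaming (_-_ to _∖_)
  open import Data.Fin.Subset.Properties
    using (_∈?_; ∉⊥; ∣⊥∣≡0; x∈p∪q⁻; x∈p∪q⁺; x∈⁅x⁆; x∈⁅y⁆⇒x≡y; p─q⊆p; x∈p∧x≢y⇒x∈p-y; p⊆q⇒∣p∣≤∣q∣)
  open import Data.List using ([]; _∷_; length; lookup)
  open import Data.Nat as ℕ using (ℕ; zero; suc; _∸_; _⊔_; _⊓_)
  open import Data.Product using (_×_; _,_; proj₁; proj₂)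
  open import Data.Rational hiding (_≟_; _<?_; _⊔_; _⊓_; ∣_∣)
  open import Data.Rational.Properties hiding (_≟_; _<?_)
  open import Data.Sum using (inj₁; inj₂)
  open import Data.Vec using ([]; _∷_)
  open import Function using (_∘_; id; const)
  open import Relation.Binary.PropositionalEquality
  open import Relation.Nullary using (Dec; yes; no; does; contradiction; ¬?)
  open import Relation.Nullary.Decidable using (dec-true; dec-false; _×-dec_)
  open import Algebra.Bundles using (CommutativeRing)
  open import Algebra.Properties.Semiring.Sum (CommutativeRing.semiring +-*-commutativeRing)
    using (sum; ∑-distrib-+; *-distribˡ-sum; *-distribʳ-sum)
  open RationalArithmetic
  open RealBounds
  open NoisyComparisons
  open Selection
  open TopAlgorithm
  open LargestElements
  open ScoreGame
  open ℚ-Solver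

  module _ {n : ℕ} {_≺_ : Rel (Fin n) 0ℓ} (order : IsStrictTotalOrder _≡_ _≺_) {k : ℕ} {γ : ℝ} (adversary : Adversary)
           {g : ℚ} (g≤γ : fromℚ g ≤ᵣ γ) (γ≤½ : γ ≤ᵣ ½ᵣ) (0≤g : 0ℚ ≤ g) (g≤½ : g ≤ ½)
           {top : Subset n} (isTop : IsLargest order k top) where

    open IsStrictTotalOrder order using (_<?_; irrefl; asym)
    open Failure order k γ adversary g g≤γ γ≤½
    open Voting 0≤g g≤½

    private
      ¼ 3ℚ : ℚ
      ¼  = ½ * ½
      3ℚ = 1ℚ + 1ℚ + 1ℚ

    -- A union bound along the truthful path: each of at most `D` votes leaves it with probability
    -- at most `ε`, and whatever follows a wrong vote is counted as failure, hence the excess 1 in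
    -- `fails-vote`.
    simulate-fails : ∀ {M A} {N ε} → drift ^ N ≤ ε → 0ℚ ≤ ε → ∀ (m : Comparing (Member M) A) {Q c D P} →
      Computes (_≼ₘ_ order M) (less order M) m Q c → c ℕ.≤ D → (∀ a → Q a → P a FailsAtMost 0ℚ) →
      simulate N D m P FailsAtMost ι D * ε
    simulate-fails error 0≤ε (done a) {D = D} q c≤D fails = fails-mono (0≤* (0≤ι D) 0≤ε) (fails a q)
    simulate-fails {M} {N = N} {ε} error 0≤ε (compare (x , x∈M) (y , y∈M) m) {Q} {suc c} {suc D} {P} q (ℕ.s≤s c≤D) fails
      with x ≟ y
    ... | yes refl = fails-mono (*-monoʳ-≤-nonNeg ε {{nonNegative 0≤ε}} (ι-mono (ℕₚ.n≤1+n D)))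
      (simulate-fails error 0≤ε (m false) {c = c}
        (subst (λ b → Computes (_≼ₘ_ order M) (less order M) (m b) Q c) (dec-false (x <? x) (irrefl refl)) q) c≤D fails)
    ... | no x≢y = fails-mono (≤-reflexive (trans (solve 2 (λ d e → d :* e :+ e :* con 1ℚ := (con 1ℚ :+ d) :* e) refl (ι D) ε)
        (cong (_* ε) (sym (ι-suc D)))))
      (fails-vote {φ = ι D * ε} {1ℚ} (nonNegative⁻¹ 1ℚ) N error (simulate-fails error 0≤ε (m _) {c = c} q c≤D fails)
        (fails-mono (≤-by-gap (ι D * ε) (0≤* (0≤ι D) 0≤ε) (+-comm 1ℚ (ι D * ε)))
          (fails-always 0≤g (simulate N D (m (not (does (x <? y)))) P))))

    largest-of-fails : ∀ {M N D ε} → drift ^ N ≤ ε → 0ℚ ≤ ε → top ⊆ M → 1 ℕ.≤ k → 200 ℕ.* (∣ M ∣ ∸ 1) ℕ.≤ D →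
      largest-of k N D (members M) FailsAtMost ι D * ε
    largest-of-fails {M} {N} {D} {ε} error 0≤ε top⊆M 1≤k enough = go (members M) refl
      where
      k≤∣M∣ : k ℕ.≤ length (members M)
      k≤∣M∣ = ℕₚ.≤-trans (ℕₚ.≤-reflexive (sym (proj₁ isTop)))
        (ℕₚ.≤-trans (p⊆q⇒∣p∣≤∣q∣ top⊆M) (ℕₚ.≤-reflexive (sym (length-members M))))
      go : ∀ xs → xs ≡ members M → largest-of k N D xs FailsAtMost ι D * ε
      go []       eq = contradiction (ℕₚ.≤-trans 1≤k (ℕₚ.≤-trans k≤∣M∣ (ℕₚ.≤-reflexive (cong length (sym eq))))) λ ()
      go (x ∷ xs) eq = simulate-fails error 0≤ε (select id (length (x ∷ xs)) (split [] x []) (k ∸ 1) (x ∷ xs))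
        (select-cost order M id (split [] x []) (k ∸ 1) (x ∷ xs) (ℕₚ.≤-trans
          (ℕₚ.≤-reflexive (ℕₚ.m+[n∸m]≡n 1≤k)) (ℕₚ.≤-trans k≤∣M∣ (ℕₚ.≤-reflexive (cong length (sym eq))))))
        (ℕₚ.≤-trans (ℕₚ.≤-reflexive (cong (λ z → 200 ℕ.* (z ∸ 1)) (trans (cong length eq) (length-members M)))) enough)
        λ s sel → let size , largest = selection-largest order M
                        (subst (λ ys → IsSelection (_≼ₘ_ order M) (less order M) id ys (k ∸ 1) s) eq sel)
                  in fails-output (largest-within order isTop top⊆M (trans size (ℕₚ.m+[n∸m]≡n 1≤k)) largest)

    τ : Fin n → ℚ
    τ x = if does (x ∈? top) then 1ℚ else 0ℚ

    weight : Scores n → Fin n → ℚ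
    weight s x = τ x * ½ ^ s x

    -- Bounds the probability that some element of `top` ever loses all of its points.
    Φ : Scores n → ℚ
    Φ s = sum (weight s)

    -- Bounds the mean relative change of the weight of a top element in a duel with x.  A loss
    -- multiplies the weight by 4 and a win by 1/2, so it is at most 4 - 1 in any case, and
    -- -1/2 + (1/16) (3 + 1/2) < -1/4 against a weaker opponent, with votes failing with probability 1/16.
    charge : Fin n → ℚ
    charge x = (3ℚ + ¼) * τ x - ¼

    private
      0≤½ : 0ℚ ≤ ½
      0≤½ = nonNegative⁻¹ ½

    0≤τ : ∀ x → 0ℚ ≤ τ x
    0≤τ x with x ∈? top
    ... | yes _ = nonNegative⁻¹ 1ℚ
    ... | no _  = ≤-refl

    0≤weight : ∀ s x → 0ℚ ≤ weight s x
    0≤weight s x = 0≤* (0≤τ x) (0≤^ (s x) 0≤½)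

    charge-top : ∀ {x} → x ∈ top → charge x ≡ 3ℚ
    charge-top {x} x∈ rewrite dec-true (x ∈? top) x∈ = refl

    charge-other : ∀ {x} → x ∉ top → charge x ≡ - ¼
    charge-other {x} x∉ rewrite dec-false (x ∈? top) x∉ = refl

    weight-other : ∀ s {x} → x ∉ top → weight s x ≡ 0ℚ
    weight-other s {x} x∉ rewrite dec-false (x ∈? top) x∉ = *-zeroˡ (½ ^ s x)

    weight-zero : ∀ {s x} → x ∈ top → s x ≡ 0 → weight s x ≡ 1ℚ
    weight-zero {s} {x} x∈ eq rewrite dec-true (x ∈? top) x∈ | eq = refl

    ∑τ : sum τ ≡ ι k
    ∑τ = trans (∑-subset top) (cong ι (proj₁ isTop))

    Φ-const : ∀ h → Φ (const h) ≡ ι k * ½ ^ h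
    Φ-const h = trans (sym (*-distribʳ-sum (½ ^ h) τ)) (cong (_* ½ ^ h) ∑τ)

    -- At most `k` members have charge 3 and all others have charge -1/4, so the sum is at most
    -- `13k/4 - ∣ M ∣ / 4`. This is where a memory proportional to `k` enters; 16 in place of 13 is
    -- slack.
    ∑-charge≤0 : ∀ M → 16 ℕ.* k ℕ.≤ ∣ M ∣ → sum (λ i → charge (proj₁ (lookup (members M) i))) ≤ 0ℚ
    ∑-charge≤0 M 16k≤ = begin
      sum (λ i → charge (x i))
        ≡⟨ trans (∑-distrib-+ (λ i → (3ℚ + ¼) * τ (x i)) (λ _ → - ¼))
             (cong₂ _+_ (sym (*-distribˡ-sum (3ℚ + ¼) (τ ∘ x))) (∑-const (length (members M)) (- ¼))) ⟩
      (3ℚ + ¼) * sum (τ ∘ x) + ι (length (members M)) * - ¼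
        ≤⟨ +-mono-≤ (*-monoˡ (3ℚ + ¼) (nonNegative⁻¹ (3ℚ + ¼)) (≤-trans (∑-members≤∑ M 0≤τ) (≤-reflexive ∑τ)))
             (≤-by-gap (¼ * (ι (length (members M)) - 16ℚ * ι k))
               (0≤* (nonNegative⁻¹ ¼) (p≤q⇒0≤q-p (≤-trans 16ι≤ (ι-mono (ℕₚ.≤-trans 16k≤ (ℕₚ.≤-reflexive (sym (length-members M))))))))
               (solve 2 (λ l c → l :* :- con ¼ :+ con ¼ :* (l :- c) := c :* :- con ¼) refl (ι (length (members M))) (16ℚ * ι k))) ⟩
      (3ℚ + ¼) * ι k + 16ℚ * ι k * - ¼
        ≤⟨ ≤-by-gap (3ℚ * ¼ * ι k) (0≤* (nonNegative⁻¹ (3ℚ * ¼)) (0≤ι k))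
             (solve 1 (λ x → con (3ℚ + ¼) :* x :+ con 16ℚ :* x :* :- con ¼ :+ con (3ℚ * ¼) :* x := con 0ℚ) refl (ι k)) ⟩
      0ℚ ∎
      where
      open ≤-Reasoning
      x : Fin (length (members M)) → Fin n
      x i = proj₁ (lookup (members M) i)
      16ℚ : ℚ
      16ℚ = 8ℚ + 8ℚ
      16ι≤ : 16ℚ * ι k ≤ ι (16 ℕ.* k)
      16ι≤ = ≤-reflexive (trans (cong (_* ι k) (sym (ι-def 16))) (sym (ι-* 16 k)))

    -- The winner's weight is halved and the loser's at most quadrupled, truncation working in the
    -- right direction. If both are the same element, its weight at most doubles, and `1 ≤ 3 - 1/2`.
    Φ-replay : ∀ s w l → Φ (replay s w l) ≤ Φ s + (3ℚ * weight s l - ½ * weight s w)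
    Φ-replay s w l = ≤-trans (∑-mono pointwise) (≤-reflexive
      (trans (∑-distrib-+ (weight s) (λ x → single l (3ℚ * weight s l) x + single w (- (½ * weight s w)) x))
        (cong (_+_ (Φ s)) (trans (∑-distrib-+ (single l (3ℚ * weight s l)) (single w (- (½ * weight s w))))
          (cong₂ _+_ (∑-single l _) (∑-single w _))))))
      where
      s′ : Scores n
      s′ = replay s w l
      pointwise : ∀ x → weight s′ x ≤ weight s x + (single l (3ℚ * weight s l) x + single w (- (½ * weight s w)) x)
      pointwise x with x ≟ l | x ≟ w
      ... | no x≢l | no x≢w = ≤-reflexive (trans (cong (λ z → τ x * ½ ^ z) (replay-other s x≢w x≢l))
        (sym (+-identityʳ (weight s x))))
      ... | no x≢l | yes refl = ≤-reflexive (trans (cong (λ z → τ x * ½ ^ z) (replay-winner s x≢l))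
        (solve 2 (λ t p → t :* (con ½ :* p) := t :* p :+ (con 0ℚ :+ :- (con ½ :* (t :* p)))) refl (τ x) (½ ^ s x)))
      ... | yes refl | no x≢w = ≤-trans (≤-reflexive (cong (λ z → τ x * ½ ^ z) (replay-loser s (x≢w ∘ sym))))
        (≤-by-gap ((3ℚ + 1ℚ) * (τ x * (½ ^ s x - ½ ^ (s x ∸ 2) * ½ ^ 2)))
          (0≤* (nonNegative⁻¹ (3ℚ + 1ℚ)) (0≤* (0≤τ x) (p≤q⇒0≤q-p (½^-∸ (s x) 2))))
          (solve 3 (λ t p q → t :* q :+ con (3ℚ + 1ℚ) :* (t :* (p :- q :* con (½ ^ 2))) := t :* p :+ (con 3ℚ :* (t :* p) :+ con 0ℚ))
            refl (τ x) (½ ^ s x) (½ ^ (s x ∸ 2))))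
      ... | yes refl | yes refl = ≤-trans (≤-reflexive (cong (λ z → τ x * ½ ^ z) (replay-self s x)))
        (≤-by-gap ((1ℚ + 1ℚ) * (τ x * (½ ^ s x - ½ ^ (s x ∸ 1) * ½ ^ 1)) + (1ℚ + ½) * weight s x)
          (0≤+ (0≤* (nonNegative⁻¹ (1ℚ + 1ℚ)) (0≤* (0≤τ x) (p≤q⇒0≤q-p (½^-∸ (s x) 1))))
               (0≤* (nonNegative⁻¹ (1ℚ + ½)) (0≤weight s x)))
          (solve 3 (λ t p q → t :* q :+ (con (1ℚ + 1ℚ) :* (t :* (p :- q :* con (½ ^ 1))) :+ con (1ℚ + ½) :* (t :* p))
              := t :* p :+ (con 3ℚ :* (t :* p) :+ :- (con ½ :* (t :* p))))
            refl (τ x) (½ ^ s x) (½ ^ (s x ∸ 1))))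

    module Duels {t R : ℕ} {η : ℚ} {fallback : ∀ {M} → Program n t M} {rest : ∀ M → Scores n → Program n t M}
                 (error : drift ^ R ≤ ½ ^ 4) {M : Subset n} {s : Scores n}
                 (settles : ∀ w l → w ∈ M → l ∈ M →
                   settle rest M s w l FailsAtMost Φ (replay s w l) + η) where

      private
        -- `outcome` bounds the failure after a known result, `target` before the vote. The latter
        -- is symmetric and bilinear in weights and charges, the form that `double-average` handles.
        outcome target : Fin n → Fin n → ℚ
        outcome w l = Φ s + (3ℚ * weight s l - ½ * weight s w) + η
        target  w l = Φ s + η + (weight s w * charge l + weight s l * charge w)

        settles-outcome : ∀ {w l} → w ∈ M → l ∈ M → settle rest M s w l FailsAtMost outcome w l
        settles-outcome {w} {l} w∈ l∈ = fails-mono (+-monoˡ-≤ η (Φ-replay s w l)) (settles w l w∈ l∈)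

        -- What `fails-vote` asks for: a bound for the right result and a nonnegative excess for the
        -- wrong one. Between two top elements or two others, either result meets `target` and `Δ`
        -- is 0; only a top element against a weaker one relies on the vote.
        record Odds (w l : Fin n) : Set where
          field
            φ Δ     : ℚ
            0≤Δ     : 0ℚ ≤ Δ
            right   : outcome w l ≤ φ
            wrong   : outcome l w ≤ φ + Δ
            average : φ + ½ ^ 4 * Δ ≤ target w l

        odds : ∀ {w l} → l ≺ w → Odds w l
        odds {w} {l} l≺w with w ∈? top | l ∈? top
        ... | yes w∈ | yes l∈ = record
          { φ = target w l ; Δ = 0ℚ ; 0≤Δ = ≤-refl
          ; right = transport bound (charge-top w∈) (charge-top l∈) (≤-by-gap (3ℚ * W + ½ * W)
              (0≤+ (0≤* (nonNegative⁻¹ 3ℚ) (0≤weight s w)) (0≤* 0≤½ (0≤weight s w)))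
              (solve 4 (λ p e w l → p :+ (con 3ℚ :* l :- con ½ :* w) :+ e :+ (con 3ℚ :* w :+ con ½ :* w)
                := p :+ e :+ (w :* con 3ℚ :+ l :* con 3ℚ)) refl (Φ s) η W L))
          ; wrong = transport bound′ (charge-top w∈) (charge-top l∈) (≤-by-gap (3ℚ * L + ½ * L)
              (0≤+ (0≤* (nonNegative⁻¹ 3ℚ) (0≤weight s l)) (0≤* 0≤½ (0≤weight s l)))
              (solve 4 (λ p e w l → p :+ (con 3ℚ :* w :- con ½ :* l) :+ e :+ (con 3ℚ :* l :+ con ½ :* l)
                := p :+ e :+ (w :* con 3ℚ :+ l :* con 3ℚ) :+ con 0ℚ) refl (Φ s) η W L))
          ; average = ≤-reflexive (solve 1 (λ t → t :+ con (½ ^ 4) :* con 0ℚ := t) refl (target w l))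
          }
          where
          W L : ℚ
          W = weight s w
          L = weight s l
          bound bound′ : ℚ → ℚ → Set
          bound  a b = outcome w l ≤ Φ s + η + (weight s w * b + weight s l * a)
          bound′ a b = outcome l w ≤ Φ s + η + (weight s w * b + weight s l * a) + 0ℚ
          transport : ∀ (P : ℚ → ℚ → Set) {a a′ b b′} → a ≡ a′ → b ≡ b′ → P a′ b′ → P a b
          transport P refl refl p = p
        ... | yes w∈ | no l∉ = record
          { φ = Φ s + (0ℚ - ½ * W) + η ; Δ = 3ℚ * W + ½ * W
          ; 0≤Δ = 0≤+ (0≤* (nonNegative⁻¹ 3ℚ) (0≤weight s w)) (0≤* 0≤½ (0≤weight s w))
          ; right = ≤-reflexive (cong (λ z → Φ s + (3ℚ * z - ½ * W) + η) (weight-other s l∉))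
          ; wrong = ≤-reflexive (trans (cong (λ z → Φ s + (3ℚ * W - ½ * z) + η) (weight-other s l∉))
              (solve 3 (λ p e w → p :+ (con 3ℚ :* w :- con ½ :* con 0ℚ) :+ e :=
                p :+ (con 0ℚ :- con ½ :* w) :+ e :+ (con 3ℚ :* w :+ con ½ :* w)) refl (Φ s) η W))
          -- The gap is exact: `-1/2 + (3 + 1/2)/16 + 1/32 = -1/4`.
          ; average = ≤-trans (≤-by-gap (½ ^ 5 * W) (0≤* (nonNegative⁻¹ (½ ^ 5)) (0≤weight s w))
              (solve 4 (λ p e w c → p :+ (con 0ℚ :- con ½ :* w) :+ e :+ con (½ ^ 4) :* (con 3ℚ :* w :+ con ½ :* w) :+ con (½ ^ 5) :* w
                := p :+ e :+ (w :* :- con ¼ :+ con 0ℚ :* c)) refl (Φ s) η W (charge w)))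
              (≤-reflexive (sym (cong₂ (λ a b → Φ s + η + (W * a + b * charge w)) (charge-other l∉) (weight-other s l∉))))
          }
          where
          W : ℚ
          W = weight s w
        ... | no w∉ | yes l∈ = contradiction l≺w (asym (proj₂ isTop l l∈ w w∉))
        ... | no w∉ | no l∉ = record
          { φ = target w l ; Δ = 0ℚ ; 0≤Δ = ≤-refl
          ; right = ≤-reflexive (trans (cong₂ (λ a b → Φ s + (3ℚ * a - ½ * b) + η) (weight-other s l∉) (weight-other s w∉))
              (trans (solve 4 (λ p e c d → p :+ (con 3ℚ :* con 0ℚ :- con ½ :* con 0ℚ) :+ e :=
                p :+ e :+ (con 0ℚ :* c :+ con 0ℚ :* d)) refl (Φ s) η (charge l) (charge w))
              (sym target≡)))
          ; wrong = ≤-reflexive (trans (cong₂ (λ a b → Φ s + (3ℚ * a - ½ * b) + η) (weight-other s w∉) (weight-other s l∉))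
              (trans (solve 4 (λ p e c d → p :+ (con 3ℚ :* con 0ℚ :- con ½ :* con 0ℚ) :+ e :=
                p :+ e :+ (con 0ℚ :* c :+ con 0ℚ :* d) :+ con 0ℚ) refl (Φ s) η (charge l) (charge w))
              (cong (_+ 0ℚ) (sym target≡))))
          ; average = ≤-reflexive (solve 1 (λ t → t :+ con (½ ^ 4) :* con 0ℚ := t) refl (target w l))
          }
          where
          target≡ : target w l ≡ Φ s + η + (0ℚ * charge l + 0ℚ * charge w)
          target≡ = cong₂ (λ a b → Φ s + η + (a * charge l + b * charge w)) (weight-other s w∉) (weight-other s l∉)

        target-comm : ∀ a b → target b a ≡ target a b
        target-comm a b = cong (_+_ (Φ s + η)) (+-comm (weight s b * charge a) (weight s a * charge b))

        fails-self : ∀ a → outcome a a ≤ target a a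
        fails-self a = by-membership (a ∈? top)
          where
          W : ℚ
          W = weight s a
          by-membership : Dec (a ∈ top) → outcome a a ≤ target a a
          by-membership (yes a∈) = ≤-trans (≤-by-gap (3ℚ * W + ½ * W)
            (0≤+ (0≤* (nonNegative⁻¹ 3ℚ) (0≤weight s a)) (0≤* 0≤½ (0≤weight s a)))
            (solve 3 (λ p e w → p :+ (con 3ℚ :* w :- con ½ :* w) :+ e :+ (con 3ℚ :* w :+ con ½ :* w)
                := p :+ e :+ (w :* con 3ℚ :+ w :* con 3ℚ)) refl (Φ s) η W))
            (≤-reflexive (cong (λ c → Φ s + η + (W * c + W * c)) (sym (charge-top a∈))))
          by-membership (no a∉) = ≤-reflexive (trans (cong (λ z → Φ s + (3ℚ * z - ½ * z) + η) (weight-other s a∉))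
            (trans (solve 3 (λ p e c → p :+ (con 3ℚ :* con 0ℚ :- con ½ :* con 0ℚ) :+ e :=
                p :+ e :+ (con 0ℚ :* c :+ con 0ℚ :* c)) refl (Φ s) η (charge a))
              (cong (λ z → Φ s + η + (z * charge a + z * charge a)) (sym (weight-other s a∉)))))

      duel-fails : ∀ a b → duel R fallback rest s a b FailsAtMost
        Φ s + η + (weight s (proj₁ a) * charge (proj₁ b) + weight s (proj₁ b) * charge (proj₁ a))
      duel-fails (a , a∈M) (b , b∈M) with a ≟ b
      ... | yes refl = fails-mono (fails-self a) (settles-outcome a∈M b∈M)
      ... | no a≢b = by-answer (does (a <? b)) refl
        where
        P : Bool → Program n t M
        P c = if c then settle rest M s b a else settle rest M s a b
        by-answer : ∀ c → does (a <? b) ≡ c → vote a b a≢b (inj₁ a∈M) (inj₁ b∈M) R 0 0 P FailsAtMost target a b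
        by-answer true eq = fails-mono (≤-trans average (≤-reflexive (target-comm a b)))
          (fails-vote {P = P} {φ} {Δ} 0≤Δ R error
            (subst (λ c → P c FailsAtMost φ) (sym eq) (fails-mono right (settles-outcome b∈M a∈M)))
            (subst (λ c → P (not c) FailsAtMost φ + Δ) (sym eq) (fails-mono wrong (settles-outcome a∈M b∈M))))
          where
          a≺b : a ≺ b
          a≺b with a <? b
          ... | yes p = p
          open Odds (odds a≺b)
        by-answer false eq = fails-mono average
          (fails-vote {P = P} {φ} {Δ} 0≤Δ R error
            (subst (λ c → P c FailsAtMost φ) (sym eq) (fails-mono right (settles-outcome a∈M b∈M)))
            (subst (λ c → P (not c) FailsAtMost φ + Δ) (sym eq) (fails-mono wrong (settles-outcome b∈M a∈M))))
          where
          b≺a : b ≺ a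
          b≺a with a <? b
          ... | no a⊀b = ≼∧≢⇒≺ order a⊀b (a≢b ∘ sym)
          open Odds (odds b≺a)

      random-duel-fails : ∀ {x xs} → x ∷ xs ≡ members M → 16 ℕ.* k ℕ.≤ ∣ M ∣ →
        random-duel R fallback rest s (x ∷ xs) FailsAtMost Φ s + η
      random-duel-fails {x} {xs} eq 16k≤ = fails-mono (≤-trans
          (≤-reflexive (double-average (Φ s + η) (weight s ∘ elem) (charge ∘ elem)))
          (≤-trans (+-monoʳ-≤ (Φ s + η) nonpositive) (≤-reflexive (+-identityʳ (Φ s + η)))))
        (fails-random λ i → fails-random λ j → duel-fails (lookup (x ∷ xs) i) (lookup (x ∷ xs) j))
        where
        elem : Fin (suc (length xs)) → Fin n
        elem i = proj₁ (lookup (x ∷ xs) i)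
        U C F : ℚ
        U = sum (weight s ∘ elem)
        C = sum (charge ∘ elem)
        F = (1ℚ + 1ℚ) * (uniform (length xs) * uniform (length xs))
        C≤0 : C ≤ 0ℚ
        C≤0 = subst (λ ys → sum (λ i → charge (proj₁ (lookup ys i))) ≤ 0ℚ) (sym eq) (∑-charge≤0 M 16k≤)
        nonpositive : F * (U * C) ≤ 0ℚ
        nonpositive = ≤-by-gap (F * (U * (0ℚ - C)))
          (0≤* (0≤* (nonNegative⁻¹ (1ℚ + 1ℚ)) (0≤* (0≤uniform (length xs)) (0≤uniform (length xs))))
            (0≤* (∑-nonneg (0≤weight s ∘ elem)) (p≤q⇒0≤q-p C≤0)))
          (solve 3 (λ f u c → f :* (u :* c) :+ f :* (u :* (con 0ℚ :- c)) := con 0ℚ) refl F U C)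

    module Streaming (width h : ℕ) where

      -- By `kept`, a top element that is lost has weight 1 from then on, so the loss is already
      -- paid for in `Φ`; by `fresh`, elements still to come count in `Φ` with their initial score.
      -- `fueled` says that the fuel covers the present potential and that of the `c` elements still
      -- to be stored. It is conditional because for `width` 1 the fuel is 0; a full memory forces a
      -- larger `width`.
      record Valid (t c f : ℕ) (M : Subset n) (s : Scores n) : Set where
        field
          kept     : ∀ {x} → x ∈ top → toℕ x ℕ.< t → x ∉ M → s x ≡ 0
          arrived  : ∀ {x} → x ∈ M → toℕ x ℕ.< t
          fresh    : ∀ {x} → t ℕ.≤ toℕ x → s x ≡ h
          capacity : ∣ M ∣ ℕ.+ c ℕ.≤ width
          fueled   : 2 ℕ.≤ width → potential M s ℕ.+ (h ℕ.+ 2) ℕ.* c ℕ.≤ f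

      open Valid

      valid-replay : ∀ {t c f M M′ s w l} → Valid t c (suc f) M s → w ∈ M → l ∈ M → M′ ⊆ M →
        (∀ {x} → x ∈ M → x ∉ M′ → x ≡ l × replay s w l l ≡ 0) → (l ∈ M′ → replay s w l l ≢ 0) →
        Valid t c f M′ (replay s w l)
      valid-replay {t} {c} {f} {M} {M′} {s} {w} {l} valid w∈M l∈M M′⊆M removed alive = record
        { kept     = kept′
        ; arrived  = arrived valid ∘ M′⊆M
        ; fresh    = λ t≤x → trans (replay-other s (late t≤x w∈M) (late t≤x l∈M)) (fresh valid t≤x)
        ; capacity = ℕₚ.≤-trans (ℕₚ.+-monoˡ-≤ c (p⊆q⇒∣p∣≤∣q∣ M′⊆M)) (capacity valid)
        ; fueled   = λ 2≤ → ℕₚ.≤-pred (ℕₚ.≤-trans (ℕₚ.≤-trans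
            (ℕₚ.≤-reflexive (cong (ℕ._+ (h ℕ.+ 2) ℕ.* c) (ℕₚ.+-comm 1 (potential M′ (replay s w l)))))
            (ℕₚ.+-monoˡ-≤ ((h ℕ.+ 2) ℕ.* c) (potential-replay s w∈M l∈M M′⊆M alive))) (fueled valid 2≤))
        }
        where
        late : ∀ {x y} → t ℕ.≤ toℕ x → y ∈ M → x ≢ y
        late t≤x y∈M refl = ℕₚ.<⇒≱ (arrived valid y∈M) t≤x
        kept′ : ∀ {x} → x ∈ top → toℕ x ℕ.< t → x ∉ M′ → replay s w l x ≡ 0
        kept′ {x} x∈top x<t x∉M′ with x ∈? M
        ... | no x∉M = trans (replay-other s (λ { refl → x∉M w∈M }) (λ { refl → x∉M l∈M })) (kept valid x∈top x<t x∉M)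
        ... | yes x∈M with removed x∈M x∉M′
        ...   | refl , eq = eq

      module _ {t c R : ℕ} {η : ℚ} (1≤k : 1 ℕ.≤ k) (error : drift ^ R ≤ ½ ^ 4)
               (fallback : ∀ {M} → Program n t M) {rest : ℕ → ∀ M → Scores n → Program n t M}
               (rest-fails : ∀ f M s → Valid t c f M s → ∣ M ∣ ℕ.< 16 ℕ.* k → rest f M s FailsAtMost Φ s + η) where

        shrink-fails : ∀ f M s → Valid t c f M s → shrink k R fallback rest f M s FailsAtMost Φ s + η
        shrink-fails zero M s valid with ∣ M ∣ ℕ.<ᵇ 16 ℕ.* k in eq
        ... | true  = rest-fails zero M s valid (ℕₚ.<ᵇ⇒< _ _ (subst T (sym eq) _))
        ... | false = contradiction (ℕₚ.≤-trans (ℕₚ.m+n≤o⇒m≤o (potential M s) (fueled valid 2≤width)) ℕ.z≤n)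
                        (ℕₚ.<⇒≱ positive-potential)
          where
          16≤∣M∣ : 16 ℕ.≤ ∣ M ∣
          16≤∣M∣ = ℕₚ.≤-trans (ℕₚ.*-monoʳ-≤ 16 1≤k) (ℕₚ.≮⇒≥ λ lt → subst T eq (ℕₚ.<⇒<ᵇ lt))
          2≤width : 2 ℕ.≤ width
          2≤width = ℕₚ.≤-trans (ℕₚ.≤-trans (ℕ.s≤s (ℕ.s≤s ℕ.z≤n)) 16≤∣M∣) (ℕₚ.m+n≤o⇒m≤o ∣ M ∣ (capacity valid))
          positive-potential : 1 ℕ.≤ potential M s
          positive-potential with members M in eq′
          ... | [] = contradiction (ℕₚ.≤-trans 16≤∣M∣ (ℕₚ.≤-reflexive (trans (sym (length-members M)) (cong length eq′)))) λ ()
          -- A fictitious duel of `x` with itself that empties the memory lowers the potential by at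
          -- least 1, so the potential was positive and the fuel cannot have run out.
          ... | (x , x∈M) ∷ _ = ℕₚ.m+n≤o⇒n≤o (potential ⊥ (replay s x x))
            (potential-replay {M′ = ⊥} s x∈M x∈M (λ x∈⊥ → contradiction x∈⊥ ∉⊥) (λ x∈⊥ → contradiction x∈⊥ ∉⊥))
        shrink-fails (suc f) M s valid with ∣ M ∣ ℕ.<ᵇ 16 ℕ.* k in eq
        ... | true  = rest-fails (suc f) M s valid (ℕₚ.<ᵇ⇒< _ _ (subst T (sym eq) _))
        ... | false = go (members M) refl
          where
          16k≤∣M∣ : 16 ℕ.* k ℕ.≤ ∣ M ∣
          16k≤∣M∣ = ℕₚ.≮⇒≥ λ lt → subst T eq (ℕₚ.<⇒<ᵇ lt)
          continue : ∀ M → Scores n → Program n t M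
          continue = shrink k R fallback rest f
          settles : ∀ w l → w ∈ M → l ∈ M → settle continue M s w l FailsAtMost Φ (replay s w l) + η
          settles w l w∈M l∈M with replay s w l l ℕ.≡ᵇ 0 in eq₀
          ... | true  = failsAtMost (success≥ (shrink-fails f (M ∖ l) (replay s w l)
            (valid-replay valid w∈M l∈M (p─q⊆p M ⁅ l ⁆) removed (λ l∈ → contradiction l∈ (x∉p-x M l)))))
            where
            removed : ∀ {x} → x ∈ M → x ∉ M ∖ l → x ≡ l × replay s w l l ≡ 0
            removed {x} x∈M x∉ with x ≟ l
            ... | yes x≡l = x≡l , ℕₚ.≡ᵇ⇒≡ _ _ (subst T (sym eq₀) _)
            ... | no x≢l  = contradiction (x∈p∧x≢y⇒x∈p-y x∈M x≢l) x∉
          ... | false = shrink-fails f M (replay s w l) (valid-replay valid w∈M l∈M id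
            (λ x∈M x∉M → contradiction x∈M x∉M) (λ _ eq₁ → subst T eq₀ (ℕₚ.≡⇒≡ᵇ _ _ eq₁)))
          go : ∀ xs → xs ≡ members M → random-duel R fallback continue s xs FailsAtMost Φ s + η
          go []       eq′ = contradiction (ℕₚ.≤-trans (ℕₚ.≤-trans (ℕₚ.*-monoʳ-≤ 16 1≤k) 16k≤∣M∣)
            (ℕₚ.≤-reflexive (trans (sym (length-members M)) (cong length (sym eq′))))) λ ()
          go (x ∷ xs) eq′ = Duels.random-duel-fails {η = η} {fallback} {continue} error settles eq′ 16k≤∣M∣

      module _ {R N start : ℕ} {ε : ℚ} (1≤k : 1 ℕ.≤ k) (error : drift ^ R ≤ ½ ^ 4)
               (error′ : drift ^ N ≤ ε) (0≤ε : 0ℚ ≤ ε)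
               (window : ∀ {x} → x ∈ top → start ℕ.≤ toℕ x × toℕ x ℕ.< start ℕ.+ width) where

        private
          D : ℕ
          D = 200 ℕ.* ((width ∸ 1) ⊓ (16 ℕ.* k))
          η : ℚ
          η = ι D * ε
          0≤η : 0ℚ ≤ η
          0≤η = 0≤* (0≤ι D) 0≤ε

        -- The second hypothesis on `c` says that the quota reaches to the end of the block: before
        -- `start` it is untouched, from then on it falls by one per arrival.
        stream-fails : ∀ r {t} (eq : r ℕ.+ t ≡ n) c f M s → Valid t c f M s →
          start ℕ.+ width ℕ.≤ (start ⊔ t) ℕ.+ c → ∣ M ∣ ℕ.≤ 16 ℕ.* k →
          stream k R N D start r eq c f M s FailsAtMost Φ s + η
        stream-fails zero refl c f M s valid quota small with any? (λ x → (x ∈? top) ×-dec ¬? (x ∈? M))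
        -- The weight of the lost `x` is 1, hence `Φ s ≥ 1` and the trivial bound suffices.
        ... | yes (x , x∈top , x∉M) = fails-mono (≤-trans
            (≤-trans (≤-reflexive (sym (weight-zero {s} x∈top (kept valid x∈top (toℕ<n x) x∉M))))
              (term≤∑ {f = weight s} (0≤weight s) x)) (≤-by-gap η 0≤η refl))
          (fails-always 0≤g (largest-of k N D (members M)))
        ... | no ¬∃ = fails-mono (≤-by-gap (Φ s) (∑-nonneg {f = weight s} (0≤weight s)) (+-comm η (Φ s)))
          (largest-of-fails error′ 0≤ε top⊆M 1≤k (ℕₚ.*-monoʳ-≤ 200 (ℕₚ.⊓-glb
            (ℕₚ.∸-monoˡ-≤ 1 (ℕₚ.m+n≤o⇒m≤o ∣ M ∣ (capacity valid))) (ℕₚ.≤-trans (ℕₚ.m∸n≤m ∣ M ∣ 1) small))))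
          where
          top⊆M : top ⊆ M
          top⊆M {x} x∈top with x ∈? M
          ... | yes x∈M = x∈M
          ... | no x∉M  = contradiction (x , x∈top , x∉M) ¬∃
        stream-fails (suc r) {t} eq zero f M s valid quota small = failsAtMost (success≥
          (stream-fails r _ zero f M s (record
            { kept     = kept′
            ; arrived  = ℕₚ.m<n⇒m<1+n ∘ arrived valid
            ; fresh    = fresh valid ∘ ℕₚ.<⇒≤
            ; capacity = capacity valid
            ; fueled   = fueled valid
            }) (ℕₚ.≤-trans quota (ℕₚ.+-monoˡ-≤ 0 (ℕₚ.⊔-monoʳ-≤ start (ℕₚ.n≤1+n t)))) small))
          where
          kept′ : ∀ {x} → x ∈ top → toℕ x ℕ.< suc t → x ∉ M → s x ≡ 0
          kept′ {x} x∈top x≤t x∉M with ℕₚ.m<1+n⇒m<n∨m≡n x≤t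
          ... | inj₁ x<t = kept valid x∈top x<t x∉M
          -- With the quota spent and `start ≤ t`, the position `t` is past the end of the block,
          -- where no top element arrives.
          ... | inj₂ x≡t = contradiction
            (subst (start ℕ.+ width ℕ.≤_) (trans (ℕₚ.+-identityʳ (start ⊔ t)) (trans (ℕₚ.m≤n⇒m⊔n≡n
                (subst (start ℕ.≤_) x≡t (proj₁ (window x∈top)))) (sym x≡t))) quota)
            (ℕₚ.<⇒≱ (proj₂ (window x∈top)))
        stream-fails (suc r) {t} eq (suc c) f M s valid quota small with start ℕ.≤ᵇ t in eq′
        ... | true = failsAtMost (success≥ (shrink-fails 1≤k error (give-up r _)
            (λ f M s valid′ small′ → stream-fails r _ c f M s valid′
              (ℕₚ.≤-trans quota (ℕₚ.≤-reflexive (trans (cong (ℕ._+ suc c) (ℕₚ.m≤n⇒m⊔n≡n start≤t))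
                (trans (ℕₚ.+-suc t c) (cong (ℕ._+ c) (sym (ℕₚ.m≤n⇒m⊔n≡n (ℕₚ.m≤n⇒m≤1+n start≤t))))))))
              (ℕₚ.<⇒≤ small′))
            f (M ∪ ⁅ i ⁆) s (record
              { kept     = λ {x} x∈top x≤t x∉ → kept valid x∈top (before x≤t (x∉ ∘ x∈p∪q⁺ ∘ inj₂ ∘ λ { refl → x∈⁅x⁆ i })) (x∉ ∘ x∈p∪q⁺ ∘ inj₁)
              ; arrived  = arrived′
              ; fresh    = fresh valid ∘ ℕₚ.<⇒≤
              ; capacity = ℕₚ.≤-trans (ℕₚ.+-monoˡ-≤ c (∣p∪⁅x⁆∣≤1+∣p∣ M i))
                  (ℕₚ.≤-trans (ℕₚ.≤-reflexive (sym (ℕₚ.+-suc ∣ M ∣ c))) (capacity valid))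
              ; fueled   = λ 2≤ → ℕₚ.≤-trans (ℕₚ.+-monoˡ-≤ ((h ℕ.+ 2) ℕ.* c) (potential-store M s i))
                  (ℕₚ.≤-trans (ℕₚ.≤-reflexive (trans (cong (λ z → potential M s ℕ.+ (z ℕ.+ 2) ℕ.+ (h ℕ.+ 2) ℕ.* c)
                      (fresh valid (ℕₚ.≤-reflexive (sym toℕ-i))))
                    (ℕS.solve 3 (λ p h c → p ℕS.:+ (h ℕS.:+ ℕS.con 2) ℕS.:+ (h ℕS.:+ ℕS.con 2) ℕS.:* c
                       ℕS.:= p ℕS.:+ (h ℕS.:+ ℕS.con 2) ℕS.:* (ℕS.con 1 ℕS.:+ c)) refl (potential M s) h c))) (fueled valid 2≤))
              })))
          where
          module ℕS = ℕ-Solver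
          start≤t : start ℕ.≤ t
          start≤t = ℕₚ.≤ᵇ⇒≤ start t (subst T (sym eq′) _)
          t<n : t ℕ.< n
          t<n = subst (suc t ℕ.≤_) eq (ℕ.s≤s (ℕₚ.m≤n+m t r))
          i : Fin n
          i = fromℕ< t<n
          toℕ-i : toℕ i ≡ t
          toℕ-i = toℕ-fromℕ< t<n
          before : ∀ {x} → toℕ x ℕ.< suc t → x ≢ i → toℕ x ℕ.< t
          before x≤t x≢i = ℕₚ.≤∧≢⇒< (ℕₚ.≤-pred x≤t) λ x≡t → x≢i (toℕ-injective (trans x≡t (sym toℕ-i)))
          arrived′ : ∀ {x} → x ∈ M ∪ ⁅ i ⁆ → toℕ x ℕ.< suc t
          arrived′ x∈ with x∈p∪q⁻ M ⁅ i ⁆ x∈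
          ... | inj₁ x∈M = ℕₚ.m<n⇒m<1+n (arrived valid x∈M)
          ... | inj₂ x∈i = ℕ.s≤s (ℕₚ.≤-reflexive (trans (cong toℕ (x∈⁅y⁆⇒x≡y i x∈i)) toℕ-i))
        ... | false = failsAtMost (success≥ (stream-fails r _ (suc c) f M s (record
            { kept     = kept′
            ; arrived  = ℕₚ.m<n⇒m<1+n ∘ arrived valid
            ; fresh    = fresh valid ∘ ℕₚ.<⇒≤
            ; capacity = capacity valid
            ; fueled   = fueled valid
            }) (ℕₚ.≤-trans quota (ℕₚ.+-monoˡ-≤ (suc c) (ℕₚ.⊔-monoʳ-≤ start (ℕₚ.n≤1+n t)))) small))
          where
          kept′ : ∀ {x} → x ∈ top → toℕ x ℕ.< suc t → x ∉ M → s x ≡ 0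
          kept′ {x} x∈top x≤t x∉M with ℕₚ.m<1+n⇒m<n∨m≡n x≤t
          ... | inj₁ x<t = kept valid x∈top x<t x∉M
          ... | inj₂ x≡t = contradiction (subst T eq′ (ℕₚ.≤⇒≤ᵇ (subst (start ℕ.≤_) x≡t (proj₁ (window x∈top))))) λ ()

      -- All offsets but `o` are written off. For `o`, losing a top element contributes `k * ½ ^ h`
      -- and the final selection `200 * 16 * k * ½ ^ h`; the total factor 3201 is rounded up to
      -- 4096, a power of two that `h` can cancel.
      algorithm-fails : ∀ {G B} (o : Fin (suc B)) → 1 ℕ.≤ k → 1 ℕ.≤ G → g * ι G ≡ 1ℚ →
        (∀ {x} → x ∈ top → toℕ o ℕ.* width ℕ.≤ toℕ x × toℕ x ℕ.< toℕ o ℕ.* width ℕ.+ width) →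
        algorithm n k G h (suc B) width FailsAtMost 1ℚ - uniform B * (1ℚ - ι (4096 ℕ.* k) * ½ ^ h)
      algorithm-fails {G} {B} o 1≤k 1≤G gG window = fails-mono (≤-reflexive total) (fails-random {φ = φ} fails)
        where
        q : ℚ
        q = ι (4096 ℕ.* k) * ½ ^ h
        D : ℕ
        D = 200 ℕ.* ((width ∸ 1) ⊓ (16 ℕ.* k))
        run : Fin (suc B) → Program n 0 ⊥
        run x = stream k (G ℕ.* G ℕ.* 4) (G ℕ.* G ℕ.* h) D (toℕ x ℕ.* width)
          n (ℕₚ.+-identityʳ n) width (2 ℕ.* (h ℕ.+ 2) ℕ.* (width ∸ 1)) ⊥ (const h)
        φ : Fin (suc B) → ℚ
        φ x = 1ℚ + single o (q - 1ℚ) x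
        D+k≤ : D ℕ.+ k ℕ.≤ 4096 ℕ.* k
        D+k≤ = begin
          D ℕ.+ k  ≤⟨ ℕₚ.+-monoˡ-≤ k (ℕₚ.*-monoʳ-≤ 200 (ℕₚ.m⊓n≤n (width ∸ 1) (16 ℕ.* k))) ⟩
          200 ℕ.* (16 ℕ.* k) ℕ.+ k  ≤⟨ ℕₚ.m≤m+n _ (895 ℕ.* k) ⟩
          200 ℕ.* (16 ℕ.* k) ℕ.+ k ℕ.+ 895 ℕ.* k ≡⟨ ℕS.solve 1 (λ k → ℕS.con 200 ℕS.:* (ℕS.con 16 ℕS.:* k) ℕS.:+ k ℕS.:+ ℕS.con 895 ℕS.:* k ℕS.:= ℕS.con 4096 ℕS.:* k) refl k ⟩
          4096 ℕ.* k ∎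
          where
          open ℕₚ.≤-Reasoning
          module ℕS = ℕ-Solver
        Φ+η≤q : Φ (const h) + ι D * ½ ^ h ≤ q
        Φ+η≤q = begin
          Φ (const h) + ι D * ½ ^ h  ≡⟨ cong (_+ ι D * ½ ^ h) (Φ-const h) ⟩
          ι k * ½ ^ h + ι D * ½ ^ h  ≡⟨ solve 3 (λ k d x → k :* x :+ d :* x := (d :+ k) :* x) refl (ι k) (ι D) (½ ^ h) ⟩
          (ι D + ι k) * ½ ^ h  ≡⟨ cong (_* ½ ^ h) (sym (ι-+ D k)) ⟩
          ι (D ℕ.+ k) * ½ ^ h  ≤⟨ *-monoʳ-≤-nonNeg (½ ^ h) {{nonNegative (0≤^ h 0≤½)}} (ι-mono D+k≤) ⟩
          q                                 ∎
          where open ≤-Reasoning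
        initially : Valid 0 width (2 ℕ.* (h ℕ.+ 2) ℕ.* (width ∸ 1)) ⊥ (const h)
        initially = record
          { kept     = λ _ ()
          ; arrived  = λ x∈⊥ → contradiction x∈⊥ ∉⊥
          ; fresh    = λ _ → refl
          ; capacity = ℕₚ.≤-reflexive (cong (ℕ._+ width) (∣⊥∣≡0 n))
          ; fueled   = λ 2≤width → begin
              potential {n} ⊥ (const h) ℕ.+ (h ℕ.+ 2) ℕ.* width  ≡⟨ cong (ℕ._+ (h ℕ.+ 2) ℕ.* width) empty ⟩
              (h ℕ.+ 2) ℕ.* width  ≤⟨ ℕₚ.*-monoʳ-≤ (h ℕ.+ 2) (doubled 2≤width) ⟩
              (h ℕ.+ 2) ℕ.* (2 ℕ.* (width ∸ 1))  ≡⟨ ℕS.solve 2 (λ h w → (h ℕS.:+ ℕS.con 2) ℕS.:* (ℕS.con 2 ℕS.:* w) ℕS.:= ℕS.con 2 ℕS.:* (h ℕS.:+ ℕS.con 2) ℕS.:* w) refl h (width ∸ 1) ⟩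
              2 ℕ.* (h ℕ.+ 2) ℕ.* (width ∸ 1) ∎
          }
          where
          open ℕₚ.≤-Reasoning
          module ℕS = ℕ-Solver
          doubled : ∀ {w} → 2 ℕ.≤ w → w ℕ.≤ 2 ℕ.* (w ∸ 1)
          doubled {suc zero}    (ℕ.s≤s ())
          doubled {suc (suc w)} _ = ℕₚ.≤-trans (ℕₚ.m≤m+n (2 ℕ.+ w) w) (ℕₚ.≤-reflexive
            (ℕS.solve 1 (λ w → ℕS.con 2 ℕS.:+ w ℕS.:+ w ℕS.:= ℕS.con 2 ℕS.:* (ℕS.con 1 ℕS.:+ w)) refl w))
          empty : potential {n} ⊥ (const h) ≡ 0
          empty = ℕₚ.n≤0⇒n≡0 (ℕₚ.≤-trans (∑ₙ-mono zeros) (ℕₚ.≤-reflexive (sumₙ-zero n)))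
            where
            open import Algebra.Properties.CommutativeMonoid.Sum ℕₚ.+-0-commutativeMonoid using ()
              renaming (sum-replicate-zero to sumₙ-zero)
            zeros : ∀ x → (if does (x ∈? ⊥ {n}) then h ℕ.+ 2 else 0) ℕ.≤ 0
            zeros x with x ∈? ⊥ {n}
            ... | yes x∈⊥ = contradiction x∈⊥ ∉⊥
            ... | no _    = ℕ.z≤n
        fails : ∀ x → run x FailsAtMost φ x
        fails x with x ≟ o
        ... | no _ = fails-always 0≤g (run x)
        ... | yes refl = fails-mono (≤-trans Φ+η≤q (≤-reflexive (solve 1 (λ q → q := con 1ℚ :+ (q :- con 1ℚ)) refl q)))
          (stream-fails 1≤k (drift-power 1≤G gG 4) (drift-power 1≤G gG h) (0≤^ h 0≤½) window n (ℕₚ.+-identityʳ n)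
            width (2 ℕ.* (h ℕ.+ 2) ℕ.* (width ∸ 1)) ⊥ (const h) initially
            (ℕₚ.+-monoˡ-≤ width (ℕₚ.m≤m⊔n (toℕ o ℕ.* width) 0))
            (ℕₚ.≤-trans (ℕₚ.≤-reflexive (∣⊥∣≡0 n)) ℕ.z≤n))
        total : uniform B * sum φ ≡ 1ℚ - uniform B * (1ℚ - q)
        total = trans (cong (uniform B *_) (trans (∑-distrib-+ (λ _ → 1ℚ) (single o (q - 1ℚ)))
            (cong₂ _+_ (∑-const (suc B) 1ℚ) (∑-single o (q - 1ℚ)))))
          (trans (solve 3 (λ u l q → u :* (l :* con 1ℚ :+ (q :- con 1ℚ)) := u :* l :- u :* (con 1ℚ :- q)) refl
              (uniform B) (ι (suc B)) q)
            (cong (_- uniform B * (1ℚ - q)) (uniform-ι B)))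

-- Choice of the parameters and estimates of the logarithm

module ParameterChoice where

  open import Data.Fin using (Fin; zero; suc; toℕ; fromℕ<)
  open import Data.Fin.Properties using (toℕ<n; toℕ-fromℕ<; _≟_)
  open import Data.Fin.Subset using (Subset; _∈_; ∣_∣; ⁅_⁆)
  open import Data.Fin.Subset.Properties using (nonempty?; Empty-unique; ∣⊥∣≡0; ∣⁅x⁆∣≡1; p⊂q⇒∣p∣<∣q∣; x∈⁅y⁆⇒x≡y; x≢y⇒x∉⁅y⁆)
  open import Data.Integer using (+_)
  open import Data.Nat as ℕ using (ℕ; zero; suc; _∸_; NonZero)
  open import Data.Nat.DivMod as ℕ using (m/n*n≤m; m≡m%n+[m/n]*n; m%n<n)
  open import Data.Product using (∃; _×_; _,_; proj₁; proj₂)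
  open import Data.Rational hiding (_⊔_; ∣_∣; NonZero; _≟_)
  open import Data.Rational.Properties hiding (_≟_)
  open import Data.Sum using (_⊎_; inj₁; inj₂)
  open import Function using (_∘_)
  open import Relation.Binary.PropositionalEquality
  open import Relation.Nullary using (yes; no; contradiction)
  open RationalArithmetic
  open RealBounds
  open NoisyComparisons using (uniform; uniform-ι)
  open ℚ-Solver

  *-cancelʳ-ι : ∀ m {p q} → p * ι (suc m) ≡ q * ι (suc m) → p ≡ q
  *-cancelʳ-ι m eq = ≤-antisym (cancel (≤-reflexive eq)) (cancel (≤-reflexive (sym eq)))
    where
    cancel : ∀ {p q} → p * ι (suc m) ≤ q * ι (suc m) → p ≤ q
    cancel {p} {q} le = *-cancelˡ (ι (suc m)) (0<ι m)
      (≤-trans (≤-reflexive (*-comm (ι (suc m)) p)) (≤-trans le (≤-reflexive (*-comm q (ι (suc m))))))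

  -- A rational `U` that eventually bounds the terms of `δ` makes both sides rational, where the
  -- tolerance of real inequalities disappears.
  log-premise : ∀ {k δ a b U} → Log₂[ fromℕ k / δ ]≤ a / b → Eventually (λ m → 0ℚ ≤ seq δ m × seq δ m ≤ U) →
    ι k ^ b ≤ ι 2 ^ a * U ^ b
  log-premise {k} {δ} {a} {b} {U} premise bracket = fromℚ-cancel λ ε ε>0 →
    eventually-map₂ (λ {m} p (0≤δ , δ≤U) → ≤-trans
      (≤-reflexive (trans (cong (_^ b) (ι-def k)) (sym (seq-^ (fromℕ k) b m))))
      (≤-trans p (+-monoˡ-≤ ε (≤-trans
        (≤-reflexive (cong₂ _*_ (trans (seq-^ (fromℕ 2) a m) (cong (_^ a) (sym (ι-def 2)))) (seq-^ δ b m)))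
        (*-monoˡ (ι 2 ^ a) (0≤^ a (0≤ι 2)) (^-monoˡ-≤ b 0≤δ δ≤U))))))
      (premise ε ε>0) bracket

  2^-cancel : ∀ {m n} → 2 ℕ.^ m ℕ.≤ 2 ℕ.^ n → m ℕ.≤ n
  2^-cancel {m} {n} p = ℕₚ.≮⇒≥ λ n<m → ℕₚ.<⇒≱ (ℕₚ.^-monoʳ-< 2 ℕₚ.≤-refl n<m) p

  -- log₂ (k/δ) ≥ 1/N whenever δ ≤ 1 - 1/N.
  log-lower : ∀ {k a b N r} → 1 ℕ.≤ k → r * ι (suc N) ≡ 1ℚ → r ≤ 1ℚ → ι k ^ b ≤ ι 2 ^ a * (1ℚ - r) ^ b →
    b ℕ.≤ suc N ℕ.* a
  log-lower {k} {a} {b} {N} {r} 1≤k rN r≤1 premise = ℕₚ.≤-trans (2^-cancel {b} {a ℕ.* suc N} (ι-cancel (begin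
      ι (2 ℕ.^ b)
        ≡⟨ sym (*-identityʳ _) ⟩
      ι (2 ℕ.^ b) * 1ℚ
        ≤⟨ *-monoˡ (ι (2 ℕ.^ b)) (0≤ι (2 ℕ.^ b)) powered ⟩
      ι (2 ℕ.^ b) * (ι (2 ℕ.^ (a ℕ.* suc N)) * ½ ^ b)
        ≡⟨ solve 3 (λ x y z → x :* (y :* z) := y :* (z :* x)) refl (ι (2 ℕ.^ b)) (ι (2 ℕ.^ (a ℕ.* suc N))) (½ ^ b) ⟩
      ι (2 ℕ.^ (a ℕ.* suc N)) * (½ ^ b * ι (2 ℕ.^ b))
        ≡⟨ trans (cong (ι (2 ℕ.^ (a ℕ.* suc N)) *_) (½^-* b)) (*-identityʳ _) ⟩
      ι (2 ℕ.^ (a ℕ.* suc N)) ∎))) (ℕₚ.≤-reflexive (ℕₚ.*-comm a (suc N)))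
    where
    open ≤-Reasoning
    0≤1-r : 0ℚ ≤ 1ℚ - r
    0≤1-r = p≤q⇒0≤q-p r≤1
    -- The power `suc N` of the premise makes `(1 - r) ^ suc N ≤ 1/2` applicable, so powers of two
    -- can be compared.
    powered : 1ℚ ≤ ι (2 ℕ.^ (a ℕ.* suc N)) * ½ ^ b
    powered = begin
      1ℚ  ≤⟨ 1≤^ (suc N) (≤-trans (1≤^ b (≤-trans (≤-reflexive (sym ι-1)) (ι-mono 1≤k))) premise) ⟩
      (ι 2 ^ a * (1ℚ - r) ^ b) ^ suc N  ≡⟨ ^-distrib-* (ι 2 ^ a) ((1ℚ - r) ^ b) (suc N) ⟩
      (ι 2 ^ a) ^ suc N * ((1ℚ - r) ^ b) ^ suc N  ≡⟨ cong₂ _*_ (trans (^-assocʳ (ι 2) a (suc N)) (sym (ι-^ 2 (a ℕ.* suc N))))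
                                                            (trans (^-assocʳ (1ℚ - r) b (suc N)) (trans (cong ((1ℚ - r) ^_) (ℕₚ.*-comm b (suc N)))
                                                              (sym (^-assocʳ (1ℚ - r) (suc N) b)))) ⟩
      ι (2 ℕ.^ (a ℕ.* suc N)) * ((1ℚ - r) ^ suc N) ^ b ≤⟨ *-monoˡ _ (0≤ι _) (^-monoˡ-≤ b (0≤^ (suc N) 0≤1-r) ([1-r]^N≤½ r N rN)) ⟩
      ι (2 ℕ.^ (a ℕ.* suc N)) * ½ ^ b ∎

  log-lower-2≤k : ∀ {k a b} → 2 ℕ.≤ k → ι k ^ b ≤ ι 2 ^ a * 1ℚ ^ b → b ℕ.≤ a
  log-lower-2≤k {k} {a} {b} 2≤k premise = 2^-cancel (ℕₚ.≤-trans (ℕₚ.^-monoˡ-≤ b 2≤k) (ι-cancel (begin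
    ι (k ℕ.^ b)  ≡⟨ ι-^ k b ⟩
    ι k ^ b  ≤⟨ premise ⟩
    ι 2 ^ a * 1ℚ ^ b  ≡⟨ trans (cong (ι 2 ^ a *_) (1^ b)) (*-identityʳ (ι 2 ^ a)) ⟩
    ι 2 ^ a  ≡⟨ sym (ι-^ 2 a) ⟩
    ι (2 ℕ.^ a) ∎)))
    where open ≤-Reasoning

  -- The logarithm of `k/δ` is at least `κ + d - 3`, where 3 is the logarithm of the factor 8 lost
  -- in the dyadic bracket. It bounds the initial score from above.
  log-upper : ∀ {k a b κ d} → 2 ℕ.^ κ ℕ.≤ k → ι k ^ b ≤ ι 2 ^ a * (8ℚ * ½ ^ d) ^ b → (κ ℕ.+ d) ℕ.* b ℕ.≤ a ℕ.+ 3 ℕ.* b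
  log-upper {k} {a} {b} {κ} {d} 2^κ≤k premise = 2^-cancel (ι-cancel (begin
    ι (2 ℕ.^ ((κ ℕ.+ d) ℕ.* b))  ≡⟨ cong ι (trans (sym (ℕₚ.^-*-assoc 2 (κ ℕ.+ d) b)) (cong (ℕ._^ b) (ℕₚ.^-distribˡ-+-* 2 κ d))) ⟩
    ι ((2 ℕ.^ κ ℕ.* 2 ℕ.^ d) ℕ.^ b)  ≤⟨ ι-mono (ℕₚ.^-monoˡ-≤ b (ℕₚ.*-monoˡ-≤ (2 ℕ.^ d) 2^κ≤k)) ⟩
    ι ((k ℕ.* 2 ℕ.^ d) ℕ.^ b)  ≡⟨ trans (ι-^ (k ℕ.* 2 ℕ.^ d) b) (trans (cong (_^ b) (ι-* k (2 ℕ.^ d))) (^-distrib-* (ι k) (ι (2 ℕ.^ d)) b)) ⟩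
    ι k ^ b * ι (2 ℕ.^ d) ^ b  ≤⟨ *-monoʳ-≤-nonNeg (ι (2 ℕ.^ d) ^ b) {{nonNegative (0≤^ b (0≤ι (2 ℕ.^ d)))}} premise ⟩
    ι 2 ^ a * (8ℚ * ½ ^ d) ^ b * ι (2 ℕ.^ d) ^ b ≡⟨ *-assoc (ι 2 ^ a) _ _ ⟩
    ι 2 ^ a * ((8ℚ * ½ ^ d) ^ b * ι (2 ℕ.^ d) ^ b) ≡⟨ cong (ι 2 ^ a *_) (trans (sym (^-distrib-* (8ℚ * ½ ^ d) (ι (2 ℕ.^ d)) b))
                                                     (cong (_^ b) (trans (*-assoc 8ℚ (½ ^ d) (ι (2 ℕ.^ d))) (trans (cong (8ℚ *_) (½^-* d)) (*-identityʳ 8ℚ))))) ⟩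
    ι 2 ^ a * 8ℚ ^ b  ≡⟨ cong₂ _*_ (sym (ι-^ 2 a)) (trans (cong (_^ b) (sym (ι-def 8))) (sym (ι-^ 8 b))) ⟩
    ι (2 ℕ.^ a) * ι (8 ℕ.^ b)  ≡⟨ sym (ι-* (2 ℕ.^ a) (8 ℕ.^ b)) ⟩
    ι (2 ℕ.^ a ℕ.* 8 ℕ.^ b)  ≡⟨ cong ι (trans (cong (2 ℕ.^ a ℕ.*_) (ℕₚ.^-*-assoc 2 3 b)) (sym (ℕₚ.^-distribˡ-+-* 2 a (3 ℕ.* b)))) ⟩
    ι (2 ℕ.^ (a ℕ.+ 3 ℕ.* b)) ∎))
    where open ≤-Reasoning

  log-floor : ∀ k → 1 ℕ.≤ k → ∃ λ κ → 2 ℕ.^ κ ℕ.≤ k × k ℕ.≤ 2 ℕ.^ suc κ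
  log-floor (suc zero)    _ = 0 , ℕₚ.≤-refl , ℕ.s≤s ℕ.z≤n
  log-floor (suc (suc k)) _ with log-floor (suc k) (ℕ.s≤s ℕ.z≤n)
  ... | κ , lo , hi with ℕₚ.m≤n⇒m<n∨m≡n hi
  ...   | inj₁ k<  = κ , ℕₚ.m≤n⇒m≤1+n lo , k<
  ...   | inj₂ eq  = suc κ , ℕₚ.≤-trans (ℕₚ.≤-reflexive (sym eq)) (ℕₚ.n≤1+n (suc k)) ,
          ℕₚ.≤-trans (ℕ.s≤s (ℕₚ.≤-reflexive eq)) (ℕₚ.≤-trans
            (ℕₚ.+-monoˡ-≤ (2 ℕ.^ suc κ) (ℕₚ.m^n>0 2 (suc κ)))
            (ℕₚ.+-monoʳ-≤ (2 ℕ.^ suc κ) (ℕₚ.m≤m+n (2 ℕ.^ suc κ) 0)))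

  record Rate (γ : ℝ) : Set where
    field
      G      : ℕ
      g      : ℚ
      1≤G    : 1 ℕ.≤ G
      0≤g    : 0ℚ ≤ g
      g≤½    : g ≤ ½
      gG     : g * ι G ≡ 1ℚ
      above  : fromℚ g ≤ᵣ γ
      bounded : Eventually (λ m → 0ℚ ≤ seq γ m × seq γ m ≤ (8ℚ + 8ℚ) * g)

  -- The lower end of the bracket is halved once more: this gives `g ≤ ½` without inspecting `d`,
  -- and the factor 8 becomes 16.
  rate : ∀ {γ} → 0ᵣ <ᵣ γ → γ ≤ᵣ ½ᵣ → Rate γ
  rate {γ} (ε , 0<ε , positive) γ≤½ = record
    { G     = 2 ℕ.^ suc d
    ; g     = ½ ^ suc d
    ; 1≤G   = ℕₚ.m^n>0 2 (suc d)
    ; 0≤g   = 0≤^ (suc d) 0≤½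
    ; g≤½   = ≤-trans (^-anti {½} {1} {suc d} 0≤½ (≤ᵇ⇒≤ _) (ℕ.s≤s ℕ.z≤n)) ≤-refl
    ; gG    = ½^-* (suc d)
    ; above = eventually-≤ {fromℚ (½ ^ suc d)} {γ} (eventually-map (λ (lo , _) →
        ≤-trans (≤-by-gap (½ * ½ ^ d) (0≤* 0≤½ (0≤^ d 0≤½)) (solve 1 (λ x → con ½ :* x :+ con ½ :* x := x) refl (½ ^ d))) lo) bracketed)
    ; bounded = eventually-map (λ (lo , hi) → ≤-trans (0≤^ d 0≤½) lo ,
        ≤-trans hi (≤-reflexive (solve 1 (λ x → con 8ℚ :* x := con (8ℚ + 8ℚ) :* (con ½ :* x)) refl (½ ^ d)))) bracketed
    }
    where
    0≤½ : 0ℚ ≤ ½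
    0≤½ = nonNegative⁻¹ ½
    bracket : ∃ λ d → Eventually (λ m → ½ ^ d ≤ seq γ m × seq γ m ≤ 8ℚ * ½ ^ d)
    bracket = dyadic-bracket γ 0<ε (eventually-map (λ p → ≤-trans (≤-reflexive (sym (+-identityˡ ε))) p) positive)
      (γ≤½ ½ (positive⁻¹ ½))
    d : ℕ
    d = proj₁ bracket
    bracketed : Eventually (λ m → ½ ^ d ≤ seq γ m × seq γ m ≤ 8ℚ * ½ ^ d)
    bracketed = proj₂ bracket

  uniform-2^ : ∀ e → uniform (2 ℕ.^ e ∸ 1) ≡ ½ ^ e
  uniform-2^ e = *-cancelʳ-ι (2 ℕ.^ e ∸ 1) (trans (uniform-ι (2 ℕ.^ e ∸ 1))
    (sym (trans (cong (λ z → ½ ^ e * ι z) (ℕₚ.m+[n∸m]≡n (ℕₚ.m^n>0 2 e))) (½^-* e))))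

  ι2^j*½^[1+j]≡½ : ∀ j → ι (2 ℕ.^ j) * ½ ^ suc j ≡ ½
  ι2^j*½^[1+j]≡½ j = trans (solve 2 (λ x y → x :* (con ½ :* y) := con ½ :* (y :* x)) refl (ι (2 ℕ.^ j)) (½ ^ j))
    (trans (cong (½ *_) (½^-* j)) (*-identityʳ ½))

  ∣p∣≡1⇒singleton : ∀ {n} {p : Subset n} → ∣ p ∣ ≡ 1 → ∃ λ x → ∀ {y} → y ∈ p → y ≡ x
  ∣p∣≡1⇒singleton {n} {p} ∣p∣≡1 with nonempty? p
  ... | no empty = contradiction (trans (sym ∣p∣≡1) (trans (cong ∣_∣ (Empty-unique empty)) (∣⊥∣≡0 n))) λ ()
  ... | yes (x , x∈p) = x , λ {y} y∈p → unique y∈p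
    where
    unique : ∀ {y} → y ∈ p → y ≡ x
    unique {y} y∈p with y ≟ x
    ... | yes y≡x = y≡x
    ... | no y≢x = contradiction (p⊂q⇒∣p∣<∣q∣ {p = ⁅ x ⁆} {p}
            ((λ z∈x → subst (_∈ p) (sym (x∈⁅y⁆⇒x≡y x z∈x)) x∈p) , y , y∈p , x≢y⇒x∉⁅y⁆ y≢x))
          (ℕₚ.<-irrefl (trans (∣⁅x⁆∣≡1 x) (sym ∣p∣≡1)))

  -- `B + 1` blocks of length `w` are on offer. `covers` provides one that holds the whole top set,
  -- `uniform B` is the chance of drawing it, and `efficient` is the comparison bound with the
  -- factor for `γ` split off.
  record Choice (p : Parameters) : Set where
    open Parameters p
    field
      h B w     : ℕ
      1≤h       : 1 ℕ.≤ h
      covers    : ∀ {top : Subset n} → ∣ top ∣ ≡ k → ∃ λ (o : Fin (suc B)) →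
                  ∀ {x} → x ∈ top → toℕ o ℕ.* w ℕ.≤ toℕ x × toℕ x ℕ.< toℕ o ℕ.* w ℕ.+ w
      succeeds  : Eventually (λ m → 1ℚ - seq δ m ≤ uniform B * (1ℚ - ι (4096 ℕ.* k) * ½ ^ h))
      efficient : ∀ a b → Log₂[ fromℕ k / δ ]≤ a / suc b → (w ∸ 1) ℕ.* h ℕ.* suc b ℕ.≤ 545 ℕ.* (n ℕ.* a)

  module _ (p : Parameters) where

    open Parameters p

    private
      31/32 15/16 : ℚ
      31/32 = + 31 / 32
      15/16 = + 15 / 16

      0≤½^ : ∀ d → 0ℚ ≤ ½ ^ d
      0≤½^ d = 0≤^ d (nonNegative⁻¹ ½)

      0≤δ : Eventually (λ m → 0ℚ ≤ seq δ m)
      0≤δ = eventually-map (≤-trans (≤-trans (<⇒≤ (proj₁ (proj₂ 0<δ))) (≤-reflexive (sym (+-identityˡ (proj₁ 0<δ))))))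
        (proj₂ (proj₂ 0<δ))

      δ≤1 : Eventually (λ m → seq δ m ≤ 1ℚ)
      δ≤1 = eventually-map (≤-trans (≤-by-gap (proj₁ δ<1) (<⇒≤ (proj₁ (proj₂ δ<1))) refl)) (proj₂ (proj₂ δ<1))

    -- Real numbers cannot be compared with a threshold, but two overlapping alternatives can be
    -- separated: a term of precision 1/64 is tested against 61/64, and one step of 1/64 either way
    -- leads to 62/64 or 60/64.
    δ-split : Eventually (λ m → seq δ m ≤ 31/32) ⊎ Eventually (λ m → 15/16 ≤ seq δ m)
    δ-split with cauchy δ (+ 1 / 64) (positive⁻¹ (+ 1 / 64))
    ... | N , close with seq δ N ≤? + 61 / 64
    ...   | yes δ≤ = inj₁ (N , λ m N≤m → ≤-trans (∣p-q∣<r⇒p≤q+r (seq δ m) (seq δ N) (close m N N≤m ℕₚ.≤-refl))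
              (+-monoˡ-≤ (+ 1 / 64) δ≤))
    ...   | no ¬δ≤ = inj₂ (N , λ m N≤m → ≤-by-gap (seq δ m + + 1 / 64 - seq δ N + (seq δ N - + 61 / 64))
              (0≤+ (p≤q⇒0≤q-p (∣p-q∣<r⇒q≤p+r (seq δ m) (seq δ N) (close m N N≤m ℕₚ.≤-refl)))
                   (p≤q⇒0≤q-p (<⇒≤ (≰⇒> ¬δ≤))))
              (solve 2 (λ x y → con 15/16 :+ (x :+ con (+ 1 / 64) :- y :+ (y :- con (+ 61 / 64))) := x) refl (seq δ m) (seq δ N)))

    general : 2 ℕ.≤ k ⊎ Eventually (λ m → seq δ m ≤ 31/32) → Choice p
    general large = record
      { h = h ; B = 0 ; w = n
      ; 1≤h = ℕ.s≤s ℕ.z≤n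
      ; covers = λ _ → zero , λ {x} _ → ℕ.z≤n , toℕ<n x
      ; succeeds = eventually-map (λ {m} (lo , _) → ≤-trans (+-monoʳ-≤ 1ℚ (neg-antimono-≤ (≤-trans q≤ lo)))
          (≤-reflexive (sym (*-identityˡ (1ℚ - ι (4096 ℕ.* k) * ½ ^ h))))) (proj₂ bracket)
      ; efficient = λ a b premise → efficient a (suc b) premise
      }
      where
      bracket : ∃ λ d → Eventually (λ m → ½ ^ d ≤ seq δ m × seq δ m ≤ 8ℚ * ½ ^ d)
      bracket = dyadic-bracket δ (proj₁ (proj₂ 0<δ))
        (eventually-map (≤-trans (≤-reflexive (sym (+-identityˡ (proj₁ 0<δ))))) (proj₂ (proj₂ 0<δ))) δ≤1
      d κ h : ℕ
      d = proj₁ bracket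
      κ = proj₁ (log-floor k 1≤k)
      -- 12 cancels 4096 and `1 + κ` cancels `k ≤ 2 ^ suc κ`; the failure bound that remains is
      -- `½ ^ d ≤ δ`.
      h = 13 ℕ.+ (κ ℕ.+ d)
      2^κ≤k : 2 ℕ.^ κ ℕ.≤ k
      2^κ≤k = proj₁ (proj₂ (log-floor k 1≤k))
      q≤ : ι (4096 ℕ.* k) * ½ ^ h ≤ ½ ^ d
      q≤ = begin
        ι (4096 ℕ.* k) * ½ ^ h  ≤⟨ *-monoʳ-≤-nonNeg (½ ^ h) {{nonNegative (0≤½^ h)}} (ι-mono (ℕₚ.*-monoʳ-≤ 4096 (proj₂ (proj₂ (log-floor k 1≤k))))) ⟩
        ι (4096 ℕ.* 2 ℕ.^ suc κ) * ½ ^ h  ≡⟨ cong₂ _*_ (cong ι (trans (sym (ℕₚ.^-distribˡ-+-* 2 12 (suc κ))) (cong (2 ℕ.^_) (ℕₚ.+-suc 12 κ))))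
                                                          (trans (cong (½ ^_) (sym (ℕₚ.+-assoc 13 κ d))) (^-homo-* ½ (13 ℕ.+ κ) d)) ⟩
        ι (2 ℕ.^ (13 ℕ.+ κ)) * (½ ^ (13 ℕ.+ κ) * ½ ^ d) ≡⟨ solve 3 (λ x y z → x :* (y :* z) := (y :* x) :* z) refl (ι (2 ℕ.^ (13 ℕ.+ κ))) (½ ^ (13 ℕ.+ κ)) (½ ^ d) ⟩
        ½ ^ (13 ℕ.+ κ) * ι (2 ℕ.^ (13 ℕ.+ κ)) * ½ ^ d ≡⟨ trans (cong (_* ½ ^ d) (½^-* (13 ℕ.+ κ))) (*-identityˡ (½ ^ d)) ⟩
        ½ ^ d ∎
        where open ≤-Reasoning
      b≤32a : ∀ {a b} → Log₂[ fromℕ k / δ ]≤ a / b → b ℕ.≤ 32 ℕ.* a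
      b≤32a {a} {b} premise = by-size large
        where
        by-size : 2 ℕ.≤ k ⊎ Eventually (λ m → seq δ m ≤ 31/32) → b ℕ.≤ 32 ℕ.* a
        by-size (inj₁ 2≤k)  = ℕₚ.≤-trans (log-lower-2≤k 2≤k
          (log-premise {k} {δ} {a} {b} premise (eventually-map₂ _,_ 0≤δ δ≤1))) (ℕₚ.m≤n*m a 32)
        by-size (inj₂ δ≤) = log-lower {k} {a} {b} {31} {+ 1 / 32} 1≤k (uniform-ι 31) (≤ᵇ⇒≤ _)
          (log-premise {k} {δ} {a} {b} premise (eventually-map₂ _,_ 0≤δ δ≤))
      efficient : ∀ a b → Log₂[ fromℕ k / δ ]≤ a / b → (n ∸ 1) ℕ.* h ℕ.* b ℕ.≤ 545 ℕ.* (n ℕ.* a)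
      efficient a b premise = begin
        (n ∸ 1) ℕ.* h ℕ.* b  ≤⟨ ℕₚ.*-monoˡ-≤ b (ℕₚ.*-monoˡ-≤ h (ℕₚ.m∸n≤m n 1)) ⟩
        n ℕ.* h ℕ.* b  ≡⟨ ℕS.solve 3 (λ n c b → n ℕS.:* (ℕS.con 13 ℕS.:+ c) ℕS.:* b ℕS.:= n ℕS.:* (ℕS.con 13 ℕS.:* b ℕS.:+ c ℕS.:* b)) refl n (κ ℕ.+ d) b ⟩
        n ℕ.* (13 ℕ.* b ℕ.+ (κ ℕ.+ d) ℕ.* b)  ≤⟨ ℕₚ.*-monoʳ-≤ n (ℕₚ.+-monoʳ-≤ (13 ℕ.* b) (log-upper {k} {a} {b} {κ} {d} 2^κ≤k
                                                           (log-premise {k} {δ} {a} {b} premise (eventually-map (λ (lo , hi) → ≤-trans (0≤½^ d) lo , hi) (proj₂ bracket))))) ⟩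
        n ℕ.* (13 ℕ.* b ℕ.+ (a ℕ.+ 3 ℕ.* b))  ≡⟨ ℕS.solve 3 (λ n a b → n ℕS.:* (ℕS.con 13 ℕS.:* b ℕS.:+ (a ℕS.:+ ℕS.con 3 ℕS.:* b)) ℕS.:= n ℕS.:* (a ℕS.:+ ℕS.con 16 ℕS.:* b)) refl n a b ⟩
        -- The additive 16 in the score is absorbed because here the logarithm is at least 1/32;
        -- this is what breaks down for `k = 1` and `δ` close to 1. The result is
        -- `1 + 16 * 32 = 513`; the common constant 545 also exceeds the 208 of `sparse`.
        n ℕ.* (a ℕ.+ 16 ℕ.* b)  ≤⟨ ℕₚ.*-monoʳ-≤ n (ℕₚ.+-monoʳ-≤ a (ℕₚ.*-monoʳ-≤ 16 (b≤32a {a} {b} premise))) ⟩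
        n ℕ.* (a ℕ.+ 16 ℕ.* (32 ℕ.* a))  ≡⟨ ℕS.solve 2 (λ n a → n ℕS.:* (a ℕS.:+ ℕS.con 16 ℕS.:* (ℕS.con 32 ℕS.:* a)) ℕS.:= ℕS.con 513 ℕS.:* (n ℕS.:* a)) refl n a ⟩
        513 ℕ.* (n ℕ.* a)  ≤⟨ ℕₚ.*-monoˡ-≤ (n ℕ.* a) (ℕₚ.m≤m+n 513 32) ⟩
        545 ℕ.* (n ℕ.* a) ∎
        where
        open ℕₚ.≤-Reasoning
        module ℕS = ℕ-Solver

    private
      16ℚ : ℚ
      16ℚ = 8ℚ + 8ℚ
      0≤16 : 0ℚ ≤ 16ℚ
      0≤16 = nonNegative⁻¹ 16ℚ

    -- For k = 1 and a small success probability 1 - δ it suffices to examine a random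
    -- block that makes up a fraction of about 2 (1 - δ) of the stream.
    sparse : k ≡ 1 → ∀ e → Eventually (λ m → ½ ^ e ≤ 16ℚ * (1ℚ - seq δ m) × 16ℚ * (1ℚ - seq δ m) ≤ 8ℚ * ½ ^ e) → Choice p
    sparse k≡1 e bracket = record
      { h = 13 ; B = 2 ℕ.^ e ∸ 1 ; w = w
      ; 1≤h = ℕ.s≤s ℕ.z≤n
      ; covers = λ ∣top∣≡k → covers (trans ∣top∣≡k k≡1)
      ; succeeds = eventually-map (λ {m} (_ , hi) → ≤-trans
          (*-cancelˡ 16ℚ (positive⁻¹ 16ℚ) (≤-trans hi (≤-reflexive
            (solve 1 (λ x → con 8ℚ :* x := con 16ℚ :* (x :* con ½)) refl (½ ^ e)))))
          (≤-reflexive (cong₂ _*_ (sym (uniform-2^ e)) (cong (λ z → 1ℚ - z) (sym q≡½))))) bracket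
      ; efficient = λ a b premise → efficient a (suc b) premise
      }
      where
      w : ℕ
      instance
        2^e-nonZero : NonZero (2 ℕ.^ e)
        2^e-nonZero = ℕₚ.m^n≢0 2 e
      -- Rounding up makes `2 ^ e` blocks cover the stream, while `w ∸ 1` stays below `n / 2 ^ e`
      -- even when that is less than 1. With score 13 the right block succeeds with probability at
      -- least 1/2.
      w = suc (n ℕ./ 2 ℕ.^ e)
      q≡½ : ι (4096 ℕ.* k) * ½ ^ 13 ≡ ½
      q≡½ = trans (cong (λ z → ι z * ½ ^ 13) (cong (4096 ℕ.*_) k≡1)) (ι2^j*½^[1+j]≡½ 12)
      n<w*2^e : n ℕ.< w ℕ.* 2 ℕ.^ e
      n<w*2^e = ℕₚ.≤-<-trans (ℕₚ.≤-reflexive (m≡m%n+[m/n]*n n (2 ℕ.^ e)))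
        (ℕₚ.+-monoˡ-< (n ℕ./ 2 ℕ.^ e ℕ.* 2 ℕ.^ e) (m%n<n n (2 ℕ.^ e)))
      covers : ∀ {top : Subset n} → ∣ top ∣ ≡ 1 → ∃ λ (o : Fin (suc (2 ℕ.^ e ∸ 1))) →
               ∀ {y} → y ∈ top → toℕ o ℕ.* w ℕ.≤ toℕ y × toℕ y ℕ.< toℕ o ℕ.* w ℕ.+ w
      covers ∣top∣≡1 with ∣p∣≡1⇒singleton ∣top∣≡1
      ... | y , unique = fromℕ< o< , λ z∈top → window (unique z∈top)
        where
        o : ℕ
        o = toℕ y ℕ./ w
        o< : o ℕ.< suc (2 ℕ.^ e ∸ 1)
        o< = ℕₚ.<-≤-trans (ℕ.m<n*o⇒m/o<n (ℕₚ.<-trans (toℕ<n y) (subst (n ℕ.<_) (ℕₚ.*-comm w (2 ℕ.^ e)) n<w*2^e)))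
          (ℕₚ.≤-reflexive (sym (ℕₚ.m+[n∸m]≡n (ℕₚ.m^n>0 2 e))))
        window : ∀ {z} → z ≡ y → toℕ (fromℕ< o<) ℕ.* w ℕ.≤ toℕ z × toℕ z ℕ.< toℕ (fromℕ< o<) ℕ.* w ℕ.+ w
        window refl rewrite toℕ-fromℕ< o< = m/n*n≤m (toℕ y) w ,
          ℕₚ.<-≤-trans (ℕₚ.≤-<-trans (ℕₚ.≤-reflexive (m≡m%n+[m/n]*n (toℕ y) w)) (ℕₚ.+-monoˡ-< (o ℕ.* w) (m%n<n (toℕ y) w)))
            (ℕₚ.≤-reflexive (ℕₚ.+-comm w (o ℕ.* w)))
      efficient : ∀ a b → Log₂[ fromℕ k / δ ]≤ a / b → (w ∸ 1) ℕ.* 13 ℕ.* b ℕ.≤ 545 ℕ.* (n ℕ.* a)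
      efficient a b premise = begin
        v ℕ.* 13 ℕ.* b  ≤⟨ ℕₚ.*-monoʳ-≤ (v ℕ.* 13) b≤ ⟩
        v ℕ.* 13 ℕ.* (16 ℕ.* 2 ℕ.^ e ℕ.* a) ≡⟨ ℕS.solve 3 (λ v x a → v ℕS.:* ℕS.con 13 ℕS.:* (ℕS.con 16 ℕS.:* x ℕS.:* a) ℕS.:= ℕS.con 208 ℕS.:* (v ℕS.:* x ℕS.:* a)) refl v (2 ℕ.^ e) a ⟩
        208 ℕ.* (v ℕ.* 2 ℕ.^ e ℕ.* a)  ≤⟨ ℕₚ.*-mono-≤ (ℕₚ.m≤m+n 208 337) (ℕₚ.*-monoˡ-≤ a (m/n*n≤m n (2 ℕ.^ e))) ⟩
        545 ℕ.* (n ℕ.* a) ∎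
        where
        open ℕₚ.≤-Reasoning
        module ℕS = ℕ-Solver
        v N : ℕ
        v = n ℕ./ 2 ℕ.^ e
        N = 16 ℕ.* 2 ℕ.^ e ∸ 1
        sucN : suc N ≡ 16 ℕ.* 2 ℕ.^ e
        sucN = ℕₚ.m+[n∸m]≡n (ℕₚ.*-mono-≤ {1} {16} (ℕ.s≤s ℕ.z≤n) (ℕₚ.m^n>0 2 e))
        -- The lower end of the bracket without its factor 16: `1 - δ ≥ r`. So the logarithm is at
        -- least `1 / (16 * 2 ^ e)`, proportional to the share of the stream that is examined.
        r : ℚ
        r = ½ ^ (4 ℕ.+ e)
        δ≤1-r : Eventually (λ m → seq δ m ≤ 1ℚ - r)
        δ≤1-r = eventually-map (λ {m} (lo , _) → ≤-by-gap (½ ^ 4 * (16ℚ * (1ℚ - seq δ m) - ½ ^ e))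
          (0≤* (nonNegative⁻¹ (½ ^ 4)) (p≤q⇒0≤q-p lo))
          (solve 2 (λ d y → d :+ con (½ ^ 4) :* (con 16ℚ :* (con 1ℚ :- d) :- y) := con 1ℚ :- con ½ :* (con ½ :* (con ½ :* (con ½ :* y))))
            refl (seq δ m) (½ ^ e))) bracket
        b≤ : b ℕ.≤ 16 ℕ.* 2 ℕ.^ e ℕ.* a
        b≤ = subst (λ z → b ℕ.≤ z ℕ.* a) sucN (log-lower {k} {a} {b} {N} {r} 1≤k
          (trans (cong (λ z → r * ι z) (trans sucN (sym (ℕₚ.^-distribˡ-+-* 2 4 e)))) (½^-* (4 ℕ.+ e)))
          (≤-trans (^-anti {½} {0} {4 ℕ.+ e} (nonNegative⁻¹ ½) (≤ᵇ⇒≤ _) ℕ.z≤n) ≤-refl)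
          (log-premise {k} {δ} {a} {b} premise (eventually-map₂ _,_ 0≤δ δ≤1-r)))

    -- Scaling by 16 uses the full range up to 1 that `dyadic-bracket` allows. Its factor 8 then
    -- leaves `1 - δ ≤ ½ ^ e / 2`, exactly the chance `½ ^ e` of the right block times its success
    -- probability 1/2.
    1-δ-bracket : Eventually (λ m → 15/16 ≤ seq δ m) →
      ∃ λ e → Eventually (λ m → ½ ^ e ≤ 16ℚ * (1ℚ - seq δ m) × 16ℚ * (1ℚ - seq δ m) ≤ 8ℚ * ½ ^ e)
    1-δ-bracket 15/16≤δ = dyadic-bracket (fromℚ 16ℚ *ᵣ (1ᵣ -ᵣ δ)) (proj₁ (proj₂ δ<1))
      (eventually-map (λ {m} δ+ε≤1 → ≤-by-gap (16ℚ * (1ℚ - (seq δ m + ε)) + (16ℚ - 1ℚ) * ε)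
        (0≤+ (0≤* 0≤16 (p≤q⇒0≤q-p δ+ε≤1)) (0≤* (p≤q⇒0≤q-p {1ℚ} {16ℚ} (≤ᵇ⇒≤ _)) (<⇒≤ (proj₁ (proj₂ δ<1)))))
        (solve 3 (λ s d e → e :+ (s :* (con 1ℚ :- (d :+ e)) :+ (s :- con 1ℚ) :* e) := s :* (con 1ℚ :- d)) refl 16ℚ (seq δ m) ε))
        (proj₂ (proj₂ δ<1)))
      (eventually-map (λ {m} lo → *-monoˡ 16ℚ 0≤16 (+-monoʳ-≤ 1ℚ (neg-antimono-≤ lo))) 15/16≤δ)
      where
      ε : ℚ
      ε = proj₁ δ<1

    choice : Choice p
    choice with k ℕ.≟ 1 | δ-split
    ... | _        | inj₁ δ≤    = general (inj₂ δ≤)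
    ... | yes k≡1  | inj₂ 15/16≤δ = sparse k≡1 (proj₁ (1-δ-bracket 15/16≤δ)) (proj₂ (1-δ-bracket 15/16≤δ))
    ... | no k≢1   | inj₂ _     = general (inj₁ (ℕₚ.≤∧≢⇒< 1≤k (k≢1 ∘ sym)))

-- Assembly of the three bounds

open import Data.Fin using (Fin)
open import Data.Nat using (ℕ; _≤_; _*_)
open import Data.Product using (Σ; ∃; _×_)
open import Relation.Binary.PropositionalEquality using (_≡_)
open import Data.Fin using (toℕ)
open import Data.Fin.Subset using (_∈_)
import Data.Nat as ℕ
import Data.Rational as ℚ
open ℚ using (ℚ; 0ℚ; 1ℚ)
import Data.Rational.Properties as ℚₚ
open import Data.Integer using (+_)
open import Data.Product using (_,_; proj₁; proj₂)
open import Relation.Binary.PropositionalEquality using (refl; sym; trans; cong; cong₂)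
open RationalArithmetic
open RealBounds
open NoisyComparisons
open TopAlgorithm
open LargestElements
open SuccessProbability
open ParameterChoice

module Tuned (p : Parameters) (γ-rate : Rate (Parameters.γ p)) (p-choice : Choice p) where

  open Parameters p
  open Rate γ-rate
  open Choice p-choice

  private
    volume : ℕ
    volume = (w ℕ.∸ 1) ℕ.* h

  streaming-algorithm : StreamingAlgorithm n
  streaming-algorithm = algorithm n k G h (ℕ.suc B) w

  memory-bound : peakMemory streaming-algorithm ≤ 17 * k
  memory-bound = Within.memory≤ (within-algorithm n k G h (ℕ.suc B) w 1≤k 1≤h)

  -- The constant has three sources: `σ = 16²` from `γ ≤ 16 g`, `α` from the comparisons per unit of
  -- `volume * (G * G)`, and `β` from the volume relative to `n` times the logarithm. Kept as
  -- variables, they are never multiplied out.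
  comparison-bound-for : ∀ σ α β q → ι σ ≡ (8ℚ ℚ.+ 8ℚ) ℚ.* (8ℚ ℚ.+ 8ℚ) → q ≤ α * (volume * (G * G)) →
    (∀ a b → Log₂[ fromℕ k / δ ]≤ a / ℕ.suc b → volume * ℕ.suc b ≤ β * (n * a)) →
    ComparisonBound p (σ * (α * β)) q
  comparison-bound-for σ α β q σ≡ q≤ cheap a b premise =
    eventually-≤ {fromℕ q *ᵣ (γ *ᵣ γ)} {fromℕ c *ᵣ fromℕ n *ᵣ fromℚ (+ a ℚ./ ℕ.suc b)} (eventually-map bound bounded)
    where
    c : ℕ
    c = σ * (α * β)
    scaled : σ * (α * volume) * ℕ.suc b ≤ c * n * a
    scaled = begin
      σ * (α * volume) * ℕ.suc b  ≡⟨ ℕ-Solver.solve 4 (λ σ α v b → σ :* (α :* v) :* b := σ :* α :* (v :* b)) refl σ α volume (ℕ.suc b) ⟩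
      σ * α * (volume * ℕ.suc b)  ≤⟨ ℕₚ.*-monoʳ-≤ (σ * α) (cheap a b premise) ⟩
      σ * α * (β * (n * a))  ≡⟨ ℕ-Solver.solve 5 (λ σ α β n a → σ :* α :* (β :* (n :* a)) := σ :* (α :* β) :* n :* a) refl σ α β n a ⟩
      c * n * a ∎
      where
      open ℕₚ.≤-Reasoning
      open ℕ-Solver
    ιq : ι q ℚ.* (g ℚ.* g) ℚ.≤ ι (α * volume)
    ιq = begin
      ι q ℚ.* (g ℚ.* g)  ≤⟨ ℚₚ.*-monoʳ-≤-nonNeg (g ℚ.* g) {{ℚ.nonNegative (0≤* 0≤g 0≤g)}} (ι-mono q≤) ⟩
      ι (α * (volume * (G * G))) ℚ.* (g ℚ.* g)  ≡⟨ cong (ℚ._* (g ℚ.* g)) (trans (cong ι (sym (ℕₚ.*-assoc α volume (G * G))))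
                                                          (trans (ι-* (α * volume) (G * G)) (cong (ι (α * volume) ℚ.*_) (ι-* G G)))) ⟩
      ι (α * volume) ℚ.* (ι G ℚ.* ι G) ℚ.* (g ℚ.* g) ≡⟨ solve 3 (λ v G g → v :* (G :* G) :* (g :* g) := v :* ((g :* G) :* (g :* G))) refl (ι (α * volume)) (ι G) g ⟩
      ι (α * volume) ℚ.* ((g ℚ.* ι G) ℚ.* (g ℚ.* ι G)) ≡⟨ cong (λ z → ι (α * volume) ℚ.* (z ℚ.* z)) gG ⟩
      ι (α * volume) ℚ.* (1ℚ ℚ.* 1ℚ)  ≡⟨ ℚₚ.*-identityʳ (ι (α * volume)) ⟩
      ι (α * volume) ∎
      where
      open ℚₚ.≤-Reasoning
      open ℚ-Solver
    rational : ι σ ℚ.* ι (α * volume) ℚ.≤ ι c ℚ.* ι n ℚ.* (+ a ℚ./ ℕ.suc b)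
    rational = *-cancelˡ (ι (ℕ.suc b)) (0<ι b) (begin
      ι (ℕ.suc b) ℚ.* (ι σ ℚ.* ι (α * volume))  ≡⟨ trans (cong (ι (ℕ.suc b) ℚ.*_) (sym (ι-* σ (α * volume))))
                                                          (trans (ℚₚ.*-comm (ι (ℕ.suc b)) (ι (σ * (α * volume)))) (sym (ι-* (σ * (α * volume)) (ℕ.suc b)))) ⟩
      ι (σ * (α * volume) * ℕ.suc b)  ≤⟨ ι-mono scaled ⟩
      ι (c * n * a)  ≡⟨ trans (ι-* (c * n) a) (cong₂ ℚ._*_ (ι-* c n) (sym (/-cancel a b))) ⟩
      ι c ℚ.* ι n ℚ.* ((+ a ℚ./ ℕ.suc b) ℚ.* ι (ℕ.suc b)) ≡⟨ solve 3 (λ x y z → x :* (y :* z) := z :* (x :* y)) refl (ι c ℚ.* ι n) (+ a ℚ./ ℕ.suc b) (ι (ℕ.suc b)) ⟩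
      ι (ℕ.suc b) ℚ.* (ι c ℚ.* ι n ℚ.* (+ a ℚ./ ℕ.suc b)) ∎)
      where
      open ℚₚ.≤-Reasoning
      open ℚ-Solver
    bound : ∀ {m} → 0ℚ ℚ.≤ seq γ m × seq γ m ℚ.≤ (8ℚ ℚ.+ 8ℚ) ℚ.* g →
      (+ q ℚ./ 1) ℚ.* (seq γ m ℚ.* seq γ m) ℚ.≤ (+ c ℚ./ 1) ℚ.* (+ n ℚ./ 1) ℚ.* (+ a ℚ./ ℕ.suc b)
    bound {m} (0≤γ , γ≤) = begin
      (+ q ℚ./ 1) ℚ.* (seq γ m ℚ.* seq γ m)  ≡⟨ cong (ℚ._* (seq γ m ℚ.* seq γ m)) (sym (ι-def q)) ⟩
      ι q ℚ.* (seq γ m ℚ.* seq γ m)  ≤⟨ *-monoˡ (ι q) (0≤ι q) (*-mono-≤ 0≤γ (ℚₚ.≤-trans 0≤γ γ≤) γ≤ γ≤) ⟩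
      ι q ℚ.* ((8ℚ ℚ.+ 8ℚ) ℚ.* g ℚ.* ((8ℚ ℚ.+ 8ℚ) ℚ.* g)) ≡⟨ solve 3 (λ q s g → q :* (s :* g :* (s :* g)) := s :* s :* (q :* (g :* g))) refl (ι q) (8ℚ ℚ.+ 8ℚ) g ⟩
      (8ℚ ℚ.+ 8ℚ) ℚ.* (8ℚ ℚ.+ 8ℚ) ℚ.* (ι q ℚ.* (g ℚ.* g)) ≡⟨ cong (ℚ._* (ι q ℚ.* (g ℚ.* g))) (sym σ≡) ⟩
      ι σ ℚ.* (ι q ℚ.* (g ℚ.* g))  ≤⟨ *-monoˡ (ι σ) (0≤ι σ) ιq ⟩
      ι σ ℚ.* ι (α * volume)  ≤⟨ rational ⟩
      ι c ℚ.* ι n ℚ.* (+ a ℚ./ ℕ.suc b)  ≡⟨ cong₂ (λ x y → x ℚ.* y ℚ.* (+ a ℚ./ ℕ.suc b)) (ι-def c) (ι-def n) ⟩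
      (+ c ℚ./ 1) ℚ.* (+ n ℚ./ 1) ℚ.* (+ a ℚ./ ℕ.suc b) ∎
      where
      open ℚₚ.≤-Reasoning
      open ℚ-Solver

  comparison-bound : ComparisonBound p (256 * (224 * 545)) (comparisons streaming-algorithm)
  comparison-bound = comparison-bound-for 256 224 545 (comparisons streaming-algorithm) (ι-def 256)
    (Within.queries≤ (within-algorithm n k G h (ℕ.suc B) w 1≤k 1≤h)) efficient

  success-bound : ∀ (_≺_ : Rel (Fin n) 0ℓ) (order : IsStrictTotalOrder _≡_ _≺_) (adversary : Adversary) →
                  1ᵣ -ᵣ δ ≤ᵣ successProbability order γ k adversary streaming-algorithm
  success-bound _≺_ order adversary =
    ≤ᵣ-trans {1ᵣ -ᵣ δ} {fromℚ (1ℚ ℚ.- φ)} {successProbability order γ k adversary streaming-algorithm}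
      (eventually-≤ {1ᵣ -ᵣ δ} {fromℚ (1ℚ ℚ.- φ)} (eventually-map (λ le → ℚₚ.≤-trans le (ℚₚ.≤-reflexive
        (solve 1 (λ x → x := con 1ℚ :- (con 1ℚ :- x)) refl (uniform B ℚ.* (1ℚ ℚ.- ι (4096 * k) ℚ.* ℚ.½ ^ h))))) succeeds))
      (Failure.fails⇒success order k γ adversary g above γ≤½ {streaming-algorithm} {φ}
        (Streaming.algorithm-fails order adversary above γ≤½ 0≤g g≤½ (proj₂ largest) w h
          (proj₁ block) 1≤k 1≤G gG (proj₂ block)))
    where
    open ℚ-Solver
    φ : ℚ
    φ = 1ℚ ℚ.- uniform B ℚ.* (1ℚ ℚ.- ι (4096 * k) ℚ.* ℚ.½ ^ h)
    largest : ∃ (IsLargest order k)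
    largest = largest-exists order 1≤k k≤n
    block : ∃ λ (o : Fin (ℕ.suc B)) → ∀ {x} → x ∈ proj₁ largest → toℕ o * w ≤ toℕ x × toℕ x ℕ.< toℕ o * w ℕ.+ w
    block = covers (proj₁ (proj₂ largest))

theorem3 : ∃ λ (C₁ : ℕ) → ∃ λ (C₂ : ℕ) →
    Σ ((p : Parameters) → StreamingAlgorithm (Parameters.n p)) λ algorithm →
    ∀ (p : Parameters) → let open Parameters p in
    peakMemory (algorithm p) ≤ C₁ * k
    × ComparisonBound p C₂ (comparisons (algorithm p))
    × (∀ (_≺_ : Rel (Fin n) 0ℓ) (order : IsStrictTotalOrder _≡_ _≺_) (adversary : Adversary) →
    1ᵣ -ᵣ δ ≤ᵣ successProbability order γ k adversary (algorithm p))
theorem3 = 17 , 256 * (224 * 545) , (λ p → Tuned.streaming-algorithm p (p-rate p) (choice p)) , λ p →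
    Tuned.memory-bound p (p-rate p) (choice p)
  , Tuned.comparison-bound p (p-rate p) (choice p)
  , Tuned.success-bound p (p-rate p) (choice p)
  where
  p-rate : ∀ p → Rate (Parameters.γ p)
  p-rate p = rate (Parameters.0<γ p) (Parameters.γ≤½ p)
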